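{- Let $p$ be a prime and $q$ a prime power with $q\equiv1 \pmod{p}$. Then $$(q-1)\left(h(q,z)-\frac{1}{p}h(q^p,z^p)\right)\in \mathbb{Z}_p[[z]].$$
   Context: For a number $Q$ (here a power of a prime power), $h(Q,z)=\log f(Q,z)\in\mathbb{Q}[[z]]$, where $f(Q,z)=\sum_{n\geq0}\frac{(-1)^nz^n}{Q^{\binom{n}{2}}(Q;Q)_n}$ and $(Q;Q)_n=\prod_{i=1}^n(1-Q^i)$. $\mathbb{Z}_p$ denotes the $p$-adic integers. -}

module Defs where

open import Data.Nat as ℕ using (ℕ; zero; suc; _∸_; _≥_)
open import Data.Nat.Divisibility using (_∣_; _∣?_; quotient)
open import Data.Nat.Combinatorics using (_C_)
open import Data.Nat.Primality using (Prime)
open import Data.Integer as ℤ using (ℤ; +_)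
open import Data.Rational
  using (ℚ; 0ℚ; 1ℚ; _+_; _*_; _-_; -_; 1/_; _≟_; ≢-nonZero; _/_)
open import Data.Product using (∃₂; _×_)
open import Relation.Nullary using (yes; no; ¬_)
open import Relation.Binary.PropositionalEquality using (_≡_)

-- Formal power series over ℚ, represented by their coefficient sequences.
PS : Set
PS = ℕ → ℚ

-- Total division on ℚ (x ÷₀ 0 = 0); only ever used with nonzero divisors.
inv : ℚ → ℚ
inv y with y ≟ 0ℚ
... | yes _ = 0ℚ
... | no ne = 1/_ y {{≢-nonZero ne}}

_÷₀_ : ℚ → ℚ → ℚ
x ÷₀ y = x * inv y

ℕ→ℚ : ℕ → ℚ
ℕ→ℚ n = + n / 1

_^ℚ_ : ℚ → ℕ → ℚ
x ^ℚ zero = 1ℚ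
x ^ℚ suc n = x * (x ^ℚ n)

sumTo : ℕ → (ℕ → ℚ) → ℚ
sumTo zero g = 0ℚ
sumTo (suc n) g = sumTo n g + g n

qPoch : ℚ → ℕ → ℚ
qPoch Q zero = 1ℚ
qPoch Q (suc n) = qPoch Q n * (1ℚ - (Q ^ℚ suc n))

fSeries : ℕ → PS
fSeries Q n = ((- 1ℚ) ^ℚ n) ÷₀ ((ℕ→ℚ Q ^ℚ (n C 2)) * qPoch (ℕ→ℚ Q) n)

_⊛_ : PS → PS → PS
(f ⊛ g) n = sumTo (suc n) (λ k → f k * g (n ∸ k))

psOne : PS
psOne zero = 1ℚ
psOne (suc n) = 0ℚ

psPow : PS → ℕ → PS
psPow f zero = psOne
psPow f (suc m) = f ⊛ psPow f m

dropConst : PS → PS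
dropConst f zero = 0ℚ
dropConst f (suc n) = f (suc n)

-- log f = Σ_{m≥1} (-1)^{m+1} (f-1)^m / m  (for f with constant term 1);
-- coefficient n only receives contributions from m ≤ n.
psLog : PS → PS
psLog f n = sumTo n (λ k → ((- 1ℚ) ^ℚ k) * ((+ 1 / suc k) * psPow (dropConst f) (suc k) n))

hSeries : ℕ → PS
hSeries Q = psLog (fSeries Q)

substPow : ℕ → PS → PS
substPow p g n with p ∣? n
... | yes d = g (quotient d)
... | no _ = 0ℚ

InZp : ℕ → ℚ → Set
InZp p r = ¬ (p ∣ ℚ.denominatorℕ r)

InZpSeries : ℕ → PS → Set
InZpSeries p g = ∀ n → InZp p (g n)

IsPrimePower : ℕ → Set
IsPrimePower q = ∃₂ λ ℓ k → Prime ℓ × k ≥ 1 × q ≡ ℓ ℕ.^ k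

theSeries : ℕ → ℕ → PS
theSeries p q n =
  ℕ→ℚ (q ∸ 1) * (hSeries q n - (1ℚ ÷₀ ℕ→ℚ p) * substPow p (hSeries (q ℕ.^ p)) n)

{-# OPTIONS --safe #-}
-- With t = 1/q put v(z) = f(q,qz) / f(q,z).  Then v(z) = 1 + z / v(tz), so v ∈ ℤ[t][[z]], and
-- logarithmic derivatives give n (qⁿ - 1) hₙ(q) = bₙ(t) with Σ bₙ zⁿ = z v′/v.  The n-th
-- coefficient of the series in question is therefore
--   (q - 1) Vₙ(1/q) / (n (qⁿ - 1)),   Vₙ = bₙ(t) - bₙ/ₚ(tᵖ)
-- (without the second term if p ∤ n).  Write n = pʳ m with p ∤ m.  As q ≡ 1 mod p, this is
-- p-integral once pʳ (1 + t + … + t^(pʳ-1)) divides Vₙ in ℤ[t].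
--
-- Divisibility by pʳ is a Gauss congruence, which follows from
-- v(t,z)^(pʳ) ≡ v(tᵖ,zᵖ)^(pʳ⁻¹) mod pʳ.  For divisibility by Φ_(pⁱ), 1 ≤ i ≤ r, let ζ be a root of
-- Φ_(pⁱ) and e = pⁱ.  The product λ = v(z) v(ζz) ⋯ v(ζ^(e-1) z) is an eigenvalue of a product of
-- 2×2 matrices whose determinant is -zᵉ and whose trace T is a polynomial in z of degree < e.
-- Since λ is invariant under z ↦ ζz and agrees with T below zᵉ, T = 1 and λ² = λ + zᵉ.
-- The analogous product for (ζᵖ, e/p), evaluated at zᵖ, satisfies the same equation, hence
-- equals λ, and comparing logarithmic derivatives gives bₙ(ζ) = bₙ/ₚ(ζᵖ).  The divisors combine
-- because Φ_(pⁱ) ≡ p modulo 1 + t + … + t^(pⁱ⁻¹-1), and because a polynomial with constant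
-- term 1 can be cancelled modulo powers of p.
module Submission where

open import Defs
open import Algebra.Bundles using (CommutativeRing; RawRing)
import Algebra.Morphism.RingMonomorphism
open import Algebra.Morphism.Structures using (IsRingMonomorphism)
import Algebra.Properties.CommutativeMonoid.Mult
import Algebra.Properties.CommutativeSemiring.Binomial
import Algebra.Properties.CommutativeSemiring.Exp
import Algebra.Properties.Group
import Algebra.Properties.Ring
import Algebra.Properties.Semiring.Mult
import Algebra.Properties.Semiring.Mult.TCOptimised
import Algebra.Properties.Semiring.Sum
import Algebra.Solver.Ring
open import Algebra.Solver.Ring.AlmostCommutativeRing
  using (_-Raw-AlmostCommutative⟶_; fromCommutativeRing)
open import Data.Fin as Fin using (Fin; toℕ; inject₁; fromℕ)
import Data.Fin.Properties as Fin
open import Data.Integer as ℤ using (ℤ; +_; -[1+_])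
import Data.Integer.Divisibility.Signed as ℤ∣
import Data.Integer.Properties as ℤ
open import Data.List as List using (List; []; _∷_; length)
open import Data.Maybe.Base using (Maybe; just; nothing)
open import Data.Nat as ℕ using (ℕ; zero; suc; z≤n; s≤s; _∸_; _!)
open import Data.Nat.Combinatorics
  using (_C_; nCk≡n!/k![n-k]!; k![n∸k]!∣n!; nCn≡1; nC1≡n; nCk+nC[k+1]≡[n+1]C[k+1])
open import Data.Nat.Coprimality as Coprimality using (coprime-divisor; 1-coprimeTo)
open import Data.Nat.Divisibility
  using (_∣_; _∣?_; divides; ∣1⇒≡1; ∣⇒≤; ∣-trans; m∣m*n; n∣m*n; *-cancelʳ-∣; ∣m+n∣m⇒∣n)
open import Data.Nat.DivMod using (m/n*n≡m)
open import Data.Nat.GCD using (gcd; gcd-GCD; gcd[m,n]∣m; gcd[m,n]∣n; module Bézout)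
open import Data.Nat.Primality
  using (Prime; ¬prime[0]; euclidsLemma; prime⇒nonZero; prime⇒irreducible; prime⇒nonTrivial)
import Data.Nat.Properties as ℕ
open import Data.Nat.Tactic.RingSolver using (solve-∀)
open import Data.Product as Product using (∃; ∃₂; _,_; proj₁; proj₂)
open import Data.Rational as ℚ using (ℚ; mkℚ; 0ℚ; 1ℚ; ↥_; toℚᵘ)
import Data.Rational.Properties as ℚ
import Data.Rational.Unnormalised as ℚᵘ
import Data.Rational.Unnormalised.Properties as ℚᵘ
open import Data.Sum using (_⊎_; inj₁; inj₂)
open import Level using (0ℓ)
open import Relation.Binary.PropositionalEquality as ≡ using (_≡_; _≢_)
import Relation.Binary.Reasoning.Setoid
open import Relation.Nullary using (¬_; Dec; yes; no; contradiction)

-- The passage from `f` to `v` removes denominators: `f` involves (q;q)ₙ and hₙ involves qⁿ - 1, so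
-- neither can be specialised to a root of unity, whereas the coefficients of v and of z v′/v are
-- polynomials in t. Integrality is proved as a divisibility of polynomials because the p-part of 1
-- + q + ... + q^(pʳ-1) is not determined by p and r: for p = 2 and r = 1 it is the 2-part of 1 + q,
-- so no fixed power of p would do. With N = pʳ, qⁿ - 1 = (q - 1) (1 + ... + q^(N-1)) (1 + q^N + ...
-- + q^((m-1)N)). The last factor is congruent to m modulo p, and replacing 1/q by q in the middle
-- one costs only powers of q, which are prime to p. The root ζ is the class of t in ℤ[t]/(Φ).
-- Rather than showing that this ring is a domain, the argument uses only that multiplication by p
-- is injective on it: an x fixed by a nontrivial power of ζ is fixed by ζ^(pⁱ⁻¹), and then Φ(ζ) = 0
-- turns into p x = 0.

-- The unique ring homomorphism from ℤ, which lets the solver use integer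
-- coefficients (and hence cancel x against - x) in an abstract ring.
module Ringℤ (R : CommutativeRing 0ℓ 0ℓ) where
  open CommutativeRing R
  open Algebra.Properties.Semiring.Mult.TCOptimised semiring
    using (_×_; 1+×; ×-homo-+; ×1-homo-*; ×ᵤ≈×)
  open Algebra.Properties.Semiring.Mult semiring using (×-assoc-*) renaming (_×_ to _×ᵤ_)
  open Algebra.Properties.Ring ring
    using (-‿involutive; -0#≈0#; -‿distribˡ-*; -‿distribʳ-*; -‿anti-homo-+)
  open Algebra.Properties.Group +-group public using ()
    renaming (x∙y⁻¹≈ε⇒x≈y to x-y≈0⇒x≈y; x≈y⇒x∙y⁻¹≈ε to x≈y⇒x-y≈0)
  open Relation.Binary.Reasoning.Setoid setoid

  ι : ℤ → Carrier
  ι (+ n) = n × 1#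
  ι -[1+ n ] = - (suc n × 1#)

  private
    shuffle : ∀ x a b → a - b ≈ (x + a) - (x + b)
    shuffle x a b = begin
      a - b ≈⟨ +-congʳ (+-identityˡ a) ⟨
      (0# + a) - b ≈⟨ +-congʳ (+-congʳ (-‿inverseʳ x)) ⟨
      ((x - x) + a) - b ≈⟨ +-congʳ (+-assoc x (- x) a) ⟩
      (x + (- x + a)) - b ≈⟨ +-congʳ (+-congˡ (+-comm (- x) a)) ⟩
      (x + (a - x)) - b ≈⟨ +-congʳ (+-assoc x a (- x)) ⟨
      ((x + a) - x) - b ≈⟨ +-assoc (x + a) (- x) (- b) ⟩
      (x + a) + (- x - b) ≈⟨ +-congˡ (+-comm (- x) (- b)) ⟩
      (x + a) + (- b - x) ≈⟨ +-congˡ (-‿anti-homo-+ x b) ⟨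
      (x + a) - (x + b) ∎

  ι-⊖ : ∀ m n → ι (m ℤ.⊖ n) ≈ m × 1# - n × 1#
  ι-⊖ zero zero = sym (-‿inverseʳ 0#)
  ι-⊖ (suc m) zero = trans (sym (+-identityʳ _)) (+-congˡ (sym -0#≈0#))
  ι-⊖ zero (suc n) = sym (+-identityˡ _)
  ι-⊖ (suc m) (suc n) = begin
    ι (suc m ℤ.⊖ suc n) ≡⟨ ≡.cong ι (ℤ.[1+m]⊖[1+n]≡m⊖n m n) ⟩
    ι (m ℤ.⊖ n) ≈⟨ ι-⊖ m n ⟩
    m × 1# - n × 1# ≈⟨ shuffle 1# (m × 1#) (n × 1#) ⟩
    (1# + m × 1#) - (1# + n × 1#) ≈⟨ +-cong (1+× m 1#) (-‿cong (1+× n 1#)) ⟨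
    suc m × 1# - suc n × 1# ∎

  ι-neg : ∀ i → ι (ℤ.- i) ≈ - ι i
  ι-neg (+ zero) = sym -0#≈0#
  ι-neg (+ suc n) = refl
  ι-neg -[1+ n ] = sym (-‿involutive _)

  ι-+ : ∀ i j → ι (i ℤ.+ j) ≈ ι i + ι j
  ι-+ (+ m) (+ n) = ×-homo-+ 1# m n
  ι-+ (+ m) -[1+ n ] = ι-⊖ m (suc n)
  ι-+ -[1+ m ] (+ n) = trans (ι-⊖ n (suc m)) (+-comm _ _)
  ι-+ -[1+ m ] -[1+ n ] = begin
    - (suc (suc (m ℕ.+ n)) × 1#) ≡⟨ ≡.cong (λ k → - (k × 1#)) (≡.cong suc (≡.sym (ℕ.+-suc m n))) ⟩
    - ((suc m ℕ.+ suc n) × 1#) ≈⟨ -‿cong (×-homo-+ 1# (suc m) (suc n)) ⟩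
    - (suc m × 1# + suc n × 1#) ≈⟨ -‿anti-homo-+ _ _ ⟩
    - (suc n × 1#) - suc m × 1# ≈⟨ +-comm _ _ ⟩
    - (suc m × 1#) - suc n × 1# ∎

  private
    ι-+* : ∀ m j → ι (+ m ℤ.* j) ≈ m × 1# * ι j
    ι-+* m (+ n) = trans (reflexive (≡.cong ι (≡.sym (ℤ.pos-* m n)))) (×1-homo-* m n)
    ι-+* m -[1+ n ] = begin
      ι (+ m ℤ.* ℤ.- (+ suc n)) ≡⟨ ≡.cong ι (ℤ.neg-distribʳ-* (+ m) (+ suc n)) ⟨
      ι (ℤ.- (+ m ℤ.* + suc n)) ≈⟨ ι-neg (+ m ℤ.* + suc n) ⟩
      - ι (+ m ℤ.* + suc n) ≈⟨ -‿cong (ι-+* m (+ suc n)) ⟩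
      - (m × 1# * (suc n × 1#)) ≈⟨ -‿distribʳ-* _ _ ⟩
      m × 1# * - (suc n × 1#) ∎

  ι-* : ∀ i j → ι (i ℤ.* j) ≈ ι i * ι j
  ι-* (+ m) j = ι-+* m j
  ι-* -[1+ m ] j = begin
    ι (ℤ.- (+ suc m) ℤ.* j) ≡⟨ ≡.cong ι (ℤ.neg-distribˡ-* (+ suc m) j) ⟨
    ι (ℤ.- (+ suc m ℤ.* j)) ≈⟨ ι-neg (+ suc m ℤ.* j) ⟩
    - ι (+ suc m ℤ.* j) ≈⟨ -‿cong (ι-+* (suc m) j) ⟩
    - (suc m × 1# * ι j) ≈⟨ -‿distribˡ-* _ _ ⟩
    - (suc m × 1#) * ι j ∎

  -- Turns iterated addition into a product with a ring element, the form in which the ring solver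
  -- can handle it.
  ι-× : ∀ n x → n ×ᵤ x ≈ ι (+ n) * x
  ι-× n x = begin
    n ×ᵤ x ≈⟨ Algebra.Properties.Semiring.Mult.×-congʳ semiring n (*-identityˡ x) ⟨
    n ×ᵤ (1# * x) ≈⟨ ×-assoc-* n 1# x ⟨
    n ×ᵤ 1# * x ≈⟨ *-congʳ (×ᵤ≈× n 1#) ⟩
    n × 1# * x ∎

  private
    morphism : ℤ.+-*-rawRing -Raw-AlmostCommutative⟶ fromCommutativeRing R
    morphism = record
      { ⟦_⟧ = ι ; +-homo = ι-+ ; *-homo = ι-* ; -‿homo = ι-neg
      ; 0-homo = refl ; 1-homo = refl }

    ι≟ : ∀ i j → Maybe (ι i ≈ ι j)
    ι≟ i j with i ℤ.≟ j
    ... | yes ≡.refl = just refl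
    ... | no _ = nothing

  open Algebra.Solver.Ring ℤ.+-*-rawRing (fromCommutativeRing R) morphism ι≟ public
    using (solve; _:=_; _:+_; _:*_; _:-_; :-_; con)


-- Powers, ring homomorphisms and formal power series.

module Powers (R : CommutativeRing 0ℓ 0ℓ) where
  open CommutativeRing R
  open Algebra.Properties.CommutativeSemiring.Exp commutativeSemiring using (_^_; ^-distrib-*)

  ^-one : ∀ {x} n → x ≈ 1# → x ^ n ≈ 1#
  ^-one zero eq = refl
  ^-one (suc n) eq = trans (*-cong eq (^-one n eq)) (*-identityˡ 1#)

  ^-inverse : ∀ {x y} n → x * y ≈ 1# → x ^ n * y ^ n ≈ 1#
  ^-inverse {x} {y} n eq = trans (sym (^-distrib-* x y n)) (^-one n eq)

record RingHom (A B : CommutativeRing 0ℓ 0ℓ) : Set where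
  private module A = CommutativeRing A
  private module B = CommutativeRing B
  field
    ⟦_⟧ : A.Carrier → B.Carrier
    ⟦⟧-cong : ∀ {x y} → x A.≈ y → ⟦ x ⟧ B.≈ ⟦ y ⟧
    +-homo : ∀ x y → ⟦ x A.+ y ⟧ B.≈ ⟦ x ⟧ B.+ ⟦ y ⟧
    *-homo : ∀ x y → ⟦ x A.* y ⟧ B.≈ ⟦ x ⟧ B.* ⟦ y ⟧
    1-homo : ⟦ A.1# ⟧ B.≈ B.1#

  open Algebra.Properties.Ring B.ring
  open Algebra.Properties.Semiring.Mult A.semiring using () renaming (_×_ to _×ᴬ_)
  open Algebra.Properties.Semiring.Mult B.semiring using () renaming (_×_ to _×ᴮ_)
  open Algebra.Properties.CommutativeSemiring.Exp A.commutativeSemiring using () renaming (_^_ to _^ᴬ_)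
  open Algebra.Properties.CommutativeSemiring.Exp B.commutativeSemiring using () renaming (_^_ to _^ᴮ_)

  0-homo : ⟦ A.0# ⟧ B.≈ B.0#
  0-homo = +-identityˡ-unique ⟦ A.0# ⟧ ⟦ A.0# ⟧
    (B.trans (B.sym (+-homo A.0# A.0#)) (⟦⟧-cong (A.+-identityˡ A.0#)))

  neg-homo : ∀ x → ⟦ A.- x ⟧ B.≈ B.- ⟦ x ⟧
  neg-homo x = +-inverseˡ-unique ⟦ A.- x ⟧ ⟦ x ⟧
    (B.trans (B.sym (+-homo (A.- x) x)) (B.trans (⟦⟧-cong (A.-‿inverseˡ x)) 0-homo))

  ×-homo : ∀ n x → ⟦ n ×ᴬ x ⟧ B.≈ n ×ᴮ ⟦ x ⟧
  ×-homo zero x = 0-homo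
  ×-homo (suc n) x = B.trans (+-homo x (n ×ᴬ x)) (B.+-congˡ (×-homo n x))

  ^-homo : ∀ x n → ⟦ x ^ᴬ n ⟧ B.≈ ⟦ x ⟧ ^ᴮ n
  ^-homo x zero = 1-homo
  ^-homo x (suc n) = B.trans (*-homo x (x ^ᴬ n)) (B.*-congˡ (^-homo x n))

module PowerSeries (R : CommutativeRing 0ℓ 0ℓ) where
  open CommutativeRing R hiding (zero)
  open Algebra.Properties.Semiring.Mult semiring using (_×_; ×-congʳ; ×-comm-*; ×-assocˡ)
  open Algebra.Properties.CommutativeMonoid.Mult +-commutativeMonoid using (×-distrib-+)
  open Algebra.Properties.CommutativeSemiring.Exp commutativeSemiring using (_^_)
  open Ringℤ R using (solve; _:=_; _:+_; _:*_; con)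
  open Relation.Binary.Reasoning.Setoid setoid

  Series : Set
  Series = ℕ → Carrier

  infix 4 _≋_
  -- A record rather than a bare function type, so that both series can be inferred from a proof of
  -- their equality.
  record _≋_ (f g : Series) : Set where
    constructor pointwise
    field at : ∀ n → f n ≈ g n
  open _≋_ public

  tail : Series → Series
  tail f n = f (suc n)

  infixl 6 _⊕_
  infixl 7 _⊗_ _·_
  -- The Cauchy product through f g = f(0) g + z (tail f) g. The ring laws become inductions on the
  -- index, without reindexing of finite sums.
  _⊕_ _⊗_ : Series → Series → Series
  (f ⊕ g) n = f n + g n
  (f ⊗ g) zero = f 0 * g 0
  (f ⊗ g) (suc n) = f 0 * g (suc n) + (tail f ⊗ g) n

  _·_ : Carrier → Series → Series
  (c · f) n = c * f n

  neg : Series → Series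
  neg f n = - f n

  const : Carrier → Series
  const c zero = c
  const c (suc n) = 0#

  shift : Series → Series
  shift f zero = 0#
  shift f (suc n) = f n

  -- Only coefficients up to n enter coefficient n of a product; the causality of the fixed-point
  -- operators below rests on this.
  ⊗-cong-≤ : ∀ n {f f′ g g′} → (∀ k → k ℕ.≤ n → f k ≈ f′ k) → (∀ k → k ℕ.≤ n → g k ≈ g′ k) →
             (f ⊗ g) n ≈ (f′ ⊗ g′) n
  ⊗-cong-≤ zero p q = *-cong (p 0 z≤n) (q 0 z≤n)
  ⊗-cong-≤ (suc n) p q = +-cong (*-cong (p 0 z≤n) (q (suc n) ℕ.≤-refl))
    (⊗-cong-≤ n (λ k k≤n → p (suc k) (s≤s k≤n)) (λ k k≤n → q k (ℕ.m≤n⇒m≤1+n k≤n)))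

  private
    cong′ : ∀ {f f′ g g′} n → (∀ k → f k ≈ f′ k) → (∀ k → g k ≈ g′ k) → (f ⊗ g) n ≈ (f′ ⊗ g′) n
    cong′ n p q = ⊗-cong-≤ n (λ k _ → p k) (λ k _ → q k)

    zeroˡ′ : ∀ f n → ((λ _ → 0#) ⊗ f) n ≈ 0#
    zeroˡ′ f zero = zeroˡ _
    zeroˡ′ f (suc n) = trans (+-cong (zeroˡ _) (zeroˡ′ f n)) (+-identityˡ 0#)

    distribʳ′ : ∀ f g h n → ((g ⊕ h) ⊗ f) n ≈ (g ⊗ f) n + (h ⊗ f) n
    distribʳ′ f g h zero = distribʳ _ _ _
    distribʳ′ f g h (suc n) = trans (+-congˡ (distribʳ′ f (tail g) (tail h) n))
      (solve 5 (λ a b c x y → (a :+ b) :* c :+ (x :+ y) := (a :* c :+ x) :+ (b :* c :+ y)) refl _ _ _ _ _)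

    ·-assocˡ′ : ∀ c f g n → ((c · f) ⊗ g) n ≈ c * (f ⊗ g) n
    ·-assocˡ′ c f g zero = *-assoc _ _ _
    ·-assocˡ′ c f g (suc n) = trans (+-congˡ (·-assocˡ′ c (tail f) g n))
      (solve 4 (λ c a b x → c :* a :* b :+ c :* x := c :* (a :* b :+ x)) refl _ _ _ _)

    ⊗-sucʳ : ∀ f g n → (f ⊗ g) (suc n) ≈ (f ⊗ tail g) n + f (suc n) * g 0
    ⊗-sucʳ f g zero = refl
    ⊗-sucʳ f g (suc n) = trans (+-congˡ (⊗-sucʳ (tail f) g n)) (sym (+-assoc _ _ _))

    comm′ : ∀ f g n → (f ⊗ g) n ≈ (g ⊗ f) n
    comm′ f g zero = *-comm _ _
    comm′ f g (suc n) = begin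
      f 0 * g (suc n) + (tail f ⊗ g) n ≈⟨ +-cong (*-comm _ _) (comm′ (tail f) g n) ⟩
      g (suc n) * f 0 + (g ⊗ tail f) n ≈⟨ +-comm _ _ ⟩
      (g ⊗ tail f) n + g (suc n) * f 0 ≈⟨ ⊗-sucʳ g f n ⟨
      (g ⊗ f) (suc n) ∎

    assoc′ : ∀ f g h n → ((f ⊗ g) ⊗ h) n ≈ (f ⊗ (g ⊗ h)) n
    assoc′ f g h zero = *-assoc _ _ _
    assoc′ f g h (suc n) = begin
      f 0 * g 0 * h (suc n) + ((f 0 · tail g ⊕ (tail f ⊗ g)) ⊗ h) n
        ≈⟨ +-congˡ (distribʳ′ h (f 0 · tail g) (tail f ⊗ g) n) ⟩
      f 0 * g 0 * h (suc n) + (((f 0 · tail g) ⊗ h) n + ((tail f ⊗ g) ⊗ h) n)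
        ≈⟨ +-congˡ (+-cong (·-assocˡ′ (f 0) (tail g) h n) (assoc′ (tail f) g h n)) ⟩
      f 0 * g 0 * h (suc n) + (f 0 * (tail g ⊗ h) n + (tail f ⊗ (g ⊗ h)) n)
        ≈⟨ solve 5 (λ a b c x y → a :* b :* c :+ (a :* x :+ y) := a :* (b :* c :+ x) :+ y) refl _ _ _ _ _ ⟩
      f 0 * (g ⊗ h) (suc n) + (tail f ⊗ (g ⊗ h)) n ∎

    const-⊗′ : ∀ c f n → (const c ⊗ f) n ≈ c * f n
    const-⊗′ c f zero = refl
    const-⊗′ c f (suc n) = trans (+-congˡ (zeroˡ′ f n)) (+-identityʳ _)

  series : CommutativeRing 0ℓ 0ℓ
  series = record
    { Carrier = Series ; _≈_ = _≋_ ; _+_ = _⊕_ ; _*_ = _⊗_ ; -_ = neg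
    ; 0# = λ _ → 0# ; 1# = const 1#
    ; isCommutativeRing = record
      { isRing = record
        { +-isAbelianGroup = record
          { isGroup = record
            { isMonoid = record
              { isSemigroup = record
                { isMagma = record
                  { isEquivalence = record
                    { refl = pointwise λ _ → refl
                    ; sym = λ p → pointwise λ n → sym (at p n)
                    ; trans = λ p q → pointwise λ n → trans (at p n) (at q n) }
                  ; ∙-cong = λ p q → pointwise λ n → +-cong (at p n) (at q n) }
                ; assoc = λ f g h → pointwise λ n → +-assoc _ _ _ }
              ; identity = (λ f → pointwise λ n → +-identityˡ _) , (λ f → pointwise λ n → +-identityʳ _) }
            ; inverse = (λ f → pointwise λ n → -‿inverseˡ _) , (λ f → pointwise λ n → -‿inverseʳ _)
            ; ⁻¹-cong = λ p → pointwise λ n → -‿cong (at p n) }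
          ; comm = λ f g → pointwise λ n → +-comm _ _ }
        ; *-cong = λ p q → pointwise λ n → cong′ n (at p) (at q)
        ; *-assoc = λ f g h → pointwise (assoc′ f g h)
        ; *-identity = identityˡ
          , (λ f → pointwise λ n → trans (comm′ f (const 1#) n) (at (identityˡ f) n))
        ; distrib =
            (λ f g h → pointwise λ n → trans (comm′ f (g ⊕ h) n)
              (trans (distribʳ′ f g h n) (+-cong (comm′ g f n) (comm′ h f n))))
          , (λ f g h → pointwise (distribʳ′ f g h)) }
      ; *-comm = λ f g → pointwise (comm′ f g) } }
    where
    identityˡ : ∀ f → const 1# ⊗ f ≋ f
    identityˡ f = pointwise λ n → trans (const-⊗′ 1# f n) (*-identityˡ _)

  private
    module S = CommutativeRing series
    module SM = Algebra.Properties.Semiring.Mult S.semiring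
    module SE = Algebra.Properties.CommutativeSemiring.Exp S.commutativeSemiring

  ×-at : ∀ k f n → (k SM.× f) n ≈ k × f n
  ×-at zero f n = refl
  ×-at (suc k) f n = +-congˡ (×-at k f n)

  const-⊗ : ∀ c f → const c ⊗ f ≋ c · f
  const-⊗ c f = pointwise (const-⊗′ c f)

  ·-⊗ : ∀ c f g → (c · f) ⊗ g ≋ c · (f ⊗ g)
  ·-⊗ c f g = pointwise (·-assocˡ′ c f g)

  shift-cong : ∀ {f g} → f ≋ g → shift f ≋ shift g
  shift-cong p = pointwise λ { zero → refl ; (suc n) → at p n }

  shift-⊗ : ∀ f g → shift f ⊗ g ≋ shift (f ⊗ g)
  shift-⊗ f g = pointwise λ
    { zero → zeroˡ _
    ; (suc n) → trans (+-congʳ (zeroˡ _)) (+-identityˡ _) }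

  -- The lowest coefficient of x is seen to vanish, and the same argument applies to its tail. This
  -- replaces division by a series with constant term 1.
  ⊗-cancel : ∀ {f} x → f 0 ≈ 1# → x ⊗ f ≋ (λ _ → 0#) → x ≋ (λ _ → 0#)
  ⊗-cancel {f} x f₀ p = pointwise (go x (at p))
    where
    head : ∀ x → (∀ n → (x ⊗ f) n ≈ 0#) → x 0 ≈ 0#
    head x p = trans (sym (*-identityʳ _)) (trans (*-congˡ (sym f₀)) (p 0))
    go : ∀ x → (∀ n → (x ⊗ f) n ≈ 0#) → ∀ n → x n ≈ 0#
    go x p zero = head x p
    go x p (suc n) = go (tail x) (λ k → begin
      (tail x ⊗ f) k ≈⟨ +-identityˡ _ ⟨
      0# + (tail x ⊗ f) k ≈⟨ +-congʳ (trans (*-congʳ (head x p)) (zeroˡ _)) ⟨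
      (x ⊗ f) (suc k) ≈⟨ p (suc k) ⟩
      0# ∎) n

  private
    ×-0 : ∀ n → n × 0# ≈ 0#
    ×-0 zero = refl
    ×-0 (suc n) = trans (+-identityˡ _) (×-0 n)

  -- The Euler operator z d/dz, which preserves the indexing of coefficients.
  θ : Series → Series
  θ f n = n × f n

  θ-cong : ∀ {f g} → f ≋ g → θ f ≋ θ g
  θ-cong p = pointwise λ n → ×-congʳ n (at p n)

  θ-⊕ : ∀ f g → θ (f ⊕ g) ≋ θ f ⊕ θ g
  θ-⊕ f g = pointwise λ n → ×-distrib-+ (f n) (g n) n

  θ-× : ∀ k f → θ (k SM.× f) ≋ k SM.× θ f
  θ-× k f = pointwise λ n → begin
    n × (k SM.× f) n ≈⟨ ×-congʳ n (×-at k f n) ⟩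
    n × (k × f n) ≈⟨ ×-assocˡ (f n) n k ⟩
    (n ℕ.* k) × f n ≡⟨ ≡.cong (_× f n) (ℕ.*-comm n k) ⟩
    (k ℕ.* n) × f n ≈⟨ ×-assocˡ (f n) k n ⟨
    k × (n × f n) ≈⟨ ×-at k (θ f) n ⟨
    (k SM.× θ f) n ∎

  private
    θ-⊗′ : ∀ f g n → n × (f ⊗ g) n ≈ (θ f ⊗ g) n + (f ⊗ θ g) n
    θ-⊗′ f g zero = sym (trans (+-cong (zeroˡ _) (zeroʳ _)) (+-identityˡ 0#))
    θ-⊗′ f g (suc n) = begin
      suc n × (f 0 * g (suc n) + (tail f ⊗ g) n)
        ≈⟨ ×-distrib-+ _ _ (suc n) ⟩
      suc n × (f 0 * g (suc n)) + ((tail f ⊗ g) n + n × (tail f ⊗ g) n)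
        ≈⟨ +-cong (sym (×-comm-* (suc n) _ _)) (+-congˡ (θ-⊗′ (tail f) g n)) ⟩
      f 0 * (suc n × g (suc n)) + ((tail f ⊗ g) n + ((θ (tail f) ⊗ g) n + (tail f ⊗ θ g) n))
        ≈⟨ solve 5 (λ a y b c d → a :+ (b :+ (c :+ d)) := con ℤ.0ℤ :* y :+ (b :+ c) :+ (a :+ d)) refl _ (g (suc n)) _ _ _ ⟩
      0# * g (suc n) + ((tail f ⊗ g) n + (θ (tail f) ⊗ g) n) + (f 0 * θ g (suc n) + (tail f ⊗ θ g) n)
        ≈⟨ +-congʳ (+-congˡ (distribʳ′ g (tail f) (θ (tail f)) n)) ⟨
      0# * g (suc n) + (tail (θ f) ⊗ g) n + (f 0 * θ g (suc n) + (tail f ⊗ θ g) n) ∎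

  θ-⊗ : ∀ f g → θ (f ⊗ g) ≋ (θ f ⊗ g) ⊕ (f ⊗ θ g)
  θ-⊗ f g = pointwise (θ-⊗′ f g)

  θ-const : ∀ c → θ (const c) ≋ (λ _ → 0#)
  θ-const c = pointwise λ { zero → refl ; (suc n) → ×-0 (suc n) }

  θ-^ : ∀ f n → θ (f SE.^ suc n) ≋ suc n SM.× (f SE.^ n ⊗ θ f)
  θ-^ f zero = S.trans (θ-cong (S.*-identityʳ f))
    (S.trans (S.sym (S.*-identityˡ (θ f))) (S.sym (S.+-identityʳ _)))
  θ-^ f (suc n) = S.trans (θ-⊗ f (f SE.^ suc n)) (S.+-cong (S.*-comm _ _)
    (S.trans (S.*-congˡ (θ-^ f n)) (S.trans (SM.×-comm-* (suc n) _ _)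
      (SM.×-congʳ (suc n) (S.sym (S.*-assoc _ _ _))))))

  scale : Carrier → Series → Series
  scale c f n = c ^ n * f n

  scaleHom : Carrier → RingHom series series
  scaleHom c = record
    { ⟦_⟧ = scale c
    ; ⟦⟧-cong = λ p → pointwise λ n → *-congˡ (at p n)
    ; +-homo = λ f g → pointwise λ n → distribˡ _ _ _
    ; *-homo = λ f g → pointwise (scale-⊗ f g)
    ; 1-homo = pointwise λ { zero → *-identityˡ _ ; (suc n) → zeroʳ _ } }
    where
    scale-⊗ : ∀ f g n → c ^ n * (f ⊗ g) n ≈ (scale c f ⊗ scale c g) n
    scale-⊗ f g zero = solve 2 (λ a b → con ℤ.1ℤ :* (a :* b) := con ℤ.1ℤ :* a :* (con ℤ.1ℤ :* b)) refl (f 0) (g 0)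
    scale-⊗ f g (suc n) = begin
      c * c ^ n * (f 0 * g (suc n) + (tail f ⊗ g) n)
        ≈⟨ solve 5 (λ c d a b x → c :* d :* (a :* b :+ x) := a :* (c :* d :* b) :+ c :* (d :* x)) refl c (c ^ n) (f 0) (g (suc n)) _ ⟩
      f 0 * (c * c ^ n * g (suc n)) + c * (c ^ n * (tail f ⊗ g) n)
        ≈⟨ +-cong (*-congʳ (sym (*-identityˡ _))) (*-congˡ (scale-⊗ (tail f) g n)) ⟩
      1# * f 0 * scale c g (suc n) + c * (scale c (tail f) ⊗ scale c g) n
        ≈⟨ +-congˡ (·-assocˡ′ c (scale c (tail f)) (scale c g) n) ⟨
      1# * f 0 * scale c g (suc n) + ((c · scale c (tail f)) ⊗ scale c g) n
        ≈⟨ +-congˡ (cong′ n (λ k → sym (*-assoc c (c ^ k) (f (suc k)))) (λ _ → refl)) ⟩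
      1# * f 0 * scale c g (suc n) + (tail (scale c f) ⊗ scale c g) n ∎

  θ-scale : ∀ c f → θ (scale c f) ≋ scale c (θ f)
  θ-scale c f = pointwise λ n → sym (×-comm-* n _ _)

  -- expandAt k j f is z^j f(z^(1+k)).
  module _ (k : ℕ) where
    expandAt : ℕ → Series → Series
    expandAt zero f zero = f 0
    -- The counter restarts at k: after each coefficient of f come k zeros.
    expandAt zero f (suc n) = expandAt k (tail f) n
    expandAt (suc j) f zero = 0#
    expandAt (suc j) f (suc n) = expandAt j f n

    expandAt-0 : ∀ j n → expandAt j (λ _ → 0#) n ≈ 0#
    expandAt-0 zero zero = refl
    expandAt-0 zero (suc n) = expandAt-0 k n
    expandAt-0 (suc j) zero = refl
    expandAt-0 (suc j) (suc n) = expandAt-0 j n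

    private
      expandAt-cong : ∀ j {f g} → f ≋ g → ∀ n → expandAt j f n ≈ expandAt j g n
      expandAt-cong zero p zero = at p 0
      expandAt-cong zero p (suc n) = expandAt-cong k (pointwise λ m → at p (suc m)) n
      expandAt-cong (suc j) p zero = refl
      expandAt-cong (suc j) p (suc n) = expandAt-cong j p n

      expandAt-⊕ : ∀ j f g n → expandAt j (f ⊕ g) n ≈ expandAt j f n + expandAt j g n
      expandAt-⊕ zero f g zero = refl
      expandAt-⊕ zero f g (suc n) = expandAt-⊕ k (tail f) (tail g) n
      expandAt-⊕ (suc j) f g zero = sym (+-identityˡ 0#)
      expandAt-⊕ (suc j) f g (suc n) = expandAt-⊕ j f g n

      expandAt-· : ∀ j c f n → expandAt j (c · f) n ≈ c * expandAt j f n
      expandAt-· zero c f zero = refl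
      expandAt-· zero c f (suc n) = expandAt-· k c (tail f) n
      expandAt-· (suc j) c f zero = sym (zeroʳ c)
      expandAt-· (suc j) c f (suc n) = expandAt-· j c f n

      expandAt-⊗ : ∀ j f g n → expandAt j (f ⊗ g) n ≈ (expandAt j f ⊗ expandAt zero g) n
      expandAt-⊗ zero f g zero = refl
      expandAt-⊗ zero f g (suc n) = begin
        expandAt k (f 0 · tail g ⊕ (tail f ⊗ g)) n
          ≈⟨ expandAt-⊕ k (f 0 · tail g) (tail f ⊗ g) n ⟩
        expandAt k (f 0 · tail g) n + expandAt k (tail f ⊗ g) n
          ≈⟨ +-cong (expandAt-· k (f 0) (tail g) n) (expandAt-⊗ k (tail f) g n) ⟩
        f 0 * expandAt k (tail g) n + (expandAt k (tail f) ⊗ expandAt zero g) n ∎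
      expandAt-⊗ (suc j) f g zero = sym (zeroˡ _)
      expandAt-⊗ (suc j) f g (suc n) = begin
        expandAt j (f ⊗ g) n ≈⟨ expandAt-⊗ j f g n ⟩
        (expandAt j f ⊗ expandAt zero g) n ≈⟨ +-identityˡ _ ⟨
        0# + (expandAt j f ⊗ expandAt zero g) n ≈⟨ +-congʳ (zeroˡ _) ⟨
        0# * expandAt zero g (suc n) + (expandAt j f ⊗ expandAt zero g) n ∎

      expandAt-1 : ∀ n → expandAt zero (const 1#) n ≈ const 1# n
      expandAt-1 zero = refl
      expandAt-1 (suc n) = expandAt-0 k n

      -- Leibniz rule for z^j f(z^(1+k)): j comes from z^j, and 1 + k from the chain rule.
      expandAt-θ : ∀ j f n → n × expandAt j f n ≈ j × expandAt j f n + suc k × expandAt j (θ f) n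
      expandAt-θ zero f zero = sym (trans (+-identityˡ _) (×-0 (suc k)))
      expandAt-θ zero f (suc n) = begin
        e + n × e ≈⟨ +-congˡ (expandAt-θ k (tail f) n) ⟩
        e + (k × e + suc k × e′) ≈⟨ +-assoc _ _ _ ⟨
        suc k × e + suc k × e′ ≈⟨ ×-distrib-+ e e′ (suc k) ⟨
        suc k × (e + e′) ≈⟨ ×-congʳ (suc k) (expandAt-⊕ k (tail f) (θ (tail f)) n) ⟨
        suc k × expandAt k (tail (θ f)) n ≈⟨ +-identityˡ _ ⟨
        0# + suc k × expandAt k (tail (θ f)) n ∎
        where
        e e′ : Carrier
        e = expandAt k (tail f) n
        e′ = expandAt k (θ (tail f)) n
      expandAt-θ (suc j) f zero = sym (trans (+-cong (×-0 (suc j)) (×-0 (suc k))) (+-identityˡ 0#))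
      expandAt-θ (suc j) f (suc n) = trans (+-congˡ (expandAt-θ j f n)) (sym (+-assoc _ _ _))

      expandAt-+ : ∀ j f n → expandAt j f (j ℕ.+ n) ≡ expandAt zero f n
      expandAt-+ zero f n = ≡.refl
      expandAt-+ (suc j) f n = expandAt-+ j f n

    expandHom : RingHom series series
    expandHom = record
      { ⟦_⟧ = expandAt zero
      ; ⟦⟧-cong = λ p → pointwise (expandAt-cong zero p)
      ; +-homo = λ f g → pointwise (expandAt-⊕ zero f g)
      ; *-homo = λ f g → pointwise (expandAt-⊗ zero f g)
      ; 1-homo = pointwise expandAt-1 }

    expand : Series → Series
    expand = expandAt zero

    θ-expand : ∀ f → θ (expand f) ≋ suc k SM.× expand (θ f)
    θ-expand f = pointwise λ n → trans (expandAt-θ zero f n)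
      (trans (+-identityˡ _) (sym (×-at (suc k) (expand (θ f)) n)))

    expand-at : ∀ f n → expand f (n ℕ.* suc k) ≡ f n
    expand-at f zero = ≡.refl
    expand-at f (suc n) = ≡.trans (expandAt-+ k (tail f) (n ℕ.* suc k)) (expand-at (tail f) n)

  AgreeBelow : ℕ → Series → Series → Set
  AgreeBelow N f g = ∀ n → n ℕ.< N → f n ≈ g n

  -- Coefficient n of the output depends only on the input below n, so F is a contraction for the
  -- z-adic metric. `fix-eq` and `fix-unique` are the corresponding Banach fixed-point theorem.
  Causal : (Series → Series) → Set
  Causal F = ∀ N {f g} → AgreeBelow N f g → AgreeBelow (suc N) (F f) (F g)

  private
    iter : (Series → Series) → ℕ → Series
    iter F zero = λ _ → 0#
    iter F (suc N) = F (iter F N)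

  fix : (Series → Series) → Series
  -- Each iteration settles one more coefficient, so coefficient n is final after n + 1 of them.
  fix F n = iter F (suc n) n

  fix-eq : ∀ {F} → Causal F → fix F ≋ F (fix F)
  fix-eq {F} causal = pointwise λ n →
    causal n (λ k k<n → sym (stable k<n k (ℕ.n<1+n k))) n (ℕ.n<1+n n)
    where
    stable : ∀ {N M} → N ℕ.≤ M → AgreeBelow N (iter F N) (iter F M)
    stable (s≤s N≤M) = causal _ (stable N≤M)

  fix-unique : ∀ {F f g} → Causal F → f ≋ F f → g ≋ F g → f ≋ g
  fix-unique {F} {f} {g} causal p q = pointwise λ n → agree (suc n) n (ℕ.n<1+n n)
    where
    agree : ∀ N → AgreeBelow N f g
    agree (suc N) n n<N = trans (at p n) (trans (causal N (agree N) n n<N) (sym (at q n)))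

module _ {A B : CommutativeRing 0ℓ 0ℓ} (φ : RingHom A B) where
  private module A = PowerSeries A
  private module B = PowerSeries B
  open RingHom φ
  open CommutativeRing B hiding (zero)

  mapHom : RingHom A.series B.series
  mapHom = record
    { ⟦_⟧ = λ f n → ⟦ f n ⟧
    ; ⟦⟧-cong = λ p → B.pointwise λ n → ⟦⟧-cong (A.at p n)
    ; +-homo = λ f g → B.pointwise λ n → +-homo _ _
    ; *-homo = λ f g → B.pointwise (map-⊗ f g)
    ; 1-homo = B.pointwise λ { zero → 1-homo ; (suc n) → 0-homo } }
    where
    map-⊗ : ∀ f g n → ⟦ (f A.⊗ g) n ⟧ ≈ ((λ k → ⟦ f k ⟧) B.⊗ (λ k → ⟦ g k ⟧)) n
    map-⊗ f g zero = *-homo _ _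
    map-⊗ f g (suc n) = trans (+-homo _ _) (+-cong (*-homo _ _) (map-⊗ (A.tail f) g n))

  map-θ : ∀ f → RingHom.⟦_⟧ mapHom (A.θ f) B.≋ B.θ (RingHom.⟦_⟧ mapHom f)
  map-θ f = B.pointwise λ n → ×-homo n (f n)

-- The continued fraction v = 1 + z / v(tz) and its functoriality.

-- With t = 1/Q, the series v = 1 + z / v(tz) is f(Q,Qz) / f(Q,z).
module Ratio (R : CommutativeRing 0ℓ 0ℓ) (t : CommutativeRing.Carrier R) where
  open CommutativeRing R hiding (zero)
  open PowerSeries R
  private module S = CommutativeRing series
  open Ringℤ series
  open Relation.Binary.Reasoning.Setoid S.setoid

  -- Inserting v = 1 + z v⁻¹(tz) into v v⁻¹ = 1 gives v⁻¹ = 1 - z v⁻¹(tz) v⁻¹(z). Solving for the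
  -- reciprocal first yields both series without any division in R.
  step : Series → Series
  step f = const 1# ⊕ neg (shift (scale t f ⊗ f))

  step-causal : Causal step
  step-causal N p zero _ = refl
  step-causal N p (suc n) (s≤s n<N) = +-congˡ (-‿cong (⊗-cong-≤ n
    (λ k k≤n → *-congˡ (p k (ℕ.≤-<-trans k≤n n<N)))
    (λ k k≤n → p k (ℕ.≤-<-trans k≤n n<N))))

  v⁻¹ v dlogv : Series
  v⁻¹ = fix step
  v = const 1# ⊕ shift (scale t v⁻¹)
  dlogv = θ v ⊗ v⁻¹

  v⊗v⁻¹ : v ⊗ v⁻¹ ≋ const 1#
  v⊗v⁻¹ = begin
    v ⊗ v⁻¹ ≈⟨ S.distribʳ v⁻¹ (const 1#) w ⟩
    (const 1# ⊗ v⁻¹) ⊕ (w ⊗ v⁻¹) ≈⟨ S.+-cong (S.*-identityˡ v⁻¹) (shift-⊗ (scale t v⁻¹) v⁻¹) ⟩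
    v⁻¹ ⊕ wv⁻¹ ≈⟨ S.+-congʳ (fix-eq step-causal) ⟩
    (const 1# ⊕ neg wv⁻¹) ⊕ wv⁻¹ ≈⟨ solve 2 (λ a b → (a :- b) :+ b := a) S.refl (const 1#) wv⁻¹ ⟩
    const 1# ∎
    where
    w wv⁻¹ : Series
    w = shift (scale t v⁻¹)
    wv⁻¹ = shift (scale t v⁻¹ ⊗ v⁻¹)

  -- This form of v = 1 + z / v(tz) avoids the reciprocal.
  v-recurrence : v ⊗ scale t v ≋ scale t v ⊕ shift (const 1#)
  v-recurrence = begin
    v ⊗ vₜ ≈⟨ S.distribʳ vₜ (const 1#) (shift (scale t v⁻¹)) ⟩
    (const 1# ⊗ vₜ) ⊕ (shift (scale t v⁻¹) ⊗ vₜ)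
      ≈⟨ S.+-cong (S.*-identityˡ vₜ) (shift-⊗ (scale t v⁻¹) vₜ) ⟩
    vₜ ⊕ shift (scale t v⁻¹ ⊗ vₜ) ≈⟨ S.+-congˡ (shift-cong (begin
      scale t v⁻¹ ⊗ vₜ ≈⟨ *-homo v⁻¹ v ⟨
      scale t (v⁻¹ ⊗ v) ≈⟨ ⟦⟧-cong (S.trans (S.*-comm v⁻¹ v) v⊗v⁻¹) ⟩
      scale t (const 1#) ≈⟨ 1-homo ⟩
      const 1# ∎)) ⟩
    vₜ ⊕ shift (const 1#) ∎
    where
    open RingHom (scaleHom t)
    vₜ : Series
    vₜ = scale t v

module _ {A B : CommutativeRing 0ℓ 0ℓ} (φ : RingHom A B) where
  open RingHom
  private module A = PowerSeries A
  private module B = PowerSeries B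
  open CommutativeRing B hiding (zero)
  open Algebra.Properties.CommutativeSemiring.Exp commutativeSemiring using (^-congˡ)
  open Relation.Binary.Reasoning.Setoid (CommutativeRing.setoid B.series)

  private
    map : A.Series → B.Series
    map = ⟦ mapHom φ ⟧

  module _ {t s} (eq : ⟦ φ ⟧ t ≈ s) where
    private module At = Ratio A t
    private module Bs = Ratio B s
    private module SB = CommutativeRing B.series

    map-scale : ∀ f → map (A.scale t f) B.≋ B.scale s (map f)
    map-scale f = B.pointwise λ n → trans (*-homo φ _ _)
      (*-congʳ (trans (^-homo φ t n) (^-congˡ n eq)))

    map-shift : ∀ f → map (A.shift f) B.≋ B.shift (map f)
    map-shift f = B.pointwise λ { zero → 0-homo φ ; (suc n) → refl }

    -- The image satisfies the fixed-point equation with parameter s, whose solution is unique. In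
    -- this way one computation over ℤ[t] specialises to 1/q, to roots of unity and along t ↦ tᵖ.
    map-v⁻¹ : map At.v⁻¹ B.≋ Bs.v⁻¹
    map-v⁻¹ = B.fix-unique Bs.step-causal (begin
      map At.v⁻¹ ≈⟨ ⟦⟧-cong (mapHom φ) (A.fix-eq At.step-causal) ⟩
      map (At.step At.v⁻¹) ≈⟨ +-homo (mapHom φ) _ _ ⟩
      map (A.const _) B.⊕ map (A.neg w) ≈⟨ SB.+-cong (1-homo (mapHom φ)) (neg-homo (mapHom φ) w) ⟩
      B.const 1# B.⊕ B.neg (map w) ≈⟨ SB.+-congˡ (SB.-‿cong (SB.trans (map-shift _)
        (B.shift-cong (SB.trans (*-homo (mapHom φ) _ _) (SB.*-congʳ (map-scale _)))))) ⟩
      Bs.step (map At.v⁻¹) ∎) (B.fix-eq Bs.step-causal)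
      where
      w : A.Series
      w = A.shift (A.scale t At.v⁻¹ A.⊗ At.v⁻¹)

    map-v : map At.v B.≋ Bs.v
    map-v = SB.trans (+-homo (mapHom φ) _ _) (SB.+-cong (1-homo (mapHom φ))
      (SB.trans (map-shift _) (B.shift-cong (SB.trans (map-scale _)
        (⟦⟧-cong (B.scaleHom s) map-v⁻¹)))))

    map-dlogv : map At.dlogv B.≋ Bs.dlogv
    map-dlogv = SB.trans (*-homo (mapHom φ) _ _)
      (SB.*-cong (SB.trans (map-θ φ At.v) (B.θ-cong map-v)) map-v⁻¹)

-- Divisors of prime powers and parity.

∣-prime-power : ∀ {p} → Prime p → ∀ n {c} → c ∣ p ℕ.^ n → c ≡ 1 ⊎ p ∣ c
∣-prime-power pr zero c∣ = inj₁ (∣1⇒≡1 c∣)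
∣-prime-power {p} pr (suc n) {c} (divides e eq) with euclidsLemma e c pr (≡.subst (p ∣_) eq (m∣m*n (p ℕ.^ n)))
... | inj₂ p∣c = inj₂ p∣c
... | inj₁ (divides e′ ≡.refl) = ∣-prime-power pr n (divides e′ (ℕ.*-cancelˡ-≡ _ _ p (≡.trans eq lemma)))
  where
  instance _ = prime⇒nonZero pr
  lemma : e′ ℕ.* p ℕ.* c ≡ p ℕ.* (e′ ℕ.* c)
  lemma = ≡.trans (≡.cong (ℕ._* c) (ℕ.*-comm e′ p)) (ℕ.*-assoc p e′ c)

-- The complementary divisor is not 1, so it contains a factor p that can be removed.
proper∣-prime-power : ∀ {p} → Prime p → ∀ n {d} → d ∣ p ℕ.^ suc n → ¬ d ≡ p ℕ.^ suc n → d ∣ p ℕ.^ n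
proper∣-prime-power {p} pr n {d} (divides c eq) d≢ with ∣-prime-power pr (suc n) (divides d (≡.trans eq (ℕ.*-comm c d)))
... | inj₁ ≡.refl = contradiction (≡.trans (≡.sym (ℕ.*-identityˡ d)) (≡.sym eq)) d≢
... | inj₂ (divides c′ ≡.refl) = divides c′ (ℕ.*-cancelˡ-≡ _ _ p (≡.trans eq
  (≡.trans (≡.cong (ℕ._* d) (ℕ.*-comm c′ p)) (ℕ.*-assoc p c′ d))))
  where instance _ = prime⇒nonZero pr

even⊎odd : ∀ n → (∃ λ h → n ≡ 2 ℕ.* h) ⊎ (∃ λ h → n ≡ suc (2 ℕ.* h))
even⊎odd zero = inj₁ (0 , ≡.refl)
even⊎odd (suc n) with even⊎odd n
... | inj₁ (h , ≡.refl) = inj₂ (h , ≡.refl)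
... | inj₂ (h , ≡.refl) = inj₁ (suc h , ≡.cong suc (≡.sym (ℕ.+-suc h (h ℕ.+ 0))))

-- Needed for the sign and the exponent in the determinant (-1)^e ζ^(e(e-1)/2) zᵉ, which behave
-- differently for p = 2.
2⊎odd : ∀ {p} → Prime p → p ≡ 2 ⊎ (∃ λ h → p ≡ suc (2 ℕ.* h))
2⊎odd {p} pr with even⊎odd p
... | inj₂ odd = inj₂ odd
... | inj₁ (h , eq) with prime⇒irreducible pr (divides h (≡.trans eq (ℕ.*-comm 2 h)))
...   | inj₂ 2≡p = inj₁ (≡.sym 2≡p)

odd-^ : ∀ h n → ∃ λ k → suc (2 ℕ.* h) ℕ.^ n ≡ suc (2 ℕ.* k)
odd-^ h zero = 0 , ≡.refl
odd-^ h (suc n) with k , eq ← odd-^ h n =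
  h ℕ.+ k ℕ.+ 2 ℕ.* h ℕ.* k , ≡.trans (≡.cong (suc (2 ℕ.* h) ℕ.*_) eq) (lemma h k)
  where
  lemma : ∀ h k → suc (2 ℕ.* h) ℕ.* suc (2 ℕ.* k) ≡ suc (2 ℕ.* (h ℕ.+ k ℕ.+ 2 ℕ.* h ℕ.* k))
  lemma = solve-∀

-- Geometric sums and roots of cyclotomic polynomials.

module Geometric (R : CommutativeRing 0ℓ 0ℓ) where
  open CommutativeRing R hiding (zero)
  open Algebra.Properties.Semiring.Mult semiring using () renaming (_×_ to _·_; ×-assocˡ to ·-assocˡ)
  open Algebra.Properties.CommutativeSemiring.Exp commutativeSemiring using (_^_; ^-homo-*; ^-assocʳ; ^-congˡ)
  open Ringℤ R
  open Relation.Binary.Reasoning.Setoid setoid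

  geom : Carrier → ℕ → Carrier
  geom x zero = 0#
  geom x (suc n) = 1# + x * geom x n

  geom-* : ∀ x n → geom x n * (x - 1#) ≈ x ^ n - 1#
  geom-* x zero = solve 1 (λ x → con (+ 0) :* (x :- con (+ 1)) := con (+ 1) :- con (+ 1)) refl x
  geom-* x (suc n) = begin
    (1# + x * geom x n) * (x - 1#)
      ≈⟨ solve 2 (λ x g → (con (+ 1) :+ x :* g) :* (x :- con (+ 1)) := (x :- con (+ 1)) :+ x :* (g :* (x :- con (+ 1)))) refl x (geom x n) ⟩
    (x - 1#) + x * (geom x n * (x - 1#)) ≈⟨ +-congˡ (*-congˡ (geom-* x n)) ⟩
    (x - 1#) + x * (x ^ n - 1#)
      ≈⟨ solve 2 (λ x y → (x :- con (+ 1)) :+ x :* (y :- con (+ 1)) := x :* y :- con (+ 1)) refl x (x ^ n) ⟩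
    x * x ^ n - 1# ∎

  geom-cong : ∀ {x y} n → x ≈ y → geom x n ≈ geom y n
  geom-cong zero p = refl
  geom-cong (suc n) p = +-congˡ (*-cong p (geom-cong n p))

  geom≈0⇒^≈1 : ∀ x n → geom x n ≈ 0# → x ^ n ≈ 1#
  geom≈0⇒^≈1 x n p = x-y≈0⇒x≈y (x ^ n) 1# (trans (sym (geom-* x n)) (trans (*-congʳ p) (zeroˡ _)))

  -- Every power of s fixes x, so each of the n terms contributes x.
  geom-fixed : ∀ {s x} n → s * x ≈ x → geom s n * x ≈ n · x
  geom-fixed zero p = zeroˡ _
  geom-fixed {s} {x} (suc n) p = begin
    (1# + s * geom s n) * x ≈⟨ solve 3 (λ s g x → (con (+ 1) :+ s :* g) :* x := x :+ g :* (s :* x)) refl s (geom s n) x ⟩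
    x + geom s n * (s * x) ≈⟨ +-congˡ (*-congˡ p) ⟩
    x + geom s n * x ≈⟨ +-congˡ (geom-fixed n p) ⟩
    x + n · x ∎

  ^-fixed : ∀ {s x} n → s * x ≈ x → s ^ n * x ≈ x
  ^-fixed zero p = *-identityˡ _
  ^-fixed (suc n) p = trans (*-assoc _ _ _) (trans (*-congˡ (^-fixed n p)) p)

  -- Subtraction of exponents without an inverse of ζ: x is first replaced by ζ^b x.
  ^-fixed-∸ : ∀ {ζ x} a b {c} → a ℕ.+ b ≡ c → ζ ^ c * x ≈ x → ζ ^ b * x ≈ x → ζ ^ a * x ≈ x
  ^-fixed-∸ {ζ} {x} a b ≡.refl pc pb = begin
    ζ ^ a * x ≈⟨ *-congˡ pb ⟨
    ζ ^ a * (ζ ^ b * x) ≈⟨ *-assoc _ _ _ ⟨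
    ζ ^ a * ζ ^ b * x ≈⟨ *-congʳ (^-homo-* ζ a b) ⟨
    ζ ^ (a ℕ.+ b) * x ≈⟨ pc ⟩
    x ∎

  ^-fixed-∣ : ∀ {ζ x a b} → a ∣ b → ζ ^ a * x ≈ x → ζ ^ b * x ≈ x
  ^-fixed-∣ {ζ} {x} {a} (divides c ≡.refl) p = trans (*-congʳ (trans
    (reflexive (≡.cong (ζ ^_) (ℕ.*-comm c a))) (sym (^-assocʳ ζ a c)))) (^-fixed c p)

  -- The exponents that fix x are closed under multiples and differences, so Bézout's identity
  -- applies; its two cases tell which multiple is the larger one.
  ^-fixed-gcd : ∀ {ζ x} a b → ζ ^ a * x ≈ x → ζ ^ b * x ≈ x → ζ ^ gcd a b * x ≈ x
  ^-fixed-gcd a b pa pb with Bézout.identity (gcd-GCD a b)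
  ... | Bézout.Identity.+- x y eq = ^-fixed-∸ (gcd a b) (y ℕ.* b) eq (^-fixed-∣ (n∣m*n x) pa) (^-fixed-∣ (n∣m*n y) pb)
  ... | Bézout.Identity.-+ x y eq = ^-fixed-∸ (gcd a b) (x ℕ.* a) eq (^-fixed-∣ (n∣m*n y) pb) (^-fixed-∣ (n∣m*n x) pa)

  TorsionFree : ℕ → Set
  TorsionFree p = ∀ {x} → p · x ≈ 0# → x ≈ 0#

  torsionFree-^ : ∀ p → TorsionFree p → ∀ i → TorsionFree (p ℕ.^ i)
  torsionFree-^ p tf zero eq = trans (sym (+-identityʳ _)) eq
  torsionFree-^ p tf (suc i) {x} eq = torsionFree-^ p tf i (tf (trans (·-assocˡ x p (p ℕ.^ i)) eq))

  torsionFree-cancel : ∀ n {x y} → TorsionFree n → n · x ≈ n · y → x ≈ y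
  torsionFree-cancel n {x} {y} tf eq = x-y≈0⇒x≈y x y (tf (begin
    n · (x - y) ≈⟨ ι-× n (x - y) ⟩
    ι (+ n) * (x - y) ≈⟨ solve 3 (λ a x y → a :* (x :- y) := a :* x :- a :* y) refl _ x y ⟩
    ι (+ n) * x - ι (+ n) * y ≈⟨ +-cong (ι-× n x) (-‿cong (ι-× n y)) ⟨
    n · x - n · y ≈⟨ x≈y⇒x-y≈0 eq ⟩
    0# ∎))

  -- Φ_(p^(i+1))(ζ) = 1 + s + … + s^(p-1) with s = ζ^(p^i).
  CyclotomicRoot : ℕ → ℕ → Carrier → Set
  CyclotomicRoot p zero ζ = ζ ≈ 1#
  CyclotomicRoot p (suc i) ζ = geom (ζ ^ (p ℕ.^ i)) p ≈ 0#

  module _ {p} (pr : Prime p) where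
    private instance _ = prime⇒nonZero pr

    root-^≈1 : ∀ i {ζ} → CyclotomicRoot p i ζ → ζ ^ (p ℕ.^ i) ≈ 1#
    root-^≈1 zero r = trans (*-identityʳ _) r
    root-^≈1 (suc i) {ζ} r = begin
      ζ ^ (p ℕ.* p ℕ.^ i) ≡⟨ ≡.cong (ζ ^_) (ℕ.*-comm p (p ℕ.^ i)) ⟩
      ζ ^ (p ℕ.^ i ℕ.* p) ≈⟨ ^-assocʳ ζ (p ℕ.^ i) p ⟨
      (ζ ^ (p ℕ.^ i)) ^ p ≈⟨ geom≈0⇒^≈1 _ p r ⟩
      1# ∎

    root-power : ∀ i {ζ} → CyclotomicRoot p (suc i) ζ → CyclotomicRoot p i (ζ ^ p)
    root-power zero {ζ} r = trans (^-congˡ p (sym (*-identityʳ ζ))) (geom≈0⇒^≈1 _ p r)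
    root-power (suc i) {ζ} r = trans (geom-cong p (^-assocʳ ζ p (p ℕ.^ i))) r

    -- Since gcd(k, p^(i+1)) divides pⁱ, also s = ζ^(pⁱ) fixes x. Then 0 = (1 + s + ... + s^(p-1)) x
    -- = p x. The lemma stands in for the regularity of ζᵏ - 1.
    root-fixed : TorsionFree p → ∀ i {ζ x} k .{{_ : ℕ.NonZero k}} → CyclotomicRoot p (suc i) ζ →
                 k ℕ.< p ℕ.^ suc i → ζ ^ k * x ≈ x → x ≈ 0#
    root-fixed tf i {ζ} {x} k r k<pⁱ⁺¹ fixed = tf (begin
      p · x ≈⟨ geom-fixed p (^-fixed-∣ d∣pⁱ (^-fixed-gcd k P fixed (trans (*-congʳ (root-^≈1 (suc i) r)) (*-identityˡ x)))) ⟨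
      geom (ζ ^ (p ℕ.^ i)) p * x ≈⟨ *-congʳ r ⟩
      0# * x ≈⟨ zeroˡ x ⟩
      0# ∎)
      where
      P : ℕ
      P = p ℕ.^ suc i
      d∣pⁱ : gcd k P ∣ p ℕ.^ i
      d∣pⁱ = proper∣-prime-power pr i (gcd[m,n]∣n k P)
        (λ eq → ℕ.<-irrefl eq (ℕ.≤-<-trans (∣⇒≤ (gcd[m,n]∣m k P)) k<pⁱ⁺¹))

-- Continuants and the quadratic equation for λ.

module Monomial (R : CommutativeRing 0ℓ 0ℓ) where
  open CommutativeRing R hiding (zero)
  open PowerSeries R
  private module S = CommutativeRing series
  open Relation.Binary.Reasoning.Setoid setoid

  monomial : Carrier → ℕ → Series
  monomial c zero = const c
  monomial c (suc n) = shift (monomial c n)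

  monomial-cong : ∀ {c d} n → c ≈ d → monomial c n ≋ monomial d n
  monomial-cong zero p = pointwise λ { zero → p ; (suc _) → refl }
  monomial-cong (suc n) p = shift-cong (monomial-cong n p)

  const-⊗-monomial : ∀ c d n → const c ⊗ monomial d n ≋ monomial (c * d) n
  const-⊗-monomial c d n = S.trans (const-⊗ c (monomial d n)) (·-monomial n)
    where
    ·-monomial : ∀ n → c · monomial d n ≋ monomial (c * d) n
    ·-monomial zero = pointwise λ { zero → refl ; (suc _) → zeroʳ c }
    ·-monomial (suc n) = pointwise λ { zero → zeroʳ c ; (suc m) → at (·-monomial n) m }

  neg-monomial : ∀ c n → neg (monomial c n) ≋ monomial (- c) n
  neg-monomial c zero = pointwise λ { zero → refl ; (suc _) → Algebra.Properties.Ring.-0#≈0# ring }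
  neg-monomial c (suc n) = pointwise λ
    { zero → Algebra.Properties.Ring.-0#≈0# ring ; (suc m) → at (neg-monomial c n) m }

  monomial-⊗-below : ∀ c f {k n} → k ℕ.< n → (monomial c n ⊗ f) k ≈ 0#
  monomial-⊗-below c f {k} {suc n} k<n = trans (at (shift-⊗ (monomial c n) f) k) (below k k<n)
    where
    below : ∀ k → k ℕ.< suc n → shift (monomial c n ⊗ f) k ≈ 0#
    below zero _ = refl
    below (suc k) (s≤s k<n) = monomial-⊗-below c f k<n

  expand-monomial : ∀ k c n → expand k (monomial c n) ≋ monomial c (n ℕ.* suc k)
  expand-monomial k c zero = pointwise λ { zero → refl ; (suc n) → expandAt-0 k k n }
  expand-monomial k c (suc n) = pointwise λ { zero → refl ; (suc m) → at (expandAt-monomial k) m }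
    where
    expandAt-monomial : ∀ j → expandAt k j (monomial c n) ≋ monomial c (j ℕ.+ n ℕ.* suc k)
    expandAt-monomial zero = expand-monomial k c n
    expandAt-monomial (suc j) = pointwise λ { zero → refl ; (suc m) → at (expandAt-monomial j) m }

  scale-scale : ∀ a b f → scale a (scale b f) ≋ scale (a * b) f
  scale-scale a b f = pointwise λ n → trans (sym (*-assoc _ _ _))
    (*-congʳ (sym (Algebra.Properties.CommutativeSemiring.Exp.^-distrib-* commutativeSemiring a b n)))

  scale-cong : ∀ {a b} f → a ≈ b → scale a f ≋ scale b f
  scale-cong f p = pointwise λ n → *-congʳ
    (Algebra.Properties.CommutativeSemiring.Exp.^-congˡ commutativeSemiring n p)

  scale-1 : ∀ {a} f → a ≈ 1# → scale a f ≋ f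
  scale-1 f p = pointwise λ n → trans (*-congʳ (Powers.^-one R n p)) (*-identityˡ _)

-- Continuants of the recurrence v_j v_(j+1) = v_(j+1) + ζ^j z for v_j = v(ζ^j z).
module Continuant (R : CommutativeRing 0ℓ 0ℓ) (ζ : CommutativeRing.Carrier R) where
  open CommutativeRing R hiding (zero)
  open PowerSeries R
  open Monomial R
  open Ratio R ζ
  open Algebra.Properties.CommutativeSemiring.Exp commutativeSemiring using (_^_; ^-assocʳ)
  open Algebra.Properties.Semiring.Mult semiring using () renaming (_×_ to _·ℕ_)
  private module S = CommutativeRing series
  private module Rℤ = Ringℤ R
  open Ringℤ series
  open Relation.Binary.Reasoning.Setoid S.setoid

  private
    vₙ Z : ℕ → Series
    vₙ j = scale (ζ ^ j) v
    Z j = shift (const (ζ ^ j))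

    vₙ-recurrence : ∀ j → vₙ j ⊗ vₙ (suc j) ≋ vₙ (suc j) ⊕ Z j
    vₙ-recurrence j = begin
      vₙ j ⊗ vₙ (suc j) ≈⟨ S.*-congˡ next ⟨
      vₙ j ⊗ scale (ζ ^ j) (scale ζ v) ≈⟨ *-homo v (scale ζ v) ⟨
      scale (ζ ^ j) (v ⊗ scale ζ v) ≈⟨ ⟦⟧-cong v-recurrence ⟩
      scale (ζ ^ j) (scale ζ v ⊕ shift (const 1#)) ≈⟨ +-homo _ _ ⟩
      scale (ζ ^ j) (scale ζ v) ⊕ scale (ζ ^ j) (shift (const 1#)) ≈⟨ S.+-cong next z ⟩
      vₙ (suc j) ⊕ Z j ∎
      where
      open RingHom (scaleHom (ζ ^ j))
      next : scale (ζ ^ j) (scale ζ v) ≋ vₙ (suc j)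
      next = S.trans (scale-scale (ζ ^ j) ζ v) (scale-cong v (*-comm (ζ ^ j) ζ))
      z : scale (ζ ^ j) (shift (const 1#)) ≋ Z j
      z = pointwise λ
        { zero → zeroʳ _
        ; (suc zero) → trans (*-identityʳ _) (*-identityʳ _)
        ; (suc (suc n)) → zeroʳ _ }

  Λ Λ⁻¹ : ℕ → Series
  Λ zero = const 1#
  Λ (suc k) = Λ k ⊗ scale (ζ ^ k) v
  Λ⁻¹ zero = const 1#
  Λ⁻¹ (suc k) = Λ⁻¹ k ⊗ scale (ζ ^ k) v⁻¹

  private
    vₙ⊗vₙ⁻¹ : ∀ k → vₙ k ⊗ scale (ζ ^ k) v⁻¹ ≋ const 1#
    vₙ⊗vₙ⁻¹ k = S.trans (S.sym (*-homo v v⁻¹)) (S.trans (⟦⟧-cong v⊗v⁻¹) 1-homo)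
      where open RingHom (scaleHom (ζ ^ k))

  Λ⊗Λ⁻¹ : ∀ k → Λ k ⊗ Λ⁻¹ k ≋ const 1#
  Λ⊗Λ⁻¹ zero = S.*-identityˡ _
  Λ⊗Λ⁻¹ (suc k) = begin
    (Λ k ⊗ vₙ k) ⊗ (Λ⁻¹ k ⊗ vₙ⁻¹) ≈⟨ solve 4 (λ a b c d → (a :* b) :* (c :* d) := (a :* c) :* (b :* d)) S.refl (Λ k) (vₙ k) (Λ⁻¹ k) vₙ⁻¹ ⟩
    (Λ k ⊗ Λ⁻¹ k) ⊗ (vₙ k ⊗ vₙ⁻¹) ≈⟨ S.*-cong (Λ⊗Λ⁻¹ k) (vₙ⊗vₙ⁻¹ k) ⟩
    const 1# ⊗ const 1# ≈⟨ S.*-identityˡ _ ⟩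
    const 1# ∎
    where
    vₙ⁻¹ : Series
    vₙ⁻¹ = scale (ζ ^ k) v⁻¹

  Λ₀ : ∀ k → Λ k 0 ≈ 1#
  Λ₀ zero = refl
  Λ₀ (suc k) = trans (*-cong (Λ₀ k) (trans (*-identityˡ _) (+-identityʳ _))) (*-identityˡ _)

  -- The factor v(ζ^j z) contributes ζ^(jn) bₙ, and ζⁿ = 1 makes all k contributions equal.
  dlogΛ-at : ∀ k n → ζ ^ n ≈ 1# → (θ (Λ k) ⊗ Λ⁻¹ k) n ≈ k ·ℕ dlogv n
  dlogΛ-at zero n _ = trans (at (S.trans (S.*-congʳ (θ-const 1#)) (S.zeroˡ _)) n) refl
  dlogΛ-at (suc k) n p = trans (at sum n) (trans (+-comm _ _) (+-cong term (dlogΛ-at k n p)))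
    where
    open RingHom (scaleHom (ζ ^ k))
    vₙ⁻¹ : Series
    vₙ⁻¹ = scale (ζ ^ k) v⁻¹
    sum : θ (Λ k ⊗ vₙ k) ⊗ (Λ⁻¹ k ⊗ vₙ⁻¹) ≋ (θ (Λ k) ⊗ Λ⁻¹ k) ⊕ scale (ζ ^ k) dlogv
    sum = begin
      θ (Λ k ⊗ vₙ k) ⊗ (Λ⁻¹ k ⊗ vₙ⁻¹) ≈⟨ S.*-congʳ (θ-⊗ (Λ k) (vₙ k)) ⟩
      ((θ (Λ k) ⊗ vₙ k) ⊕ (Λ k ⊗ θ (vₙ k))) ⊗ (Λ⁻¹ k ⊗ vₙ⁻¹)
        ≈⟨ solve 6 (λ x x′ xi y y′ yi → (x′ :* y :+ x :* y′) :* (xi :* yi) := (x′ :* xi) :* (y :* yi) :+ (x :* xi) :* (y′ :* yi))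
             S.refl (Λ k) (θ (Λ k)) (Λ⁻¹ k) (vₙ k) (θ (vₙ k)) vₙ⁻¹ ⟩
      ((θ (Λ k) ⊗ Λ⁻¹ k) ⊗ (vₙ k ⊗ vₙ⁻¹)) ⊕ ((Λ k ⊗ Λ⁻¹ k) ⊗ (θ (vₙ k) ⊗ vₙ⁻¹))
        ≈⟨ S.+-cong (S.trans (S.*-congˡ (vₙ⊗vₙ⁻¹ k)) (S.*-identityʳ _))
                    (S.trans (S.*-cong (Λ⊗Λ⁻¹ k) (S.*-congʳ (θ-scale (ζ ^ k) v))) (S.*-identityˡ _)) ⟩
      (θ (Λ k) ⊗ Λ⁻¹ k) ⊕ (scale (ζ ^ k) (θ v) ⊗ vₙ⁻¹) ≈⟨ S.+-congˡ (*-homo (θ v) v⁻¹) ⟨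
      (θ (Λ k) ⊗ Λ⁻¹ k) ⊕ scale (ζ ^ k) dlogv ∎
    term : (ζ ^ k) ^ n * dlogv n ≈ dlogv n
    term = trans (*-congʳ (trans (^-assocʳ ζ k n) (trans (reflexive (≡.cong (ζ ^_) (ℕ.*-comm k n)))
      (trans (sym (^-assocʳ ζ n k)) (Powers.^-one R k p))))) (*-identityˡ _)

  -- Replacing z by ζz turns the factors with indices 0, ..., k-1 into those with indices 1, ..., k;
  -- multiplication by v restores index 0.
  scale-Λ : ∀ k → scale ζ (Λ k) ⊗ v ≋ Λ (suc k)
  scale-Λ zero = S.*-cong 1-homo (S.sym (scale-1 v refl))
    where open RingHom (scaleHom ζ)
  scale-Λ (suc k) = begin
    scale ζ (Λ k ⊗ vₙ k) ⊗ v ≈⟨ S.*-congʳ (*-homo (Λ k) (vₙ k)) ⟩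
    (scale ζ (Λ k) ⊗ scale ζ (vₙ k)) ⊗ v ≈⟨ S.*-congʳ (S.*-congˡ (scale-scale ζ (ζ ^ k) v)) ⟩
    (scale ζ (Λ k) ⊗ vₙ (suc k)) ⊗ v ≈⟨ solve 3 (λ a b c → (a :* b) :* c := (a :* c) :* b) S.refl _ _ _ ⟩
    (scale ζ (Λ k) ⊗ v) ⊗ vₙ (suc k) ≈⟨ S.*-congʳ (scale-Λ k) ⟩
    Λ (suc (suc k)) ∎
    where open RingHom (scaleHom ζ)

  private
    -- Let M_j be the matrix with rows (1, ζ^j z) and (1, 0), which represents w ↦ 1 + ζ^j z / w.
    -- The product M_0 ⋯ M_k has rows (α_(k+1), β_(k+1)) and (α′_k, β′_k).
    α β α′ β′ : ℕ → Series
    α zero = const 1#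
    α (suc k) = α k ⊕ β k
    β zero = λ _ → 0#
    β (suc k) = Z k ⊗ α k
    α′ k = scale ζ (α k)
    β′ k = scale ζ (β k)

    Λ-continuant : ∀ k → Λ k ⊗ vₙ k ≋ (α k ⊗ vₙ k) ⊕ β k
    Λ-continuant zero = S.sym (S.+-identityʳ _)
    Λ-continuant (suc k) = begin
      (Λ k ⊗ vₙ k) ⊗ vₙ (suc k) ≈⟨ S.*-congʳ (Λ-continuant k) ⟩
      ((α k ⊗ vₙ k) ⊕ β k) ⊗ vₙ (suc k)
        ≈⟨ solve 4 (λ a v b w → (a :* v :+ b) :* w := a :* (v :* w) :+ b :* w) S.refl (α k) (vₙ k) (β k) (vₙ (suc k)) ⟩
      (α k ⊗ (vₙ k ⊗ vₙ (suc k))) ⊕ (β k ⊗ vₙ (suc k)) ≈⟨ S.+-congʳ (S.*-congˡ (vₙ-recurrence k)) ⟩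
      (α k ⊗ (vₙ (suc k) ⊕ Z k)) ⊕ (β k ⊗ vₙ (suc k))
        ≈⟨ solve 4 (λ a w z b → a :* (w :+ z) :+ b :* w := (a :+ b) :* w :+ z :* a) S.refl (α k) (vₙ (suc k)) (Z k) (β k) ⟩
      ((α k ⊕ β k) ⊗ vₙ (suc k)) ⊕ (Z k ⊗ α k) ∎

    Λ-continuant′ : ∀ k → scale ζ (Λ k) ⊗ vₙ (suc k) ≋ (α′ k ⊗ vₙ (suc k)) ⊕ β′ k
    Λ-continuant′ k = begin
      scale ζ (Λ k) ⊗ vₙ (suc k) ≈⟨ S.*-congˡ next ⟨
      scale ζ (Λ k) ⊗ scale ζ (vₙ k) ≈⟨ *-homo (Λ k) (vₙ k) ⟨
      scale ζ (Λ k ⊗ vₙ k) ≈⟨ ⟦⟧-cong (Λ-continuant k) ⟩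
      scale ζ ((α k ⊗ vₙ k) ⊕ β k) ≈⟨ +-homo _ _ ⟩
      scale ζ (α k ⊗ vₙ k) ⊕ β′ k ≈⟨ S.+-congʳ (*-homo (α k) (vₙ k)) ⟩
      (α′ k ⊗ scale ζ (vₙ k)) ⊕ β′ k ≈⟨ S.+-congʳ (S.*-congˡ next) ⟩
      (α′ k ⊗ vₙ (suc k)) ⊕ β′ k ∎
      where
      open RingHom (scaleHom ζ)
      next : scale ζ (vₙ k) ≋ vₙ (suc k)
      next = scale-scale ζ (ζ ^ k) v

    scale-Z : ∀ k → scale ζ (Z k) ≋ Z (suc k)
    scale-Z k = pointwise λ
      { zero → zeroʳ _
      ; (suc zero) → *-congʳ (*-identityʳ ζ)
      ; (suc (suc n)) → zeroʳ _ }

    β′-suc : ∀ k → β′ (suc k) ≋ Z (suc k) ⊗ α′ k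
    β′-suc k = S.trans (RingHom.*-homo (scaleHom ζ) (Z k) (α k)) (S.*-congʳ (scale-Z k))

  -- In closed form (-1)^k ζ^(0 + 1 + ... + (k-1)): the product of the determinants -ζ^j z of the
  -- first k matrices, stripped of z^k.
  δ : ℕ → Carrier
  δ zero = 1#
  δ (suc k) = - (ζ ^ k * δ k)

  private
    -- Multiplicativity of the determinant, one matrix at a time: the step contributes the factor
    -- -ζ^(k+1) z.
    determinant : ∀ k → (α (suc k) ⊗ β′ k) ⊕ neg (β (suc k) ⊗ α′ k) ≋ monomial (δ (suc k)) (suc k)
    determinant zero = begin
      ((const 1# ⊕ (λ _ → 0#)) ⊗ β′ 0) ⊕ neg ((Z 0 ⊗ const 1#) ⊗ α′ 0)
        ≈⟨ S.+-cong (S.*-congˡ (0-homo)) (S.-‿cong (S.*-congˡ 1-homo)) ⟩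
      ((const 1# ⊕ (λ _ → 0#)) ⊗ (λ _ → 0#)) ⊕ neg ((Z 0 ⊗ const 1#) ⊗ const 1#)
        ≈⟨ S.+-cong (S.zeroʳ _) (S.-‿cong (S.trans (S.*-identityʳ _) (S.*-identityʳ _))) ⟩
      (λ _ → 0#) ⊕ neg (Z 0) ≈⟨ S.+-identityˡ _ ⟩
      neg (monomial 1# 1) ≈⟨ neg-monomial 1# 1 ⟩
      monomial (- 1#) 1 ≈⟨ monomial-cong 1 (-‿cong (sym (*-identityˡ 1#))) ⟩
      monomial (δ 1) 1 ∎
      where open RingHom (scaleHom ζ)
    determinant (suc k) = begin
      ((a ⊕ b) ⊗ β′ (suc k)) ⊕ neg ((z ⊗ a) ⊗ α′ (suc k))
        ≈⟨ S.+-cong (S.*-congˡ (β′-suc k)) (S.-‿cong (S.*-congˡ (RingHom.+-homo (scaleHom ζ) (α k) (β k)))) ⟩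
      ((a ⊕ b) ⊗ (z ⊗ α′ k)) ⊕ neg ((z ⊗ a) ⊗ (α′ k ⊕ β′ k))
        ≈⟨ solve 5 (λ a b z a′ b′ → (a :+ b) :* (z :* a′) :- (z :* a) :* (a′ :+ b′) := :- (z :* (a :* b′ :- b :* a′)))
             S.refl a b z (α′ k) (β′ k) ⟩
      neg (z ⊗ ((a ⊗ β′ k) ⊕ neg (b ⊗ α′ k))) ≈⟨ S.-‿cong (S.*-congˡ (determinant k)) ⟩
      neg (z ⊗ monomial (δ (suc k)) (suc k)) ≈⟨ S.-‿cong (shift-⊗ _ _) ⟩
      neg (shift (const (ζ ^ suc k) ⊗ monomial (δ (suc k)) (suc k)))
        ≈⟨ S.-‿cong (shift-cong (const-⊗-monomial _ _ (suc k))) ⟩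
      neg (monomial (ζ ^ suc k * δ (suc k)) (suc (suc k))) ≈⟨ neg-monomial _ (suc (suc k)) ⟩
      monomial (δ (suc (suc k))) (suc (suc k)) ∎
      where
      a b z : Series
      a = α (suc k)
      b = β (suc k)
      z = Z (suc k)

    α-degree : ∀ k n → k ℕ.< n → α k n ≈ 0#
    β-degree : ∀ k n → k ℕ.< n → β k n ≈ 0#
    α-degree zero (suc n) _ = refl
    α-degree (suc k) n k<n = trans (+-cong (α-degree k n k<n′) (β-degree k n k<n′)) (+-identityˡ 0#)
      where
      k<n′ : k ℕ.< n
      k<n′ = ℕ.<-trans (ℕ.n<1+n k) k<n
    β-degree zero n _ = refl
    β-degree (suc k) (suc n) (s≤s k<n) = trans (at (shift-⊗ (const (ζ ^ k)) (α k)) (suc n))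
      (trans (at (const-⊗ (ζ ^ k) (α k)) n) (trans (*-congˡ (α-degree k n k<n)) (zeroʳ _)))

    α₀ : ∀ k → α k 0 ≈ 1#
    β₀ : ∀ k → β k 0 ≈ 0#
    α₀ zero = refl
    α₀ (suc k) = trans (+-cong (α₀ k) (β₀ k)) (+-identityʳ 1#)
    β₀ zero = refl
    β₀ (suc k) = zeroˡ _

  module _ (m : ℕ) (root : ζ ^ suc m ≈ 1#) where
    private
      e : ℕ
      e = suc m
      vₑ : vₙ e ≋ v
      vₑ = scale-1 v root
      T : Series
      T = α e ⊕ β′ m
      D : Series
      D = monomial (δ e) e

    -- Because v_e = v, the vector (v, 1) is an eigenvector of M_0 ⋯ M_m with eigenvalue `Λ e`; `E₁`
    -- and `E₂` are the two rows of this statement. The result is the characteristic equation, T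
    -- being the trace and D the determinant.
    Λ-quadratic′ : Λ e ⊗ Λ e ⊕ D ≋ T ⊗ Λ e
    Λ-quadratic′ = begin
      Λ e ⊗ Λ e ⊕ D ≈⟨ S.+-cong (S.*-congˡ E₂) (S.sym (determinant m)) ⟩
      Λ e ⊗ (α′ m ⊗ v ⊕ β′ m) ⊕ (α e ⊗ β′ m ⊕ neg (β e ⊗ α′ m))
        ≈⟨ solve 6 (λ l a v b c d → l :* (a :* v :+ b) :+ (c :* b :- d :* a) := a :* (l :* v) :+ (l :* b :+ (c :* b :- d :* a)))
             S.refl (Λ e) (α′ m) v (β′ m) (α e) (β e) ⟩
      α′ m ⊗ (Λ e ⊗ v) ⊕ (Λ e ⊗ β′ m ⊕ (α e ⊗ β′ m ⊕ neg (β e ⊗ α′ m))) ≈⟨ S.+-congʳ (S.*-congˡ E₁) ⟩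
      α′ m ⊗ (α e ⊗ v ⊕ β e) ⊕ (Λ e ⊗ β′ m ⊕ (α e ⊗ β′ m ⊕ neg (β e ⊗ α′ m)))
        ≈⟨ solve 6 (λ l a v b c d → a :* (c :* v :+ d) :+ (l :* b :+ (c :* b :- d :* a)) := c :* (a :* v :+ b) :+ b :* l)
             S.refl (Λ e) (α′ m) v (β′ m) (α e) (β e) ⟩
      α e ⊗ (α′ m ⊗ v ⊕ β′ m) ⊕ β′ m ⊗ Λ e ≈⟨ S.+-congʳ (S.*-congˡ E₂) ⟨
      α e ⊗ Λ e ⊕ β′ m ⊗ Λ e ≈⟨ S.distribʳ (Λ e) (α e) (β′ m) ⟨
      T ⊗ Λ e ∎
      where
      E₁ : Λ e ⊗ v ≋ α e ⊗ v ⊕ β e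
      E₁ = S.trans (S.*-congˡ (S.sym vₑ)) (S.trans (Λ-continuant e) (S.+-congʳ (S.*-congˡ vₑ)))
      E₂ : Λ e ≋ α′ m ⊗ v ⊕ β′ m
      E₂ = S.trans (S.sym (scale-Λ m)) (S.trans (S.*-congˡ (S.sym vₑ))
        (S.trans (Λ-continuant′ m) (S.+-congʳ (S.*-congˡ vₑ))))

    -- As ζ^e = 1, the substitution permutes the factors cyclically. Multiplication by v followed by
    -- v⁻¹ carries out the rotation.
    Λ-invariant : scale ζ (Λ e) ≋ Λ e
    Λ-invariant = begin
      scale ζ (Λ e) ≈⟨ S.*-identityʳ _ ⟨
      scale ζ (Λ e) ⊗ const 1# ≈⟨ S.*-congˡ v⊗v⁻¹ ⟨
      scale ζ (Λ e) ⊗ (v ⊗ v⁻¹) ≈⟨ S.*-assoc _ _ _ ⟨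
      (scale ζ (Λ e) ⊗ v) ⊗ v⁻¹ ≈⟨ S.*-congʳ (S.trans (scale-Λ e) (S.*-congˡ vₑ)) ⟩
      (Λ e ⊗ v) ⊗ v⁻¹ ≈⟨ S.*-assoc _ _ _ ⟩
      Λ e ⊗ (v ⊗ v⁻¹) ≈⟨ S.*-congˡ v⊗v⁻¹ ⟩
      Λ e ⊗ const 1# ≈⟨ S.*-identityʳ _ ⟩
      Λ e ∎

    -- The trace T has degree less than e, and T = Λ + D / Λ agrees with the
    -- ζ-invariant series Λ below degree e.
    Λ-quadratic : (∀ k {x} .{{_ : ℕ.NonZero k}} → k ℕ.< e → ζ ^ k * x ≈ x → x ≈ 0#) →
                  Λ e ⊗ Λ e ⊕ D ≋ Λ e
    Λ-quadratic fixed = S.trans Λ-quadratic′ (S.trans (S.*-congʳ (pointwise T≈1)) (S.*-identityˡ _))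
      where
      T≋ : T ≋ Λ e ⊕ D ⊗ Λ⁻¹ e
      T≋ = begin
        T ≈⟨ S.*-identityʳ T ⟨
        T ⊗ const 1# ≈⟨ S.*-congˡ (Λ⊗Λ⁻¹ e) ⟨
        T ⊗ (Λ e ⊗ Λ⁻¹ e) ≈⟨ S.*-assoc _ _ _ ⟨
        (T ⊗ Λ e) ⊗ Λ⁻¹ e ≈⟨ S.*-congʳ Λ-quadratic′ ⟨
        (Λ e ⊗ Λ e ⊕ D) ⊗ Λ⁻¹ e
          ≈⟨ solve 3 (λ l d i → (l :* l :+ d) :* i := l :* (l :* i) :+ d :* i) S.refl (Λ e) D (Λ⁻¹ e) ⟩
        Λ e ⊗ (Λ e ⊗ Λ⁻¹ e) ⊕ D ⊗ Λ⁻¹ e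
          ≈⟨ S.+-congʳ (S.trans (S.*-congˡ (Λ⊗Λ⁻¹ e)) (S.*-identityʳ _)) ⟩
        Λ e ⊕ D ⊗ Λ⁻¹ e ∎
      T≈1 : ∀ n → T n ≈ const 1# n
      T≈1 zero = trans (+-cong (α₀ e) (trans (*-congˡ (β₀ m)) (zeroʳ _))) (+-identityʳ 1#)
      T≈1 n@(suc _) with n ℕ.<? e
      ... | yes n<e = trans (at T≋ n) (trans (+-cong
              (fixed n n<e (at Λ-invariant n))
              (monomial-⊗-below (δ e) (Λ⁻¹ e) n<e)) (+-identityˡ 0#))
      -- The trace has degree at most m: `α e` unfolds to `α m ⊕ β m`, whereas the degree bound for
      -- `α e` itself would still permit zᵉ.
      ... | no n≮e = trans (+-cong
              (trans (+-cong (α-degree m n m<n) (β-degree m n m<n)) (+-identityˡ 0#))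
              (trans (*-congˡ (β-degree m n m<n)) (zeroʳ _))) (+-identityˡ 0#)
        where
        m<n : m ℕ.< n
        m<n = ℕ.≮⇒≥ n≮e

-- Comparison of bₙₚ(ζ) with bₙ(ζᵖ).

module RootOfUnity (R : CommutativeRing 0ℓ 0ℓ) (k : ℕ) (pr : Prime (suc k))
                   (tf : Geometric.TorsionFree R (suc k)) where
  open CommutativeRing R hiding (zero)
  open PowerSeries R
  open Monomial R
  open Geometric R
  open Continuant R
  open Algebra.Properties.CommutativeSemiring.Exp commutativeSemiring using (_^_; ^-homo-*; ^-assocʳ; ^-congˡ)
  open Algebra.Properties.Semiring.Mult semiring
    using () renaming (_×_ to _·ℕ_; ×-congʳ to ·ℕ-congʳ; ×-assocˡ to ·ℕ-assocˡ)
  private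
    module S = CommutativeRing series
    module Rℤ = Ringℤ R
    p : ℕ
    p = suc k

  module _ (ζ : Carrier) where
    open Ringℤ R
    open Relation.Binary.Reasoning.Setoid setoid

    -- The exponent is 0 + 1 + ... + 2h = h (2h + 1).
    δ-odd : ∀ h → δ ζ (suc (2 ℕ.* h)) ≈ - (ζ ^ suc (2 ℕ.* h)) ^ h
    δ-odd zero = -‿cong (*-identityˡ _)
    δ-odd (suc h) = begin
      δ ζ (suc (2 ℕ.* suc h)) ≡⟨ ≡.cong (λ n → δ ζ (suc n)) (double h) ⟩
      - (ζ ^ suc (suc n) * - (ζ ^ suc n * δ ζ (suc n)))
        ≈⟨ -‿cong (*-congˡ (-‿cong (*-congˡ (trans (δ-odd h) (-‿cong (^-assocʳ ζ (suc n) h)))))) ⟩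
      - (ζ ^ suc (suc n) * - (ζ ^ suc n * - ζ ^ (suc n ℕ.* h)))
        ≈⟨ solve 3 (λ a b c → :- (a :* :- (b :* :- c)) := :- (a :* (b :* c))) refl _ _ _ ⟩
      - (ζ ^ suc (suc n) * (ζ ^ suc n * ζ ^ (suc n ℕ.* h)))
        ≈⟨ -‿cong (trans (*-congˡ (sym (^-homo-* ζ (suc n) _))) (sym (^-homo-* ζ (suc (suc n)) _))) ⟩
      - ζ ^ (suc (suc n) ℕ.+ (suc n ℕ.+ suc n ℕ.* h)) ≡⟨ ≡.cong (λ j → - ζ ^ j) (exponent h) ⟩
      - ζ ^ (suc (2 ℕ.* suc h) ℕ.* suc h) ≈⟨ -‿cong (^-assocʳ ζ (suc (2 ℕ.* suc h)) (suc h)) ⟨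
      - (ζ ^ suc (2 ℕ.* suc h)) ^ suc h ∎
      where
      n : ℕ
      n = 2 ℕ.* h
      double : ∀ h → 2 ℕ.* suc h ≡ suc (suc (2 ℕ.* h))
      double = solve-∀
      exponent : ∀ h → suc (suc (2 ℕ.* h)) ℕ.+ (suc (2 ℕ.* h) ℕ.+ suc (2 ℕ.* h) ℕ.* h) ≡ suc (2 ℕ.* suc h) ℕ.* suc h
      exponent = solve-∀

    -- Read off from `δ-odd`, since the next step of the recursion multiplies by -ζ^(2h) = -1.
    δ-even : ∀ h → ζ ^ (2 ℕ.* h) ≈ 1# → δ ζ (2 ℕ.* h) ≈ ζ ^ h
    δ-even h r = Algebra.Properties.Ring.-‿injective ring (begin
      - δ ζ (2 ℕ.* h) ≈⟨ -‿cong (*-identityˡ _) ⟨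
      - (1# * δ ζ (2 ℕ.* h)) ≈⟨ -‿cong (*-congʳ r) ⟨
      δ ζ (suc (2 ℕ.* h)) ≈⟨ δ-odd h ⟩
      - (ζ * ζ ^ (2 ℕ.* h)) ^ h ≈⟨ -‿cong (^-congˡ h (trans (*-congˡ r) (*-identityʳ ζ))) ⟩
      - ζ ^ h ∎)

    -- For odd p the power of ζ is trivial and the sign is (-1)^e = -1. For p = 2 the sign is +1,
    -- but the power of ζ is s = ζ^(e/2), and 1 + s = 0. Every level thus has the determinant -zᵉ,
    -- which is why λ and its analogue for ζᵖ satisfy the same equation.
    δ-root : ∀ i → CyclotomicRoot p i ζ → δ ζ (p ℕ.^ i) ≈ - 1#
    δ-root zero r = -‿cong (*-identityˡ 1#)
    δ-root (suc i) r with 2⊎odd pr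
    ... | inj₁ ≡.refl = trans (δ-even (2 ℕ.^ i) (root-^≈1 pr (suc i) r)) (begin
      s ≈⟨ solve 1 (λ s → s := (con (+ 1) :+ s :* (con (+ 1) :+ s :* con (+ 0))) :- con (+ 1)) refl s ⟩
      geom s 2 - 1# ≈⟨ +-congʳ r ⟩
      0# - 1# ≈⟨ +-identityˡ _ ⟩
      - 1# ∎)
      where
      s : Carrier
      s = ζ ^ (2 ℕ.^ i)
    ... | inj₂ (h , eq) with j , eq′ ← odd-^ h (suc i) = begin
      δ ζ P ≡⟨ ≡.cong (δ ζ) P≡ ⟩
      δ ζ (suc (2 ℕ.* j)) ≈⟨ δ-odd j ⟩
      - (ζ ^ suc (2 ℕ.* j)) ^ j ≡⟨ ≡.cong (λ n → - (ζ ^ n) ^ j) P≡ ⟨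
      - (ζ ^ P) ^ j ≈⟨ -‿cong (Powers.^-one R j (root-^≈1 pr (suc i) r)) ⟩
      - 1# ∎
      where
      P : ℕ
      P = p ℕ.^ suc i
      P≡ : P ≡ suc (2 ℕ.* j)
      P≡ = ≡.trans (≡.cong (ℕ._^ suc i) eq) eq′

    Λ-root-quadratic : ∀ i → CyclotomicRoot p i ζ →
      Λ ζ (p ℕ.^ i) ⊗ Λ ζ (p ℕ.^ i) ⊕ monomial (- 1#) (p ℕ.^ i) ≋ Λ ζ (p ℕ.^ i)
    Λ-root-quadratic i r = S.trans (S.+-congˡ (monomial-cong (p ℕ.^ i) (sym (δ-root i r))))
      (quadratic (p ℕ.^ i) {{ℕ.m^n≢0 p i}} (root-^≈1 pr i r) (fixed i r))
      where
      quadratic : ∀ e .{{_ : ℕ.NonZero e}} → ζ ^ e ≈ 1# →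
        (∀ j {x} .{{_ : ℕ.NonZero j}} → j ℕ.< e → ζ ^ j * x ≈ x → x ≈ 0#) →
        Λ ζ e ⊗ Λ ζ e ⊕ monomial (δ ζ e) e ≋ Λ ζ e
      quadratic (suc m) = Λ-quadratic ζ m
      fixed : ∀ i → CyclotomicRoot p i ζ → ∀ j {x} .{{_ : ℕ.NonZero j}} → j ℕ.< p ℕ.^ i → ζ ^ j * x ≈ x → x ≈ 0#
      fixed zero r (suc j) (s≤s ())
      fixed (suc i) r j = root-fixed pr tf i j r

  -- The difference of the two equations is (x - y)(x + y - 1) = 0, and the second factor has
  -- constant term 1 + 1 - 1 = 1.
  quadratic-unique : ∀ {x y d} → x 0 ≈ 1# → y 0 ≈ 1# → x ⊗ x ⊕ d ≋ x → y ⊗ y ⊕ d ≋ y → x ≋ y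
  quadratic-unique {x} {y} {d} x₀ y₀ qx qy = Sℤ.x-y≈0⇒x≈y x y (⊗-cancel (x ⊕ neg y) (begin
    x 0 + y 0 - 1# ≈⟨ +-congʳ (+-cong x₀ y₀) ⟩
    1# + 1# - 1# ≈⟨ Rℤ.solve 0 (Rℤ.con (+ 1) Rℤ.:+ Rℤ.con (+ 1) Rℤ.:- Rℤ.con (+ 1) Rℤ.:= Rℤ.con (+ 1)) refl ⟩
    1# ∎) (S.trans
      (solve 3 (λ x y d → (x :- y) :* (x :+ y :- con (+ 1)) := ((x :* x :+ d) :- x) :- ((y :* y :+ d) :- y)) S.refl x y d)
      (S.trans (S.+-cong (Sℤ.x≈y⇒x-y≈0 qx) (S.-‿cong (Sℤ.x≈y⇒x-y≈0 qy))) (S.-‿inverseʳ _))))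
    where
    module Sℤ = Ringℤ series
    open Sℤ
    open Relation.Binary.Reasoning.Setoid setoid

  module _ (i : ℕ) {ζ : Carrier} (r : CyclotomicRoot p (suc i) ζ) where
    open Ratio R
    private
      ξ : Carrier
      ξ = ζ ^ p
      rξ : CyclotomicRoot p i ξ
      rξ = root-power pr i r
      λ′ λ′⁻¹ μ μ⁻¹ : Series
      λ′ = Λ ζ (p ℕ.^ suc i)
      λ′⁻¹ = Λ⁻¹ ζ (p ℕ.^ suc i)
      μ = Λ ξ (p ℕ.^ i)
      μ⁻¹ = Λ⁻¹ ξ (p ℕ.^ i)
      open RingHom (expandHom k)

      λ≋μ : λ′ ≋ expand k μ
      λ≋μ = quadratic-unique (Λ₀ ζ (p ℕ.^ suc i)) (Λ₀ ξ (p ℕ.^ i)) (Λ-root-quadratic ζ (suc i) r) (begin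
        expand k μ ⊗ expand k μ ⊕ monomial (- 1#) (p ℕ.^ suc i)
          ≡⟨ ≡.cong (λ n → expand k μ ⊗ expand k μ ⊕ monomial (- 1#) n) (ℕ.*-comm p (p ℕ.^ i)) ⟩
        expand k μ ⊗ expand k μ ⊕ monomial (- 1#) (p ℕ.^ i ℕ.* p)
          ≈⟨ S.+-cong (*-homo μ μ) (expand-monomial k (- 1#) (p ℕ.^ i)) ⟨
        expand k (μ ⊗ μ) ⊕ expand k (monomial (- 1#) (p ℕ.^ i)) ≈⟨ +-homo _ _ ⟨
        expand k (μ ⊗ μ ⊕ monomial (- 1#) (p ℕ.^ i)) ≈⟨ ⟦⟧-cong (Λ-root-quadratic ξ i rξ) ⟩
        expand k μ ∎)
        where open Relation.Binary.Reasoning.Setoid S.setoid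

      μ⊗μ⁻¹ : expand k μ ⊗ expand k μ⁻¹ ≋ const 1#
      μ⊗μ⁻¹ = S.trans (S.sym (*-homo μ μ⁻¹)) (S.trans (⟦⟧-cong (Λ⊗Λ⁻¹ ξ (p ℕ.^ i))) 1-homo)

      inverse : λ′⁻¹ ≋ expand k μ⁻¹
      inverse = begin
        λ′⁻¹ ≈⟨ S.*-identityʳ _ ⟨
        λ′⁻¹ ⊗ const 1# ≈⟨ S.*-congˡ μ⊗μ⁻¹ ⟨
        λ′⁻¹ ⊗ (expand k μ ⊗ expand k μ⁻¹) ≈⟨ S.*-assoc _ _ _ ⟨
        (λ′⁻¹ ⊗ expand k μ) ⊗ expand k μ⁻¹ ≈⟨ S.*-congʳ (S.trans (S.*-comm _ _) (S.*-congʳ (S.sym λ≋μ))) ⟩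
        (λ′ ⊗ λ′⁻¹) ⊗ expand k μ⁻¹ ≈⟨ S.*-congʳ (Λ⊗Λ⁻¹ ζ (p ℕ.^ suc i)) ⟩
        const 1# ⊗ expand k μ⁻¹ ≈⟨ S.*-identityˡ _ ⟩
        expand k μ⁻¹ ∎
        where open Relation.Binary.Reasoning.Setoid S.setoid

      dlog : θ λ′ ⊗ λ′⁻¹ ≋ Algebra.Properties.Semiring.Mult._×_ S.semiring p (expand k (θ μ ⊗ μ⁻¹))
      dlog = begin
        θ λ′ ⊗ λ′⁻¹ ≈⟨ S.*-cong (S.trans (θ-cong λ≋μ) (θ-expand k μ)) inverse ⟩
        (p SM.× expand k (θ μ)) ⊗ expand k μ⁻¹ ≈⟨ SM.×-assoc-* p _ _ ⟩
        p SM.× (expand k (θ μ) ⊗ expand k μ⁻¹) ≈⟨ SM.×-congʳ p (*-homo _ _) ⟨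
        p SM.× expand k (θ μ ⊗ μ⁻¹) ∎
        where
        module SM = Algebra.Properties.Semiring.Mult S.semiring
        open Relation.Binary.Reasoning.Setoid S.setoid

    -- Coefficient np of the two logarithmic derivatives is p^(i+1) bₙₚ(ζ) on one side and p pⁱ
    -- bₙ(ζᵖ) on the other, and p^(i+1) is cancelled. From pⁱ ∣ n come ξⁿ = 1 and ζⁿᵖ = 1, as
    -- `dlogΛ-at` requires.
    dlogv-root : ∀ n → p ℕ.^ i ∣ n → dlogv ζ (n ℕ.* p) ≈ dlogv ξ n
    dlogv-root n (divides c n≡) = torsionFree-cancel (p ℕ.^ suc i) (torsionFree-^ p tf (suc i)) (begin
      (p ℕ.^ suc i) ·ℕ dlogv ζ (n ℕ.* p) ≈⟨ dlogΛ-at ζ (p ℕ.^ suc i) (n ℕ.* p) ζⁿᵖ≈1 ⟨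
      (θ λ′ ⊗ λ′⁻¹) (n ℕ.* p) ≈⟨ at dlog (n ℕ.* p) ⟩
      _ ≈⟨ ×-at p (expand k (θ μ ⊗ μ⁻¹)) (n ℕ.* p) ⟩
      p ·ℕ expand k (θ μ ⊗ μ⁻¹) (n ℕ.* p) ≡⟨ ≡.cong (p ·ℕ_) (expand-at k (θ μ ⊗ μ⁻¹) n) ⟩
      p ·ℕ (θ μ ⊗ μ⁻¹) n ≈⟨ ·ℕ-congʳ p (dlogΛ-at ξ (p ℕ.^ i) n ξⁿ≈1) ⟩
      p ·ℕ ((p ℕ.^ i) ·ℕ dlogv ξ n) ≈⟨ ·ℕ-assocˡ (dlogv ξ n) p (p ℕ.^ i) ⟩
      (p ℕ.^ suc i) ·ℕ dlogv ξ n ∎)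
      where
      open Relation.Binary.Reasoning.Setoid setoid
      ξⁿ≈1 : ξ ^ n ≈ 1#
      ξⁿ≈1 = begin
        ξ ^ n ≡⟨ ≡.cong (ξ ^_) (≡.trans n≡ (ℕ.*-comm c (p ℕ.^ i))) ⟩
        ξ ^ (p ℕ.^ i ℕ.* c) ≈⟨ ^-assocʳ ξ (p ℕ.^ i) c ⟨
        (ξ ^ (p ℕ.^ i)) ^ c ≈⟨ Powers.^-one R c (root-^≈1 pr i rξ) ⟩
        1# ∎
      ζⁿᵖ≈1 : ζ ^ (n ℕ.* p) ≈ 1#
      ζⁿᵖ≈1 = trans (reflexive (≡.cong (ζ ^_) (ℕ.*-comm n p))) (trans (sym (^-assocʳ ζ p n)) ξⁿ≈1)

-- Congruences modulo powers of p in a commutative ring.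

prime∤! : ∀ {p} → Prime p → ∀ n → n ℕ.< p → ¬ p ∣ n !
prime∤! {p} pr zero 0<p p∣1 = ℕ.<-irrefl (≡.sym (∣1⇒≡1 p∣1)) (ℕ.nonTrivial⇒n>1 p {{prime⇒nonTrivial pr}})
prime∤! pr (suc n) n<p p∣ with euclidsLemma (suc n) (n !) pr p∣
... | inj₁ p∣1+n = ℕ.<⇒≱ n<p (∣⇒≤ p∣1+n)
... | inj₂ p∣n! = prime∤! pr n (ℕ.<-trans (ℕ.n<1+n n) n<p) p∣n!

-- The prime p divides p! but neither k! nor (p-k)!.
prime∣C : ∀ {p} → Prime p → ∀ k .{{_ : ℕ.NonZero k}} → k ℕ.< p → p ∣ p C k
prime∣C {p} pr k k<p with euclidsLemma (p C k) (k ! ℕ.* (p ℕ.∸ k) !) pr (≡.subst (p ∣_) (≡.sym factored) (p∣p! p))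
  where
  instance
    _ = ℕ._!*_!≢0 k (p ℕ.∸ k)
    _ = prime⇒nonZero pr
  factored : (p C k) ℕ.* (k ! ℕ.* (p ℕ.∸ k) !) ≡ p !
  factored = ≡.trans (≡.cong (ℕ._* (k ! ℕ.* (p ℕ.∸ k) !)) (nCk≡n!/k![n-k]! (ℕ.<⇒≤ k<p)))
    (m/n*n≡m (k![n∸k]!∣n! (ℕ.<⇒≤ k<p)))
  p∣p! : ∀ n .{{_ : ℕ.NonZero n}} → n ∣ n !
  p∣p! (suc n) = m∣m*n (n !)
... | inj₁ p∣C = p∣C
... | inj₂ p∣k!l! with euclidsLemma (k !) ((p ℕ.∸ k) !) pr p∣k!l!
...   | inj₁ p∣k! = contradiction p∣k! (prime∤! pr k k<p)
...   | inj₂ p∣l! = contradiction p∣l! (prime∤! pr (p ℕ.∸ k) (ℕ.∸-monoʳ-< (ℕ.>-nonZero⁻¹ k) (ℕ.<⇒≤ k<p)))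

module Congruence (R : CommutativeRing 0ℓ 0ℓ) where
  open CommutativeRing R hiding (zero)
  open Algebra.Properties.CommutativeSemiring.Exp commutativeSemiring using (_^_; ^-congˡ)
  open Algebra.Properties.Semiring.Mult semiring
    using () renaming (_×_ to _·_; ×-assocˡ to ·-assocˡ)
  open Algebra.Properties.CommutativeMonoid.Mult +-commutativeMonoid using () renaming (×-distrib-+ to ·-distrib-+)
  open Ringℤ R
  open Relation.Binary.Reasoning.Setoid setoid

  infix 4 _≡_[mod_]
  infixr 4 _,_
  -- The quotient is kept as data, so that the quotients of single coefficients can be assembled
  -- into a quotient series.
  record _≡_[mod_] (x y : Carrier) (n : ℕ) : Set where
    constructor _,_
    field
      quotient : Carrier
      equation : x ≈ y + n · quotient
  open _≡_[mod_] public

  ι-suc : ∀ n → ι (+ suc n) ≈ 1# + ι (+ n)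
  ι-suc n = ι-+ (+ 1) (+ n)

  ι-ℕ* : ∀ m n → ι (+ (m ℕ.* n)) ≈ ι (+ m) * ι (+ n)
  ι-ℕ* m n = trans (reflexive (≡.cong ι (ℤ.pos-* m n))) (ι-* (+ m) (+ n))

  ^-taylor : ∀ y d n → ∃ λ e → (y + d) ^ suc n ≈ y ^ suc n + ι (+ suc n) * (y ^ n * d) + d * d * e
  ^-taylor y d zero = 0# , solve 2 (λ y d →
    (y :+ d) :* con (+ 1) := y :* con (+ 1) :+ con (+ 1) :* (con (+ 1) :* d) :+ d :* d :* con (+ 0)) refl y d
  ^-taylor y d (suc n) with e , eq ← ^-taylor y d n = i * y ^ n + (y + d) * e , (begin
    (y + d) * (y + d) ^ suc n ≈⟨ *-congˡ eq ⟩
    (y + d) * (y * y ^ n + i * (y ^ n * d) + d * d * e)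
      ≈⟨ solve 5 (λ y d Y i e → (y :+ d) :* (y :* Y :+ i :* (Y :* d) :+ d :* d :* e)
           := y :* (y :* Y) :+ (con (+ 1) :+ i) :* (y :* Y :* d) :+ d :* d :* (i :* Y :+ (y :+ d) :* e)) refl y d (y ^ n) i e ⟩
    y * (y * y ^ n) + (1# + i) * (y * y ^ n * d) + d * d * (i * y ^ n + (y + d) * e)
      ≈⟨ +-congʳ (+-congˡ (*-congʳ (ι-suc (suc n)))) ⟨
    y * (y * y ^ n) + ι (+ suc (suc n)) * (y * y ^ n * d) + d * d * (i * y ^ n + (y + d) * e) ∎)
    where
    i : Carrier
    i = ι (+ suc n)

  -- Write P = `suc k` and x = y + d with d a multiple of P c. The linear Taylor term P y^k d and
  -- the remainder in d² are both multiples of P² c, the latter because the modulus already contains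
  -- P.
  ^-lift : ∀ {x y} k c → x ≡ y [mod suc k ℕ.* c ] → x ^ suc k ≡ y ^ suc k [mod suc k ℕ.* (suc k ℕ.* c) ]
  ^-lift {x} {y} k c (w , eq) with e , eqᵉ ← ^-taylor y ((suc k ℕ.* c) · w) k =
    y ^ k * w + c · (w * w * e) , (begin
      x ^ suc k ≈⟨ ^-congˡ (suc k) eq ⟩
      (y + d) ^ suc k ≈⟨ eqᵉ ⟩
      y ^ suc k + P * (y ^ k * d) + d * d * e
        ≈⟨ +-cong (+-congˡ (*-congˡ (*-congˡ d≈))) (*-congʳ (*-cong d≈ d≈)) ⟩
      y ^ suc k + P * (y ^ k * (P * M * w)) + P * M * w * (P * M * w) * e
        ≈⟨ solve 6 (λ a b P M w e → a :+ P :* (b :* (P :* M :* w)) :+ P :* M :* w :* (P :* M :* w) :* e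
             := a :+ P :* (P :* M) :* (b :* w :+ M :* (w :* w :* e))) refl (y ^ suc k) (y ^ k) P M w e ⟩
      y ^ suc k + P * (P * M) * (y ^ k * w + M * (w * w * e))
        ≈⟨ +-congˡ (trans (ι-× (suc k ℕ.* (suc k ℕ.* c)) _) (*-cong (trans (ι-ℕ* (suc k) (suc k ℕ.* c)) (*-congˡ (ι-ℕ* (suc k) c))) (+-congˡ (ι-× c _)))) ⟨
      y ^ suc k + (suc k ℕ.* (suc k ℕ.* c)) · (y ^ k * w + c · (w * w * e)) ∎)
    where
    P M d : Carrier
    P = ι (+ suc k)
    M = ι (+ c)
    d = (suc k ℕ.* c) · w
    d≈ : d ≈ P * M * w
    d≈ = trans (ι-× (suc k ℕ.* c) w) (*-congʳ (ι-ℕ* (suc k) c))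

  mod-trans : ∀ {x y z n} → x ≡ y [mod n ] → y ≡ z [mod n ] → x ≡ z [mod n ]
  mod-trans {n = n} (w , p) (u , q) = u + w , trans p (trans (+-congʳ q)
    (trans (+-assoc _ _ _) (+-congˡ (sym (·-distrib-+ u w n)))))

  mod-+ : ∀ {x y x′ y′ n} → x ≡ y [mod n ] → x′ ≡ y′ [mod n ] → x + x′ ≡ y + y′ [mod n ]
  mod-+ {n = n} (w , p) (u , q) = w + u , trans (+-cong p q) (trans
    (solve 4 (λ a b c d → (a :+ b) :+ (c :+ d) := (a :+ c) :+ (b :+ d)) refl _ _ _ _)
    (+-congˡ (sym (·-distrib-+ w u n))))

  ≈⇒mod : ∀ {x y n} → x ≈ y → x ≡ y [mod n ]
  ≈⇒mod {n = n} eq = 0# , trans eq (trans (sym (+-identityʳ _)) (+-congˡ (sym (trans (ι-× n 0#) (zeroʳ _)))))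

  private
    open Algebra.Properties.Semiring.Sum semiring using (sum; sum-init-last)
    sum≡0 : ∀ {n c} (t : Fin n → Carrier) → (∀ i → t i ≡ 0# [mod c ]) → sum t ≡ 0# [mod c ]
    sum≡0 {zero} t p = ≈⇒mod refl
    sum≡0 {suc n} t p = mod-trans (mod-+ (p Fin.zero) (sum≡0 (λ i → t (Fin.suc i)) (λ i → p (Fin.suc i))))
      (≈⇒mod (+-identityˡ 0#))

  freshman : ∀ {p} → Prime p → ∀ x y → (x + y) ^ p ≡ x ^ p + y ^ p [mod p ]
  freshman {zero} pr x y = contradiction pr ¬prime[0]
  freshman {p@(suc k)} pr x y = mod-trans (≈⇒mod (Binomial.theorem p x y))
    (mod-trans (mod-+ (≈⇒mod first) (mod-trans (≈⇒mod (sum-init-last (λ i → term (Fin.suc i))))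
      (mod-+ (sum≡0 _ middle) (≈⇒mod last))))
      (≈⇒mod (solve 2 (λ a b → b :+ (con (+ 0) :+ a) := a :+ b) refl (x ^ p) (y ^ p))))
    where
    module Binomial = Algebra.Properties.CommutativeSemiring.Binomial commutativeSemiring
    term : Fin (suc p) → Carrier
    term = Binomial.binomialTerm x y p
    first : term Fin.zero ≈ y ^ p
    first = trans (+-identityʳ _) (*-identityˡ _)
    middle : ∀ (i : Fin k) → term (Fin.suc (inject₁ i)) ≡ 0# [mod p ]
    middle i with divides c eq ← prime∣C pr (suc (toℕ (inject₁ i)))
                   (s≤s (≡.subst (ℕ._< k) (≡.sym (Fin.toℕ-inject₁ i)) (Fin.toℕ<n i)))
      = c · b , (begin
        (p C suc (toℕ (inject₁ i))) · b ≡⟨ ≡.cong (_· b) (≡.trans eq (ℕ.*-comm c p)) ⟩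
        (p ℕ.* c) · b ≈⟨ ·-assocˡ b p c ⟨
        p · (c · b) ≈⟨ +-identityˡ _ ⟨
        0# + p · (c · b) ∎)
      where
      b : Carrier
      b = Binomial.binomial x y p (Fin.suc (inject₁ i))
    last : term (Fin.suc (fromℕ k)) ≈ x ^ p
    last = trans (reflexive (≡.cong (λ j → (p C suc j) · (x ^ suc j * y ^ (p ℕ.∸ suc j))) (Fin.toℕ-fromℕ k)))
      (trans (reflexive (≡.cong₂ (λ c j → c · (x ^ p * y ^ j)) (nCn≡1 p) (ℕ.n∸n≡0 k)))
        (trans (+-identityʳ _) (*-identityʳ _)))

-- Gauss congruences for logarithmic derivatives.

module GaussCongruence (R : CommutativeRing 0ℓ 0ℓ) (k : ℕ) (pr : Prime (suc k))
  (tf : Geometric.TorsionFree R (suc k)) (ψ : RingHom R R)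
  (frobenius : ∀ x → Congruence._≡_[mod_] R
    (Algebra.Properties.CommutativeSemiring.Exp._^_ (CommutativeRing.commutativeSemiring R) x (suc k))
    (RingHom.⟦_⟧ ψ x) (suc k)) where
  open CommutativeRing R hiding (zero)
  open PowerSeries R
  private
    module S = CommutativeRing series
    module C = Congruence R
    module CS = Congruence series
    module ψ = RingHom ψ
    module ψ* = RingHom (mapHom ψ)
    module E = RingHom (expandHom k)
    module SM = Algebra.Properties.Semiring.Mult S.semiring
    p : ℕ
    p = suc k
  open C using (_≡_[mod_])
  open Algebra.Properties.Semiring.Mult semiring
    using () renaming (_×_ to _·ℕ_; ×-assocˡ to ·ℕ-assocˡ)
  open Algebra.Properties.CommutativeSemiring.Exp commutativeSemiring using () renaming (_^_ to _^ᴿ_)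
  open Algebra.Properties.CommutativeSemiring.Exp S.commutativeSemiring using (_^_; ^-congˡ; ^-assocʳ)

  -- The Frobenius lift on series: ψ acts on the coefficients, and z becomes z^p.
  Ψ : Series → Series
  Ψ f = expand k (ψ*.⟦ f ⟧)

  private
    shift^ : ℕ → Series → Series
    shift^ zero f = f
    shift^ (suc j) f = shift (shift^ j f)

    shift-^ : ∀ j f → shift f ^ j ≋ shift^ j (f ^ j)
    shift-^ zero f = S.refl
    shift-^ (suc j) f = begin
      shift f ⊗ shift f ^ j ≈⟨ shift-⊗ f (shift f ^ j) ⟩
      shift (f ⊗ shift f ^ j) ≈⟨ shift-cong (S.trans (S.*-congˡ (shift-^ j f)) (⊗-shift^ j (f ^ j))) ⟩
      shift (shift^ j (f ⊗ f ^ j)) ∎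
      where
      open Relation.Binary.Reasoning.Setoid S.setoid
      ⊗-shift^ : ∀ j g → f ⊗ shift^ j g ≋ shift^ j (f ⊗ g)
      ⊗-shift^ zero g = S.refl
      ⊗-shift^ (suc j) g = S.trans (S.*-comm _ _) (S.trans (shift-⊗ _ _)
        (shift-cong (S.trans (S.*-comm _ _) (⊗-shift^ j g))))

    const-^ : ∀ c j → const c ^ j ≋ const (c ^ᴿ j)
    const-^ c zero = S.refl
    const-^ c (suc j) = S.trans (S.*-congˡ (const-^ c j)) (S.trans (const-⊗ c _)
      (pointwise λ { zero → refl ; (suc n) → zeroʳ c }))

    split : ∀ f → f ≋ const (f 0) ⊕ shift (tail f)
    split f = pointwise λ { zero → sym (+-identityʳ _) ; (suc n) → sym (+-identityˡ _) }

    ^-split : ∀ f n → (f ^ p) n ≡ const (f 0 ^ᴿ p) n + shift^ p (tail f ^ p) n [mod p ]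
    ^-split f n = CS.quotient expanded n C., trans (at (S.trans (^-congˡ p (split f)) (CS.equation expanded)) n)
        (+-cong (+-cong (at (const-^ (f 0) p) n) (at (shift-^ p (tail f)) n)) (×-at p (CS.quotient expanded) n))
      where
      expanded : (const (f 0) ⊕ shift (tail f)) ^ p CS.≡ const (f 0) ^ p ⊕ shift (tail f) ^ p [mod p ]
      expanded = CS.freshman pr (const (f 0)) (shift (tail f))

    shift^-expandAt : ∀ {g h} j n → (∀ m → m ℕ.≤ n → g m ≡ expand k h m [mod p ]) →
                      shift^ j g n ≡ expandAt k j h n [mod p ]
    shift^-expandAt zero n hyp = hyp n ℕ.≤-refl
    shift^-expandAt (suc j) zero hyp = C.≈⇒mod refl
    shift^-expandAt (suc j) (suc n) hyp = shift^-expandAt j n (λ m m≤n → hyp m (ℕ.m≤n⇒m≤1+n m≤n))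

    -- Modulo p, f^p ≡ f(0)^p + z^p (tail f)^p, which matches the recursion that computes `Ψ f`. The
    -- tail is needed at all indices up to n, so the induction runs on a bound N.
    frobenius-below : ∀ N f n → n ℕ.< N → (f ^ p) n ≡ Ψ f n [mod p ]
    frobenius-below (suc N) f zero _ = C.mod-trans (^-split f 0)
      (C.mod-trans (C.≈⇒mod (+-identityʳ _)) (frobenius (f 0)))
    frobenius-below (suc N) f (suc n) (s≤s n<N) = C.mod-trans (^-split f (suc n))
      (C.mod-trans (C.≈⇒mod (+-identityˡ _))
        (shift^-expandAt k n (λ m m≤n → frobenius-below N (tail f) m (ℕ.≤-<-trans m≤n n<N))))

  frobenius-series : ∀ f → f ^ p CS.≡ Ψ f [mod p ]
  frobenius-series f = (λ n → C.quotient (below n)) CS., pointwise λ n →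
    trans (C.equation (below n)) (+-congˡ (sym (×-at p (λ n → C.quotient (below n)) n)))
    where
    below : ∀ n → (f ^ p) n ≡ Ψ f n [mod p ]
    below n = frobenius-below (suc n) f n (ℕ.n<1+n n)

  -- Each further p-th power gains a factor p in the modulus, by `^-lift`.
  frobenius-^ : ∀ f j → f ^ (p ℕ.^ suc j) CS.≡ Ψ f ^ (p ℕ.^ j) [mod p ℕ.^ suc j ]
  frobenius-^ f zero = ≡.subst (f ^ (p ℕ.* 1) CS.≡ Ψ f ^ 1 [mod_]) (≡.sym (ℕ.*-identityʳ p))
    (CS.mod-trans (CS.≈⇒mod (S.reflexive (≡.cong (f ^_) (ℕ.*-identityʳ p))))
      (CS.mod-trans (frobenius-series f) (CS.≈⇒mod (S.sym (S.*-identityʳ _)))))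
  frobenius-^ f (suc j) = CS.mod-trans (CS.≈⇒mod (rearrange f (p ℕ.^ suc j)))
    (CS.mod-trans (CS.^-lift k (p ℕ.^ j) (frobenius-^ f j)) (CS.≈⇒mod (S.sym (rearrange (Ψ f) (p ℕ.^ j)))))
    where
    rearrange : ∀ g n → g ^ (p ℕ.* n) ≋ (g ^ n) ^ p
    rearrange g n = S.trans (S.reflexive (≡.cong (g ^_) (ℕ.*-comm p n))) (S.sym (^-assocʳ g n p))

  dlog-^ : ∀ f g n → f ⊗ g ≋ const 1# → θ (f ^ n) ⊗ g ^ n ≋ n SM.× (θ f ⊗ g)
  dlog-^ f g zero fg = S.trans (S.*-congʳ (θ-const 1#)) (S.zeroˡ _)
  dlog-^ f g (suc n) fg = begin
    θ (f ⊗ f ^ n) ⊗ (g ⊗ g ^ n) ≈⟨ S.*-congʳ (θ-⊗ f (f ^ n)) ⟩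
    (θ f ⊗ f ^ n ⊕ f ⊗ θ (f ^ n)) ⊗ (g ⊗ g ^ n)
      ≈⟨ solve 6 (λ f′ F f F′ g G → (f′ :* F :+ f :* F′) :* (g :* G) := (F :* G) :* (f′ :* g) :+ (f :* g) :* (F′ :* G))
           S.refl (θ f) (f ^ n) f (θ (f ^ n)) g (g ^ n) ⟩
    (f ^ n ⊗ g ^ n) ⊗ (θ f ⊗ g) ⊕ (f ⊗ g) ⊗ (θ (f ^ n) ⊗ g ^ n)
      ≈⟨ S.+-cong (S.*-congʳ (Powers.^-inverse series n fg)) (S.*-cong fg (dlog-^ f g n fg)) ⟩
    const 1# ⊗ (θ f ⊗ g) ⊕ const 1# ⊗ (n SM.× (θ f ⊗ g)) ≈⟨ S.+-cong (S.*-identityˡ _) (S.*-identityˡ _) ⟩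
    suc n SM.× (θ f ⊗ g) ∎
    where
    open Ringℤ series
    open Relation.Binary.Reasoning.Setoid S.setoid

  torsionFree-series : ∀ n → Geometric.TorsionFree R n → Geometric.TorsionFree series n
  torsionFree-series n tfₙ {f} eq = pointwise λ m → tfₙ (trans (sym (×-at n f m)) (at eq m))

  module _ (v v⁻¹ : Series) (inv : v ⊗ v⁻¹ ≋ const 1#) (j : ℕ) where
    private
      -- Dividing X = Y + N G by Y gives X / Y = 1 + N H. The series `W` measures the error made
      -- when Y / X is replaced by 1: (Y / X) θH = θH - N W.
      b X X⁻¹ Y Y⁻¹ G H W : Series
      N : ℕ
      N = p ℕ.^ suc j
      b = θ v ⊗ v⁻¹
      X = v ^ N
      X⁻¹ = v⁻¹ ^ N
      Y = Ψ v ^ (p ℕ.^ j)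
      Y⁻¹ = Ψ v⁻¹ ^ (p ℕ.^ j)
      G = CS.quotient (frobenius-^ v j)
      H = G ⊗ Y⁻¹
      W = X⁻¹ ⊗ (G ⊗ θ H)

      open Ringℤ series
      open Relation.Binary.Reasoning.Setoid S.setoid

      Ψv⊗Ψv⁻¹ : Ψ v ⊗ Ψ v⁻¹ ≋ const 1#
      Ψv⊗Ψv⁻¹ = S.trans (S.sym (E.*-homo _ _)) (S.trans (E.⟦⟧-cong (S.trans (S.sym (ψ*.*-homo v v⁻¹))
        (S.trans (ψ*.⟦⟧-cong inv) ψ*.1-homo))) E.1-homo)

      X⊗X⁻¹ : X ⊗ X⁻¹ ≋ const 1#
      X⊗X⁻¹ = Powers.^-inverse series N inv
      Y⊗Y⁻¹ : Y ⊗ Y⁻¹ ≋ const 1#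
      Y⊗Y⁻¹ = Powers.^-inverse series (p ℕ.^ j) Ψv⊗Ψv⁻¹

      i : Series
      i = ι (+ N)

      X≋ : X ≋ Y ⊕ i ⊗ G
      X≋ = S.trans (CS.equation (frobenius-^ v j)) (S.+-congˡ (ι-× N G))

      θX≋ : θ X ≋ θ Y ⊕ i ⊗ θ G
      θX≋ = S.trans (θ-cong (CS.equation (frobenius-^ v j))) (S.trans (θ-⊕ Y (N SM.× G))
        (S.+-congˡ (S.trans (θ-× N G) (ι-× N (θ G)))))

      dlogX : θ X ⊗ X⁻¹ ≋ i ⊗ b
      dlogX = S.trans (dlog-^ v v⁻¹ N inv) (ι-× N b)

      dlogY : θ Y ⊗ Y⁻¹ ≋ i ⊗ Ψ b
      dlogY = begin
        θ Y ⊗ Y⁻¹ ≈⟨ dlog-^ (Ψ v) (Ψ v⁻¹) (p ℕ.^ j) Ψv⊗Ψv⁻¹ ⟩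
        (p ℕ.^ j) SM.× (θ (Ψ v) ⊗ Ψ v⁻¹) ≈⟨ SM.×-congʳ (p ℕ.^ j) (begin
          θ (Ψ v) ⊗ Ψ v⁻¹ ≈⟨ S.*-congʳ (S.trans (θ-expand k _) (SM.×-congʳ p (E.⟦⟧-cong (S.sym (map-θ ψ v))))) ⟩
          (p SM.× Ψ (θ v)) ⊗ Ψ v⁻¹ ≈⟨ SM.×-assoc-* p _ _ ⟩
          p SM.× (Ψ (θ v) ⊗ Ψ v⁻¹) ≈⟨ SM.×-congʳ p (S.trans (E.⟦⟧-cong (ψ*.*-homo _ _)) (E.*-homo _ _)) ⟨
          p SM.× Ψ b ∎) ⟩
        (p ℕ.^ j) SM.× (p SM.× Ψ b) ≈⟨ SM.×-assocˡ (Ψ b) (p ℕ.^ j) p ⟩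
        (p ℕ.^ j ℕ.* p) SM.× Ψ b ≡⟨ ≡.cong (SM._× Ψ b) (ℕ.*-comm (p ℕ.^ j) p) ⟩
        N SM.× Ψ b ≈⟨ ι-× N (Ψ b) ⟩
        i ⊗ Ψ b ∎

      θY⁻¹ : Y ⊗ θ Y⁻¹ ≋ neg (θ Y ⊗ Y⁻¹)
      θY⁻¹ = Algebra.Properties.Ring.+-inverseʳ-unique S.ring _ _
        (S.trans (S.sym (θ-⊗ Y Y⁻¹)) (S.trans (θ-cong Y⊗Y⁻¹) (θ-const 1#)))

      XYθH : X⁻¹ ⊗ (Y ⊗ θ H) ≋ X⁻¹ ⊗ (θ G ⊕ neg (G ⊗ (θ Y ⊗ Y⁻¹)))
      XYθH = S.*-congˡ (begin
        Y ⊗ θ H ≈⟨ S.*-congˡ (θ-⊗ G Y⁻¹) ⟩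
        Y ⊗ (θ G ⊗ Y⁻¹ ⊕ G ⊗ θ Y⁻¹)
          ≈⟨ solve 5 (λ y g′ yi g yi′ → y :* (g′ :* yi :+ g :* yi′) := g′ :* (y :* yi) :+ g :* (y :* yi′)) S.refl _ _ _ _ _ ⟩
        θ G ⊗ (Y ⊗ Y⁻¹) ⊕ G ⊗ (Y ⊗ θ Y⁻¹) ≈⟨ S.+-cong (S.trans (S.*-congˡ Y⊗Y⁻¹) (S.*-identityʳ _)) (S.*-congˡ θY⁻¹) ⟩
        θ G ⊕ G ⊗ neg (θ Y ⊗ Y⁻¹) ≈⟨ S.+-congˡ (Algebra.Properties.Ring.-‿distribʳ-* S.ring _ _) ⟨
        θ G ⊕ neg (G ⊗ (θ Y ⊗ Y⁻¹)) ∎)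

      -- The logarithmic derivatives of X and Y are N b and N Ψ b. They differ by that of 1 + N H,
      -- which is N (Y / X) θH.
      scaled : N SM.× b ≋ N SM.× (Ψ b ⊕ X⁻¹ ⊗ (Y ⊗ θ H))
      scaled = begin
        N SM.× b ≈⟨ ι-× N b ⟩
        i ⊗ b ≈⟨ dlogX ⟨
        θ X ⊗ X⁻¹ ≈⟨ S.*-congʳ θX≋ ⟩
        (θ Y ⊕ i ⊗ θ G) ⊗ X⁻¹ ≈⟨ S.*-congʳ (S.+-congʳ (S.trans (S.*-congˡ Y⊗Y⁻¹) (S.*-identityʳ (θ Y)))) ⟨
        (θ Y ⊗ (Y ⊗ Y⁻¹) ⊕ i ⊗ θ G) ⊗ X⁻¹
          ≈⟨ solve 7 (λ y y′ yi i g g′ xi → (y′ :* (y :* yi) :+ i :* g′) :* xi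
               := ((y :+ i :* g) :* xi) :* (y′ :* yi) :+ i :* (xi :* (g′ :- g :* (y′ :* yi))))
               S.refl Y (θ Y) Y⁻¹ i G (θ G) X⁻¹ ⟩
        ((Y ⊕ i ⊗ G) ⊗ X⁻¹) ⊗ (θ Y ⊗ Y⁻¹) ⊕ i ⊗ (X⁻¹ ⊗ (θ G ⊕ neg (G ⊗ (θ Y ⊗ Y⁻¹))))
          ≈⟨ S.+-cong (S.trans (S.*-cong (S.trans (S.*-congʳ (S.sym X≋)) X⊗X⁻¹) dlogY) (S.*-identityˡ _))
               (S.*-congˡ (S.sym XYθH)) ⟩
        i ⊗ Ψ b ⊕ i ⊗ (X⁻¹ ⊗ (Y ⊗ θ H)) ≈⟨ S.distribˡ i _ _ ⟨
        i ⊗ (Ψ b ⊕ X⁻¹ ⊗ (Y ⊗ θ H)) ≈⟨ ι-× N _ ⟨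
        N SM.× (Ψ b ⊕ X⁻¹ ⊗ (Y ⊗ θ H)) ∎

      XYθH≋ : X⁻¹ ⊗ (Y ⊗ θ H) ≋ θ H ⊕ N SM.× neg W
      XYθH≋ = begin
        X⁻¹ ⊗ (Y ⊗ θ H)
          ≈⟨ solve 5 (λ xi y h i g → xi :* (y :* h) := ((y :+ i :* g) :* xi) :* h :+ i :* :- (xi :* (g :* h))) S.refl X⁻¹ Y (θ H) i G ⟩
        ((Y ⊕ i ⊗ G) ⊗ X⁻¹) ⊗ θ H ⊕ i ⊗ neg W
          ≈⟨ S.+-cong (S.trans (S.*-congʳ (S.trans (S.*-congʳ (S.sym X≋)) X⊗X⁻¹)) (S.*-identityˡ _)) (S.sym (ι-× N (neg W))) ⟩
        θ H ⊕ N SM.× neg W ∎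

    -- Cancelling N leaves b = Ψ b + θH - N W, and coefficient n of θH is n Hₙ, a multiple of N.
    dlog-congruence : ∀ n → p ℕ.^ suc j ∣ n → (θ v ⊗ v⁻¹) n ≡ Ψ (θ v ⊗ v⁻¹) n [mod p ℕ.^ suc j ]
    dlog-congruence n (divides c n≡) = C.mod-trans (C.≈⇒mod (at cancelled n))
      (C.mod-trans (C.mod-+ (C.≈⇒mod refl) (c ·ℕ H n + neg W n C., trans (+-cong θHn (×-at N (neg W) n))
        (trans (sym (·ℕ-distrib _ _ N)) (sym (+-identityˡ _))))) (C.≈⇒mod (+-identityʳ _)))
      where
      open Algebra.Properties.CommutativeMonoid.Mult +-commutativeMonoid using () renaming (×-distrib-+ to ·ℕ-distrib)
      cancelled : b ≋ Ψ b ⊕ (θ H ⊕ N SM.× neg W)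
      cancelled = S.trans (Geometric.torsionFree-cancel series N
        (torsionFree-series N (Geometric.torsionFree-^ R p tf (suc j))) scaled) (S.+-congˡ XYθH≋)
      θHn : n ·ℕ H n ≈ N ·ℕ (c ·ℕ H n)
      θHn = trans (reflexive (≡.cong (_·ℕ H n) (≡.trans n≡ (ℕ.*-comm c N)))) (sym (·ℕ-assocˡ (H n) N c))

-- The ring ℤ[t], evaluation, and the Frobenius lift t ↦ tᵖ.

module Polynomial where
  private module PS = PowerSeries ℤ.+-*-commutativeRing
  private module PR = CommutativeRing PS.series
  open PS using (_≋_; pointwise; at; _⊗_)

  -- Coefficients from the lowest degree upwards. Trailing zeros are allowed, hence the separate
  -- equality by coefficients.
  Poly : Set
  Poly = List ℤ

  coeff : Poly → ℕ → ℤ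
  coeff [] n = ℤ.0ℤ
  coeff (a ∷ p) zero = a
  coeff (a ∷ p) (suc n) = coeff p n

  infix 4 _≈ᴾ_
  record _≈ᴾ_ (p q : Poly) : Set where
    constructor coeffs
    field ≈⇒≋ : coeff p ≋ coeff q
  open _≈ᴾ_ public

  infixl 6 _+ᴾ_
  infixl 7 _*ᴾ_
  opaque
    _+ᴾ_ _*ᴾ_ : Poly → Poly → Poly
    [] +ᴾ q = q
    (a ∷ p) +ᴾ [] = a ∷ p
    (a ∷ p) +ᴾ (b ∷ q) = a ℤ.+ b ∷ p +ᴾ q
    [] *ᴾ q = []
    (a ∷ p) *ᴾ q = List.map (λ b → a ℤ.* b) q +ᴾ (ℤ.0ℤ ∷ p *ᴾ q)

  opaque
    unfolding _+ᴾ_ _*ᴾ_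

    coeff-+ : ∀ p q n → coeff (p +ᴾ q) n ≡ coeff p n ℤ.+ coeff q n
    coeff-+ [] q n = ≡.sym (ℤ.+-identityˡ _)
    coeff-+ (a ∷ p) [] n = ≡.sym (ℤ.+-identityʳ _)
    coeff-+ (a ∷ p) (b ∷ q) zero = ≡.refl
    coeff-+ (a ∷ p) (b ∷ q) (suc n) = coeff-+ p q n

    coeff-map : ∀ (f : ℤ → ℤ) → f ℤ.0ℤ ≡ ℤ.0ℤ → ∀ p n → coeff (List.map f p) n ≡ f (coeff p n)
    coeff-map f f0 [] n = ≡.sym f0
    coeff-map f f0 (a ∷ p) zero = ≡.refl
    coeff-map f f0 (a ∷ p) (suc n) = coeff-map f f0 p n

    coeff-* : ∀ p q n → coeff (p *ᴾ q) n ≡ (coeff p ⊗ coeff q) n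
    coeff-* [] q n = ≡.sym (at (PR.zeroˡ (coeff q)) n)
    coeff-* (a ∷ p) q n = ≡.trans (coeff-+ (List.map (λ b → a ℤ.* b) q) (ℤ.0ℤ ∷ p *ᴾ q) n)
      (≡.trans (≡.cong (ℤ._+ coeff (ℤ.0ℤ ∷ p *ᴾ q) n) (coeff-map (λ b → a ℤ.* b) (ℤ.*-zeroʳ a) q n)) (step n))
      where
      step : ∀ n → a ℤ.* coeff q n ℤ.+ coeff (ℤ.0ℤ ∷ p *ᴾ q) n ≡ (coeff (a ∷ p) ⊗ coeff q) n
      step zero = ℤ.+-identityʳ _
      step (suc n) = ≡.cong (λ c → a ℤ.* coeff q (suc n) ℤ.+ c) (coeff-* p q n)

  private
    rawPoly : RawRing 0ℓ 0ℓ
    rawPoly = record { Carrier = Poly ; _≈_ = _≈ᴾ_ ; _+_ = _+ᴾ_ ; _*_ = _*ᴾ_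
      ; -_ = List.map (λ a → ℤ.- a) ; 0# = [] ; 1# = ℤ.1ℤ ∷ [] }

    -- The embedding into ℤ[[t]], along which all ring laws of ℤ[t] are pulled back.
    coeff-monomorphism : IsRingMonomorphism rawPoly PR.rawRing coeff
    coeff-monomorphism = record
      { isRingHomomorphism = record
        { isSemiringHomomorphism = record
          { isNearSemiringHomomorphism = record
            { +-isMonoidHomomorphism = record
              { isMagmaHomomorphism = record
                { isRelHomomorphism = record { cong = ≈⇒≋ }
                ; homo = λ p q → pointwise (coeff-+ p q) }
              ; ε-homo = pointwise λ _ → ≡.refl }
            ; *-homo = λ p q → pointwise (coeff-* p q) }
          ; 1#-homo = pointwise λ { zero → ≡.refl ; (suc n) → ≡.refl } }
        ; -‿homo = λ p → pointwise (coeff-map (λ a → ℤ.- a) ≡.refl p) }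
      ; injective = coeffs }

  ℤ[t] : CommutativeRing 0ℓ 0ℓ
  ℤ[t] = record
    { RawRing rawPoly
    ; isCommutativeRing = Algebra.Morphism.RingMonomorphism.isCommutativeRing
        coeff-monomorphism PR.isCommutativeRing }

  open CommutativeRing ℤ[t] hiding (zero)
  open Algebra.Properties.Semiring.Mult semiring
    using () renaming (_×_ to _·ℕ_)

  t : Poly
  t = ℤ.0ℤ ∷ ℤ.1ℤ ∷ []

  coeff-·ℕ : ∀ N p n → coeff (N ·ℕ p) n ≡ + N ℤ.* coeff p n
  coeff-·ℕ zero p n = ≡.sym (ℤ.*-zeroˡ (coeff p n))
  coeff-·ℕ (suc N) p n = ≡.trans (coeff-+ p (N ·ℕ p) n)
    (≡.trans (≡.cong (λ c → coeff p n ℤ.+ c) (coeff-·ℕ N p n)) (≡.sym (ℤ.suc-* (+ N) (coeff p n))))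

  coeff₀-* : ∀ p q → coeff (p * q) 0 ≡ coeff p 0 ℤ.* coeff q 0
  coeff₀-* p q = coeff-* p q 0

  coeff₀-+ : ∀ p q → coeff (p + q) 0 ≡ coeff p 0 ℤ.+ coeff q 0
  coeff₀-+ p q = coeff-+ p q 0

  torsionFree : ∀ N .{{_ : ℕ.NonZero N}} → Geometric.TorsionFree ℤ[t] N
  torsionFree N {p} eq = coeffs (pointwise λ n → ℤ.*-cancelˡ-≡ (+ N) (coeff p n) ℤ.0ℤ
    (≡.trans (≡.sym (coeff-·ℕ N p n)) (≡.trans (at (≈⇒≋ eq) n) (≡.sym (ℤ.*-zeroʳ (+ N))))))

  private
    Multiple : ℕ → ℤ → Set
    Multiple N a = ∃ λ w → a ≡ + N ℤ.* w

    -- As f(0) = 1, the constant coefficient shows N ∣ g(0). Subtracting g(0) f then reduces the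
    -- claim to the tail of g.
    ⊗-multiple : ∀ N f → f 0 ≡ ℤ.1ℤ → ∀ g → (∀ n → Multiple N ((g ⊗ f) n)) → ∀ n → Multiple N (g n)
    ⊗-multiple N f f₀ g hyp zero with w , eq ← hyp 0 =
      w , ≡.trans (≡.sym (ℤ.*-identityʳ (g 0))) (≡.trans (≡.cong (g 0 ℤ.*_) (≡.sym f₀)) eq)
    ⊗-multiple N f f₀ g hyp (suc n) = ⊗-multiple N f f₀ (PS.tail g) tail-hyp n
      where
      open Ringℤ ℤ.+-*-commutativeRing
      tail-hyp : ∀ n → Multiple N ((PS.tail g ⊗ f) n)
      tail-hyp n with u , equ ← ⊗-multiple N f f₀ g hyp zero | w , eqw ← hyp (suc n) =
        w ℤ.- u ℤ.* f (suc n) , (begin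
          (PS.tail g ⊗ f) n
            ≡⟨ solve 2 (λ x y → y := (x :+ y) :- x) ≡.refl (g 0 ℤ.* f (suc n)) ((PS.tail g ⊗ f) n) ⟩
          (g ⊗ f) (suc n) ℤ.- g 0 ℤ.* f (suc n) ≡⟨ ≡.cong₂ (λ a b → a ℤ.- b ℤ.* f (suc n)) eqw equ ⟩
          + N ℤ.* w ℤ.- + N ℤ.* u ℤ.* f (suc n)
            ≡⟨ solve 4 (λ m w u x → m :* w :- m :* u :* x := m :* (w :- u :* x)) ≡.refl (+ N) w u (f (suc n)) ⟩
          + N ℤ.* (w ℤ.- u ℤ.* f (suc n)) ∎)
        where open ≡.≡-Reasoning

    divide : ∀ N g → (∀ n → Multiple N (coeff g n)) → ∃ λ g′ → ∀ n → coeff g n ≡ + N ℤ.* coeff g′ n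
    divide N [] hyp = [] , λ n → ≡.sym (ℤ.*-zeroʳ (+ N))
    divide N (a ∷ g) hyp with w , eq ← hyp 0 | g′ , eqs ← divide N g (λ n → hyp (suc n)) =
      w ∷ g′ , λ { zero → eq ; (suc n) → eqs n }

  -- A polynomial with constant term 1 is a unit in ℤ[[t]], so it stays regular modulo N.
  cancel-multiple : ∀ N .{{_ : ℕ.NonZero N}} F g x → coeff F 0 ≡ ℤ.1ℤ → N ·ℕ x ≈ F * g →
                    ∃ λ g′ → x ≈ F * g′
  cancel-multiple N F g x F₀ eq with g′ , eqs ← divide N g
    (⊗-multiple N (coeff F) F₀ (coeff g) λ n → coeff x n , ≡.trans (≡.sym (coeff-* g F n))
      (≡.trans (at (≈⇒≋ (*-comm g F)) n) (≡.trans (≡.sym (at (≈⇒≋ eq) n)) (coeff-·ℕ N x n)))) =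
    g′ , Geometric.torsionFree-cancel ℤ[t] N (torsionFree N) (trans eq (trans
      (*-congˡ (coeffs (pointwise λ n → ≡.trans (eqs n) (≡.sym (coeff-·ℕ N g′ n)))))
      (Algebra.Properties.Semiring.Mult.×-comm-* semiring N F g′)))

  opaque
    unfolding _+ᴾ_

    private
      ιℕ≈constant : ∀ n → Ringℤ.ι ℤ[t] (+ n) ≈ + n ∷ []
      ιℕ≈constant zero = coeffs (pointwise λ { zero → ≡.refl ; (suc n) → ≡.refl })
      ιℕ≈constant (suc n) = trans (Congruence.ι-suc ℤ[t] n) (+-congˡ (ιℕ≈constant n))

  ι≈constant : ∀ a → Ringℤ.ι ℤ[t] a ≈ a ∷ []
  ι≈constant (+ n) = ιℕ≈constant n
  ι≈constant -[1+ n ] = -‿cong (ι≈constant (+ suc n))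

  module Evaluation (A : CommutativeRing 0ℓ 0ℓ) (x : CommutativeRing.Carrier A) where
    private module A = CommutativeRing A
    open Ringℤ A
    open Relation.Binary.Reasoning.Setoid A.setoid

    eval : Poly → A.Carrier
    eval [] = A.0#
    eval (a ∷ p) = ι a A.+ x A.* eval p

    private
      eval-0 : ∀ p → (∀ n → coeff p n ≡ ℤ.0ℤ) → eval p A.≈ A.0#
      eval-0 [] _ = A.refl
      eval-0 (a ∷ p) z = A.trans (A.+-cong (A.reflexive (≡.cong ι (z 0)))
        (A.trans (A.*-congˡ (eval-0 p λ n → z (suc n))) (A.zeroʳ x))) (A.+-identityˡ A.0#)

      eval-cong : ∀ p q → (∀ n → coeff p n ≡ coeff q n) → eval p A.≈ eval q
      eval-cong [] q eq = A.sym (eval-0 q λ n → ≡.sym (eq n))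
      eval-cong (a ∷ p) [] eq = eval-0 (a ∷ p) eq
      eval-cong (a ∷ p) (b ∷ q) eq = A.+-cong (A.reflexive (≡.cong ι (eq 0)))
        (A.*-congˡ (eval-cong p q λ n → eq (suc n)))

      opaque
        unfolding _+ᴾ_ _*ᴾ_

        eval-+ : ∀ p q → eval (p +ᴾ q) A.≈ eval p A.+ eval q
        eval-+ [] q = A.sym (A.+-identityˡ _)
        eval-+ (a ∷ p) [] = A.sym (A.+-identityʳ _)
        eval-+ (a ∷ p) (b ∷ q) = A.trans (A.+-cong (ι-+ a b) (A.*-congˡ (eval-+ p q)))
          (solve 5 (λ a b x p q → a :+ b :+ x :* (p :+ q) := (a :+ x :* p) :+ (b :+ x :* q)) A.refl _ _ _ _ _)

        eval-map : ∀ a p → eval (List.map (λ b → a ℤ.* b) p) A.≈ ι a A.* eval p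
        eval-map a [] = A.sym (A.zeroʳ _)
        eval-map a (b ∷ p) = A.trans (A.+-cong (ι-* a b) (A.*-congˡ (eval-map a p)))
          (solve 4 (λ a b x p → a :* b :+ x :* (a :* p) := a :* (b :+ x :* p)) A.refl _ _ _ _)

        eval-* : ∀ p q → eval (p *ᴾ q) A.≈ eval p A.* eval q
        eval-* [] q = A.sym (A.zeroˡ _)
        eval-* (a ∷ p) q = begin
          eval (List.map (λ b → a ℤ.* b) q +ᴾ (ℤ.0ℤ ∷ p *ᴾ q)) ≈⟨ eval-+ (List.map (λ b → a ℤ.* b) q) (ℤ.0ℤ ∷ p *ᴾ q) ⟩
          eval (List.map (λ b → a ℤ.* b) q) A.+ (A.0# A.+ x A.* eval (p *ᴾ q))
            ≈⟨ A.+-cong (eval-map a q) (A.+-congˡ (A.*-congˡ (eval-* p q))) ⟩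
          ι a A.* eval q A.+ (A.0# A.+ x A.* (eval p A.* eval q))
            ≈⟨ solve 4 (λ a x p q → a :* q :+ (con (+ 0) :+ x :* (p :* q)) := (a :+ x :* p) :* q) A.refl _ _ _ _ ⟩
          eval (a ∷ p) A.* eval q ∎

    evalHom : RingHom ℤ[t] A
    evalHom = record
      { ⟦_⟧ = eval
      ; ⟦⟧-cong = λ {p} {q} eq → eval-cong p q (at (≈⇒≋ eq))
      ; +-homo = eval-+
      ; *-homo = eval-*
      ; 1-homo = A.trans (A.+-congˡ (A.zeroʳ x)) (A.+-identityʳ A.1#) }

    eval-t : eval t A.≈ x
    eval-t = solve 1 (λ x → con (+ 0) :+ x :* (con (+ 1) :+ x :* con (+ 0)) := x) A.refl x

  open Algebra.Properties.CommutativeSemiring.Exp commutativeSemiring using (_^_; ^-congˡ; ^-distrib-*)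
  open Congruence ℤ[t]
  open Ringℤ ℤ[t]

  module Frobenius {p : ℕ} (pr : Prime p) where
    open Evaluation ℤ[t] (t ^ p) public renaming (evalHom to ψ)

    private
      0^p : 0# ^ p ≈ 0#
      0^p = 0^ p {{prime⇒nonZero pr}}
        where
        0^ : ∀ n → .{{ℕ.NonZero n}} → 0# ^ n ≈ 0#
        0^ (suc n) = zeroˡ _

      fermat-ℕ : ∀ n → ι (+ n) ^ p ≡ ι (+ n) [mod p ]
      fermat-ℕ zero = ≈⇒mod 0^p
      fermat-ℕ (suc n) = mod-trans (≈⇒mod (^-congˡ p (ι-suc n))) (mod-trans (freshman pr 1# (ι (+ n)))
        (mod-trans (mod-+ (≈⇒mod (Powers.^-one ℤ[t] p refl)) (fermat-ℕ n)) (≈⇒mod (sym (ι-suc n)))))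

      -- For a negative integer -x, `freshman` is applied to -x + x = 0. This gives (-x)^p ≡ -x^p
      -- with no distinction between p = 2 and odd p.
      fermat : ∀ a → ι a ^ p ≡ ι a [mod p ]
      fermat (+ n) = fermat-ℕ n
      fermat -[1+ n ] = - (u + w) , (begin
        (- x) ^ p ≈⟨ solve 3 (λ a b i → a := (a :+ b :+ i) :- b :- i) refl ((- x) ^ p) (x ^ p) (ι (+ p) * w) ⟩
        ((- x) ^ p + x ^ p + ι (+ p) * w) - x ^ p - ι (+ p) * w
          ≈⟨ +-congʳ (+-cong (+-congˡ (ι-× p w)) refl) ⟨
        ((- x) ^ p + x ^ p + p ·ℕ w) - x ^ p - ι (+ p) * w
          ≈⟨ +-congʳ (+-cong (trans (sym (equation sum)) (trans (^-congˡ p (-‿inverseˡ x)) 0^p))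
               (-‿cong (trans (equation (fermat-ℕ (suc n))) (+-congˡ (ι-× p u))))) ⟩
        0# - (x + ι (+ p) * u) - ι (+ p) * w
          ≈⟨ solve 4 (λ x i u w → con (+ 0) :- (x :+ i :* u) :- i :* w := :- x :+ i :* :- (u :+ w)) refl x (ι (+ p)) u w ⟩
        - x + ι (+ p) * - (u + w) ≈⟨ +-congˡ (ι-× p _) ⟨
        - x + p ·ℕ - (u + w) ∎)
        where
        open Relation.Binary.Reasoning.Setoid setoid
        x u w : Carrier
        x = ι (+ suc n)
        u = quotient (fermat-ℕ (suc n))
        sum : (- x + x) ^ p ≡ (- x) ^ p + x ^ p [mod p ]
        sum = freshman pr (- x) x
        w = quotient sum

    frobenius : ∀ f → f ^ p ≡ eval f [mod p ]
    frobenius [] = ≈⇒mod 0^p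
    frobenius (a ∷ f) = mod-trans (≈⇒mod (^-congˡ p split)) (mod-trans (freshman pr (ι a) (t * f))
      (mod-+ (fermat a) (mod-trans (≈⇒mod (^-distrib-* t f p)) (mod-* (frobenius f)))))
      where
      split : a ∷ f ≈ ι a + t * f
      split = sym (trans (+-congʳ (ι≈constant a)) (coeffs (pointwise λ n →
        ≡.trans (coeff-+ (a ∷ []) (t * f) n) (≡.trans (≡.cong (λ c → coeff (a ∷ []) n ℤ.+ c) (coeff-* t f n)) (shifted n)))))
        where
        shifted : ∀ n → coeff (a ∷ []) n ℤ.+ (coeff t ⊗ coeff f) n ≡ coeff (a ∷ f) n
        shifted zero = ℤ.+-identityʳ a
        shifted (suc n) = ≡.trans (ℤ.+-identityˡ _) (≡.trans (ℤ.+-identityˡ _)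
          (at (PR.trans (PR.*-congʳ {coeff f} (pointwise λ { zero → ≡.refl ; (suc n) → ≡.refl }))
            (PR.*-identityˡ (coeff f))) n))
      mod-* : ∀ {c x y} → x ≡ y [mod p ] → c * x ≡ c * y [mod p ]
      mod-* {c} {x} {y} (w , eq) = c * w , trans (*-congˡ eq) (trans (distribˡ c y (p ·ℕ w))
        (+-congˡ (Algebra.Properties.Semiring.Mult.×-comm-* semiring p c w)))

-- Quotient rings and factors of geometric sums.

module Quotient (A : CommutativeRing 0ℓ 0ℓ) (F : CommutativeRing.Carrier A) where
  open CommutativeRing A hiding (zero)
  open Ringℤ A

  infix 4 _≈ᶠ_
  -- The cofactor is stored, because it is the witness of divisibility to be read off after a
  -- computation in the quotient ring.
  record _≈ᶠ_ (x y : Carrier) : Set where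
    constructor differBy
    field
      {cofactor} : Carrier
      difference : x ≈ y + F * cofactor
  open _≈ᶠ_ public

  ≈⇒≈ᶠ : ∀ {x y} → x ≈ y → x ≈ᶠ y
  ≈⇒≈ᶠ {x} {y} eq = differBy (trans eq (solve 2 (λ y f → y := y :+ f :* con (+ 0)) refl y F))

  quotientRing : CommutativeRing 0ℓ 0ℓ
  quotientRing = record
    { Carrier = Carrier ; _≈_ = _≈ᶠ_ ; _+_ = _+_ ; _*_ = _*_ ; -_ = -_ ; 0# = 0# ; 1# = 1#
    ; isCommutativeRing = record
      { isRing = record
        { +-isAbelianGroup = record
          { isGroup = record
            { isMonoid = record
              { isSemigroup = record
                { isMagma = record
                  { isEquivalence = record
                    { refl = ≈⇒≈ᶠ refl
                    ; sym = λ {x} {y} (differBy {g} eq) → differBy (trans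
                        (solve 3 (λ y f g → y := (y :+ f :* g) :+ f :* :- g) refl y F g)
                        (+-congʳ (sym eq)))
                    ; trans = λ {x} {y} {z} (differBy {g} eq) (differBy {h} eq′) → differBy (trans eq
                        (trans (+-congʳ eq′) (solve 4 (λ z f g h → (z :+ f :* h) :+ f :* g := z :+ f :* (h :+ g)) refl z F g h))) }
                  ; ∙-cong = λ {x} {y} {u} {v} (differBy {g} eq) (differBy {h} eq′) → differBy (trans (+-cong eq eq′)
                      (solve 5 (λ y v f g h → (y :+ f :* g) :+ (v :+ f :* h) := (y :+ v) :+ f :* (g :+ h)) refl y v F g h)) }
                ; assoc = λ x y z → ≈⇒≈ᶠ (+-assoc x y z) }
              ; identity = (λ x → ≈⇒≈ᶠ (+-identityˡ x)) , (λ x → ≈⇒≈ᶠ (+-identityʳ x)) }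
            ; inverse = (λ x → ≈⇒≈ᶠ (-‿inverseˡ x)) , (λ x → ≈⇒≈ᶠ (-‿inverseʳ x))
            ; ⁻¹-cong = λ {x} {y} (differBy {g} eq) → differBy (trans (-‿cong eq)
                (solve 3 (λ y f g → :- (y :+ f :* g) := :- y :+ f :* :- g) refl y F g)) }
          ; comm = λ x y → ≈⇒≈ᶠ (+-comm x y) }
        ; *-cong = λ {x} {y} {u} {v} (differBy {g} eq) (differBy {h} eq′) → differBy (trans (*-cong eq eq′)
            (solve 5 (λ y v f g h → (y :+ f :* g) :* (v :+ f :* h) := y :* v :+ f :* (g :* (v :+ f :* h) :+ y :* h)) refl y v F g h))
        ; *-assoc = λ x y z → ≈⇒≈ᶠ (*-assoc x y z)
        ; *-identity = (λ x → ≈⇒≈ᶠ (*-identityˡ x)) , (λ x → ≈⇒≈ᶠ (*-identityʳ x))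
        ; distrib = (λ x y z → ≈⇒≈ᶠ (distribˡ x y z)) , (λ x y z → ≈⇒≈ᶠ (distribʳ x y z)) }
      ; *-comm = λ x y → ≈⇒≈ᶠ (*-comm x y) } }

  projection : RingHom A quotientRing
  projection = record
    { ⟦_⟧ = λ x → x ; ⟦⟧-cong = ≈⇒≈ᶠ
    ; +-homo = λ x y → ≈⇒≈ᶠ refl ; *-homo = λ x y → ≈⇒≈ᶠ refl ; 1-homo = ≈⇒≈ᶠ refl }

map-geom : ∀ {A B} (φ : RingHom A B) → let open RingHom φ; open CommutativeRing B in
           ∀ x n → ⟦ Geometric.geom A x n ⟧ ≈ Geometric.geom B ⟦ x ⟧ n
map-geom {A} {B} φ x zero = RingHom.0-homo φ
map-geom {A} {B} φ x (suc n) = trans (+-homo _ _) (+-cong 1-homo (trans (*-homo _ _) (*-congˡ (map-geom φ x n))))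
  where
  open RingHom φ
  open CommutativeRing B

module GeometricFactors (A : CommutativeRing 0ℓ 0ℓ) where
  open CommutativeRing A hiding (zero)
  open Geometric A
  open Algebra.Properties.CommutativeSemiring.Exp commutativeSemiring using (_^_)
  open Ringℤ A
  open Congruence A using (ι-suc)
  open Relation.Binary.Reasoning.Setoid setoid

  geom-+ : ∀ x m n → geom x (m ℕ.+ n) ≈ geom x m + x ^ m * geom x n
  geom-+ x zero n = solve 1 (λ g → g := con (+ 0) :+ con (+ 1) :* g) refl (geom x n)
  geom-+ x (suc m) n = trans (+-congˡ (*-congˡ (geom-+ x m n)))
    (solve 4 (λ x g y h → con (+ 1) :+ x :* (g :+ y :* h) := con (+ 1) :+ x :* g :+ x :* y :* h) refl x (geom x m) (x ^ m) (geom x n))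

  geom-factor : ∀ x m n → geom x (n ℕ.* m) ≈ geom x m * geom (x ^ m) n
  geom-factor x m zero = sym (zeroʳ _)
  geom-factor x m (suc n) = begin
    geom x (m ℕ.+ n ℕ.* m) ≈⟨ geom-+ x m (n ℕ.* m) ⟩
    geom x m + x ^ m * geom x (n ℕ.* m) ≈⟨ +-congˡ (*-congˡ (geom-factor x m n)) ⟩
    geom x m + x ^ m * (geom x m * geom (x ^ m) n)
      ≈⟨ solve 3 (λ g y h → g :+ y :* (g :* h) := g :* (con (+ 1) :+ y :* h)) refl (geom x m) (x ^ m) (geom (x ^ m) n) ⟩
    geom x m * (1# + x ^ m * geom (x ^ m) n) ∎

  -- Every power of s is 1 modulo s - 1. Over ℤ[t] this yields Φ ≡ p, and over ℤ the factor of qⁿ -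
  -- 1 that is prime to p.
  geom-expansion : ∀ s n → ∃ λ h → geom s n ≈ ι (+ n) + (s - 1#) * h
  geom-expansion s zero = 0# , solve 1 (λ s → con (+ 0) := con (+ 0) :+ (s :- con (+ 1)) :* con (+ 0)) refl s
  geom-expansion s (suc n) with h , eq ← geom-expansion s n = geom s n + h , (begin
    1# + s * geom s n ≈⟨ solve 2 (λ s g → con (+ 1) :+ s :* g := con (+ 1) :+ (g :+ (s :- con (+ 1)) :* g)) refl s (geom s n) ⟩
    1# + (geom s n + (s - 1#) * geom s n) ≈⟨ +-congˡ (+-congʳ eq) ⟩
    1# + (ι (+ n) + (s - 1#) * h + (s - 1#) * geom s n)
      ≈⟨ solve 4 (λ i d h g → con (+ 1) :+ (i :+ d :* h :+ d :* g) := (con (+ 1) :+ i) :+ d :* (g :+ h)) refl (ι (+ n)) (s - 1#) h (geom s n) ⟩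
    1# + ι (+ n) + (s - 1#) * (geom s n + h) ≈⟨ +-congʳ (ι-suc n) ⟨
    ι (+ suc n) + (s - 1#) * (geom s n + h) ∎)

  -- geom (x ^ m) n ≡ n modulo geom x m, so a common multiple of both factors,
  -- multiplied by n, is a multiple of their product.
  geom-lcm : ∀ x m n {V g h} → V ≈ geom x m * g → V ≈ geom (x ^ m) n * h →
             ∃ λ c → ι (+ n) * V ≈ geom x (n ℕ.* m) * c
  geom-lcm x m n {V} {g} {h} eqg eqh with e , eq ← geom-expansion (x ^ m) n =
    g - (x - 1#) * e * h , (begin
      ι (+ n) * V ≈⟨ solve 3 (λ i V d → i :* V := (i :+ d) :* V :- d :* V) refl (ι (+ n)) V ((x ^ m - 1#) * e) ⟩
      (ι (+ n) + (x ^ m - 1#) * e) * V - (x ^ m - 1#) * e * V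
        ≈⟨ +-cong (*-cong (sym eq) eqg) (-‿cong (*-cong (*-congʳ (sym (geom-* x m))) eqh)) ⟩
      Φ * (G * g) - G * (x - 1#) * e * (Φ * h)
        ≈⟨ solve 6 (λ Φ G g y e h → Φ :* (G :* g) :- G :* y :* e :* (Φ :* h) := G :* Φ :* (g :- y :* e :* h))
             refl Φ G g (x - 1#) e h ⟩
      G * Φ * (g - (x - 1#) * e * h) ≈⟨ *-congʳ (geom-factor x m n) ⟨
      geom x (n ℕ.* m) * (g - (x - 1#) * e * h) ∎)
    where
    G Φ : Carrier
    G = geom x m
    Φ = geom (x ^ m) n

-- Divisibility of Vₙ in ℤ[t].

module DlogDivisibility (k : ℕ) (pr : Prime (suc k)) where
  open Polynomial
  open Frobenius pr using (ψ; frobenius; eval-t)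
  open CommutativeRing ℤ[t] hiding (zero)
  open Geometric ℤ[t]
  open GeometricFactors ℤ[t]
  open Algebra.Properties.Semiring.Mult semiring using () renaming (_×_ to _·ℕ_)
  open Algebra.Properties.CommutativeSemiring.Exp commutativeSemiring using (_^_)
  open Ringℤ ℤ[t]
  private
    p : ℕ
    p = suc k
    module ψ = RingHom ψ

  b : ℕ → Poly
  b = Ratio.dlogv ℤ[t] t

  ψb : ∀ n → ψ.⟦ b n ⟧ ≈ Ratio.dlogv ℤ[t] (t ^ p) n
  ψb = PowerSeries.at (map-dlogv ψ eval-t)

  private
    coeff₀-geom : ∀ x n .{{_ : ℕ.NonZero n}} → coeff x 0 ≡ ℤ.0ℤ → coeff (geom x n) 0 ≡ ℤ.1ℤ
    coeff₀-geom x (suc n) eq = ≡.trans (coeff₀-+ 1# (x * geom x n))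
      (≡.cong (λ c → ℤ.1ℤ ℤ.+ c) (≡.trans (coeff₀-* x (geom x n)) (≡.cong (λ c → c ℤ.* coeff (geom x n) 0) eq)))

    coeff₀-t^ : ∀ n .{{_ : ℕ.NonZero n}} → coeff (t ^ n) 0 ≡ ℤ.0ℤ
    coeff₀-t^ (suc n) = coeff₀-* t (t ^ n)

    -- The cyclotomic polynomial of order p^(i+1), one above its index.
    Φ : ℕ → Poly
    Φ i = geom (t ^ (p ℕ.^ i)) p

    coeff₀-Φ : ∀ i → coeff (Φ i) 0 ≡ ℤ.1ℤ
    coeff₀-Φ i = coeff₀-geom (t ^ (p ℕ.^ i)) p (coeff₀-t^ (p ℕ.^ i) {{ℕ.m^n≢0 p i}})

  module _ (i : ℕ) where
    private
      module Q = Quotient ℤ[t] (Φ i)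
      ℤ[ζ] : CommutativeRing 0ℓ 0ℓ
      ℤ[ζ] = Q.quotientRing
      module ℤζ = CommutativeRing ℤ[ζ]
      open RingHom Q.projection using (×-homo; ^-homo)

      -- If p x is a multiple of Φ i, the constant term 1 of Φ i allows p to be cancelled from the
      -- cofactor.
      tf : Geometric.TorsionFree ℤ[ζ] p
      tf {x} eq = Q.differBy (trans (proj₂ cancelled) (sym (+-identityˡ _)))
        where
        multiple : p ·ℕ x Q.≈ᶠ 0#
        multiple = ℤζ.trans (×-homo p x) eq
        cancelled : ∃ λ g → x ≈ Φ i * g
        cancelled = cancel-multiple p (Φ i) (Q.cofactor multiple) x (coeff₀-Φ i)
          (trans (Q.difference multiple) (+-identityˡ _))

      root : Geometric.CyclotomicRoot ℤ[ζ] p (suc i) t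
      root = ℤζ.trans (Geometric.geom-cong ℤ[ζ] p (ℤζ.sym (^-homo t (p ℕ.^ i))))
        (ℤζ.trans (ℤζ.sym (map-geom Q.projection (t ^ (p ℕ.^ i)) p))
          (Q.differBy (solve 1 (λ f → f := con (+ 0) :+ f :* con (+ 1)) refl (Φ i))))

    -- The class of t is the root ζ in ℤ[t]/(Φ i), so the equality bₙₚ(ζ) = bₙ(ζᵖ) there is
    -- precisely divisibility by Φ i.
    Φ-divides : ∀ n → p ℕ.^ i ∣ n → ∃ λ g → b (n ℕ.* p) ≈ ψ.⟦ b n ⟧ + Φ i * g
    Φ-divides n pⁱ∣n = Q.cofactor congruent , Q.difference congruent
      where
      congruent : b (n ℕ.* p) Q.≈ᶠ ψ.⟦ b n ⟧
      congruent = ℤζ.trans (PowerSeries.at (map-dlogv Q.projection ℤζ.refl) (n ℕ.* p))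
        (ℤζ.trans (RootOfUnity.dlogv-root ℤ[ζ] k pr tf i root n pⁱ∣n)
          (ℤζ.trans (ℤζ.sym (PowerSeries.at (map-dlogv Q.projection (^-homo t p)) n))
            (Q.≈⇒≈ᶠ (sym (ψb n)))))

  -- The sum of length p^(j+1) is the sum of length pʲ times Φ j. These factors need not be
  -- comaximal in ℤ[t], so `geom-lcm` only reaches p V; the constant term 1 then removes p.
  geom-divides : ∀ j n → p ℕ.^ j ∣ n ℕ.* p → ∃ λ g → b (n ℕ.* p) - ψ.⟦ b n ⟧ ≈ geom t (p ℕ.^ j) * g
  geom-divides zero n _ = b (n ℕ.* p) - ψ.⟦ b n ⟧ ,
    solve 2 (λ x t → x := (con (+ 1) :+ t :* con (+ 0)) :* x) refl _ t
  geom-divides (suc j) n div = cancel-multiple p (geom t (p ℕ.^ suc j)) (proj₁ multiple) V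
    (coeff₀-geom t (p ℕ.^ suc j) {{ℕ.m^n≢0 p (suc j)}} ≡.refl) (trans (ι-× p V) (proj₂ multiple))
    where
    V : Poly
    V = b (n ℕ.* p) - ψ.⟦ b n ⟧
    lower : ∃ λ g → V ≈ geom t (p ℕ.^ j) * g
    lower = geom-divides j n (∣-trans (n∣m*n p) div)
    upper : ∃ λ g → b (n ℕ.* p) ≈ ψ.⟦ b n ⟧ + Φ j * g
    upper = Φ-divides j n (*-cancelʳ-∣ p (≡.subst (_∣ n ℕ.* p) (ℕ.*-comm p (p ℕ.^ j)) div))
    multiple : ∃ λ c → ι (+ p) * V ≈ geom t (p ℕ.^ suc j) * c
    multiple = geom-lcm t (p ℕ.^ j) p (proj₂ lower) (trans (+-congʳ (proj₂ upper))
      (solve 2 (λ a d → (a :+ d) :- a := d) refl ψ.⟦ b n ⟧ (Φ j * proj₁ upper)))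

  -- The Gauss congruence gives V = N w and `geom-divides` shows that the geometric sum divides N w.
  -- Having constant term 1, it divides w already.
  dlog-divisible : ∀ j n → p ℕ.^ j ∣ n ℕ.* p →
    ∃ λ g → b (n ℕ.* p) - ψ.⟦ b n ⟧ ≈ (p ℕ.^ j) ·ℕ (geom t (p ℕ.^ j) * g)
  dlog-divisible zero n div = proj₁ divided , trans (proj₂ divided) (sym (+-identityʳ _))
    where
    divided : ∃ λ g → b (n ℕ.* p) - ψ.⟦ b n ⟧ ≈ geom t 1 * g
    divided = geom-divides zero n div
  dlog-divisible (suc j) n div = proj₁ cancelled ,
    trans V≈ (Algebra.Properties.Semiring.Mult.×-congʳ semiring N (proj₂ cancelled))
    where
    N : ℕ
    N = p ℕ.^ suc j
    instance _ = ℕ.m^n≢0 p (suc j)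
    open Congruence ℤ[t]
    congruent : b (n ℕ.* p) ≡ GaussCongruence.Ψ ℤ[t] k pr (torsionFree p) ψ frobenius b (n ℕ.* p) [mod N ]
    congruent = GaussCongruence.dlog-congruence ℤ[t] k pr (torsionFree p) ψ frobenius
      (Ratio.v ℤ[t] t) (Ratio.v⁻¹ ℤ[t] t) (Ratio.v⊗v⁻¹ ℤ[t] t) j (n ℕ.* p) div
    V≈ : b (n ℕ.* p) - ψ.⟦ b n ⟧ ≈ N ·ℕ quotient congruent
    V≈ = trans (+-congʳ (trans (equation congruent)
        (+-congʳ (reflexive (PowerSeries.expand-at ℤ[t] k (λ m → ψ.⟦ b m ⟧) n)))))
      (solve 2 (λ a w → (a :+ w) :- a := w) refl ψ.⟦ b n ⟧ (N ·ℕ quotient congruent))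
    divided : ∃ λ g → b (n ℕ.* p) - ψ.⟦ b n ⟧ ≈ geom t N * g
    divided = geom-divides (suc j) n div
    cancelled : ∃ λ g → quotient congruent ≈ geom t N * g
    cancelled = cancel-multiple N (geom t N) (proj₁ divided) (quotient congruent)
      (coeff₀-geom t N ≡.refl) (trans (sym V≈) (proj₂ divided))

-- The formal logarithm and the q-difference equation.

module Logarithm (K : CommutativeRing 0ℓ 0ℓ) (recip : ℕ → CommutativeRing.Carrier K)
  (recip-inverse : ∀ k → CommutativeRing._≈_ K
    (CommutativeRing._*_ K (recip k) (Ringℤ.ι K (+ suc k))) (CommutativeRing.1# K)) where
  open CommutativeRing K hiding (zero)
  open PowerSeries K
  private
    module S = CommutativeRing series
    module Kℤ = Ringℤ K
  open Algebra.Properties.CommutativeSemiring.Exp S.commutativeSemiring using () renaming (_^_ to _^ˢ_)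
  open Algebra.Properties.CommutativeSemiring.Exp commutativeSemiring using (_^_)
  open Algebra.Properties.Semiring.Mult semiring using () renaming (_×_ to _·ℕ_)
  open Algebra.Properties.CommutativeMonoid.Mult +-commutativeMonoid using () renaming (×-distrib-+ to ·ℕ-distrib)
  private module SM = Algebra.Properties.Semiring.Mult S.semiring

  ∑< : ℕ → (ℕ → Carrier) → Carrier
  ∑< zero g = 0#
  ∑< (suc n) g = ∑< n g + g n

  logarithm : Series → Series
  logarithm u n = ∑< n (λ k → (- 1#) ^ k * (recip k * (u ^ˢ suc k) n))

  module _ (u : Series) (u₀ : u 0 ≈ 0#) where
    private
      term : ℕ → Series
      term k = (- 1#) ^ k · (u ^ˢ k ⊗ θ u)

      partialSum : ℕ → Series
      partialSum zero = λ _ → 0#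
      partialSum (suc N) = partialSum N ⊕ term N

      ⊗-vanish : ∀ f {g} n → (∀ k → k ℕ.≤ n → g k ≈ 0#) → (f ⊗ g) n ≈ 0#
      ⊗-vanish f n z = trans (⊗-cong-≤ n {f} {f} {_} {λ _ → 0#} (λ _ _ → refl) z) (at (S.zeroʳ f) n)

      -- Both u and θu have constant term 0, so u^k θu is divisible by z^(k+1).
      power-vanish : ∀ k j → j ℕ.≤ k → (u ^ˢ k ⊗ θ u) j ≈ 0#
      power-vanish zero zero _ = trans (at (S.*-identityˡ (θ u)) 0) refl
      power-vanish (suc k) zero _ = trans (at (S.*-assoc u (u ^ˢ k) (θ u)) 0) (trans (*-congʳ u₀) (zeroˡ _))
      power-vanish (suc k) (suc j) (s≤s j≤k) = trans (at (S.*-assoc u (u ^ˢ k) (θ u)) (suc j))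
        (trans (+-cong (trans (*-congʳ u₀) (zeroˡ _))
          (⊗-vanish (tail u) j (λ i i≤j → power-vanish k i (ℕ.≤-trans i≤j j≤k)))) (+-identityˡ 0#))

      term-vanish : ∀ k j → j ℕ.≤ k → term k j ≈ 0#
      term-vanish k j j≤k = trans (*-congˡ (power-vanish k j j≤k)) (zeroʳ _)

      stable : ∀ j m → partialSum (m ℕ.+ j) j ≈ partialSum j j
      stable j zero = refl
      stable j (suc m) = trans (+-cong (stable j m) (term-vanish (m ℕ.+ j) j (ℕ.m≤n+m j m))) (+-identityʳ _)

      -- The finite geometric series (1 + u) Σ (-u)^k = 1 - (-u)^N over k < N, multiplied by θu.
      telescope : ∀ N → partialSum N ⊗ (const 1# ⊕ u) ⊕ (- 1#) ^ N · (u ^ˢ N ⊗ θ u) ≋ θ u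
      telescope zero = S.trans (S.+-cong (S.zeroˡ _)
        (pointwise λ n → trans (*-identityˡ _) (at (S.*-identityˡ (θ u)) n))) (S.+-identityˡ _)
      telescope (suc N) = S.trans (pointwise λ n → trans
          (+-congʳ (at (S.trans (S.distribʳ _ (partialSum N) (term N)) (S.+-congˡ (S.trans (S.distribˡ (term N) (const 1#) u)
            (S.+-cong (S.*-identityʳ _) (S.trans (S.*-comm _ _) (S.trans (S.*-comm _ _) (·-⊗ _ _ _))))))) n))
          (trans (+-congˡ (*-congˡ (at uᴺ⁺¹ n)))
            (Kℤ.solve 4 (λ a s x y → (a Kℤ.:+ (s Kℤ.:* x Kℤ.:+ s Kℤ.:* y)) Kℤ.:+ Kℤ.:- Kℤ.con (+ 1) Kℤ.:* s Kℤ.:* y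
               Kℤ.:= a Kℤ.:+ s Kℤ.:* x) refl _ _ _ _)))
        (telescope N)
        where
        uᴺ⁺¹ : u ^ˢ suc N ⊗ θ u ≋ (u ^ˢ N ⊗ θ u) ⊗ u
        uᴺ⁺¹ = S.trans (S.*-congʳ (S.*-comm u (u ^ˢ N))) (S.trans (S.*-assoc _ _ _)
          (S.trans (S.*-congˡ (S.*-comm _ _)) (S.sym (S.*-assoc _ _ _))))

      θ-term : ∀ n k → n ·ℕ ((- 1#) ^ k * (recip k * (u ^ˢ suc k) n)) ≈ term k n
      θ-term n k = begin
        n ·ℕ (s * (r * (u ^ˢ suc k) n)) ≈⟨ Kℤ.ι-× n _ ⟩
        Kℤ.ι (+ n) * (s * (r * (u ^ˢ suc k) n))
          ≈⟨ Kℤ.solve 4 (λ n s r x → n Kℤ.:* (s Kℤ.:* (r Kℤ.:* x)) Kℤ.:= s Kℤ.:* (r Kℤ.:* (n Kℤ.:* x))) refl _ _ _ _ ⟩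
        s * (r * (Kℤ.ι (+ n) * (u ^ˢ suc k) n)) ≈⟨ *-congˡ (*-congˡ (Kℤ.ι-× n _)) ⟨
        s * (r * (θ (u ^ˢ suc k)) n) ≈⟨ *-congˡ (*-congˡ (at (θ-^ u k) n)) ⟩
        s * (r * (suc k SM.× (u ^ˢ k ⊗ θ u)) n)
          ≈⟨ *-congˡ (*-congˡ (trans (×-at (suc k) _ n) (Kℤ.ι-× (suc k) _))) ⟩
        s * (r * (Kℤ.ι (+ suc k) * (u ^ˢ k ⊗ θ u) n)) ≈⟨ *-congˡ (*-assoc _ _ _) ⟨
        s * (r * Kℤ.ι (+ suc k) * (u ^ˢ k ⊗ θ u) n) ≈⟨ *-congˡ (trans (*-congʳ (recip-inverse k)) (*-identityˡ _)) ⟩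
        term k n ∎
        where
        open Relation.Binary.Reasoning.Setoid setoid
        s r : Carrier
        s = (- 1#) ^ k
        r = recip k

      θ-log-at : ∀ n → θ (logarithm u) n ≈ partialSum n n
      θ-log-at n = go n
        where
        go : ∀ N → n ·ℕ ∑< N (λ k → (- 1#) ^ k * (recip k * (u ^ˢ suc k) n)) ≈ partialSum N n
        go zero = trans (Kℤ.ι-× n 0#) (zeroʳ _)
        go (suc N) = trans (·ℕ-distrib _ _ n) (+-cong (go N) (θ-term n N))

    -- Up to zⁿ the derivative of the logarithm agrees with `partialSum n`, and the remainder (-u)ⁿ
    -- θu of the telescoping identity starts only at z^(n+1).
    θ-log : θ (logarithm u) ⊗ (const 1# ⊕ u) ≋ θ (const 1# ⊕ u)
    θ-log = pointwise λ n → begin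
      (θ (logarithm u) ⊗ F) n ≈⟨ ⊗-cong-≤ n {θ (logarithm u)} {partialSum n} {F} {F} (λ j j≤n → trans (θ-log-at j) (agree j≤n)) (λ _ _ → refl) ⟩
      (partialSum n ⊗ F) n ≈⟨ +-identityʳ _ ⟨
      (partialSum n ⊗ F) n + 0# ≈⟨ +-congˡ (term-vanish n n ℕ.≤-refl) ⟨
      (partialSum n ⊗ F) n + term n n ≈⟨ at (telescope n) n ⟩
      θ u n ≈⟨ +-identityˡ _ ⟨
      0# + θ u n ≈⟨ +-congʳ (at (θ-const 1#) n) ⟨
      θ (const 1#) n + θ u n ≈⟨ at (θ-⊕ (const 1#) u) n ⟨
      θ F n ∎
      where
      open Relation.Binary.Reasoning.Setoid setoid
      F : Series
      F = const 1# ⊕ u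
      agree : ∀ {j n} → j ℕ.≤ n → partialSum j j ≈ partialSum n j
      agree {j} {n} j≤n = trans (sym (stable j (n ℕ.∸ j))) (reflexive (≡.cong (λ N → partialSum N j) (ℕ.m∸n+n≡m j≤n)))

module QDifference (K : CommutativeRing 0ℓ 0ℓ) {x t : CommutativeRing.Carrier K}
  (t*x≈1 : CommutativeRing._≈_ K (CommutativeRing._*_ K t x) (CommutativeRing.1# K)) where
  open CommutativeRing K hiding (zero)
  open PowerSeries K
  open Monomial K using (scale-scale; scale-1)
  open Ratio K t
  private
    module S = CommutativeRing series
    module St = RingHom (scaleHom t)
    module Sx = RingHom (scaleHom x)
  open Ringℤ series
  open Relation.Binary.Reasoning.Setoid S.setoid

  module _ {F h : Series} (F₀ : F 0 ≈ 1#) (recurrence : scale x F ≋ F ⊕ shift (scale t F))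
           (dlog : θ h ⊗ F ≋ θ F) where
    private
      Δ : Series
      Δ = scale x F ⊕ neg (v ⊗ F)

      G : Series → Series
      G f = neg (shift (scale t (v⁻¹ ⊗ f)))

      G-causal : Causal G
      G-causal N eq zero _ = refl
      G-causal N eq (suc n) (s≤s n<N) = -‿cong (*-congˡ (⊗-cong-≤ n (λ _ _ → refl) (λ k k≤n → eq k (ℕ.≤-<-trans k≤n n<N))))

      Δ-fixed : Δ ≋ G Δ
      Δ-fixed = begin
        scale x F ⊕ neg (v ⊗ F) ≈⟨ S.+-cong recurrence (S.-‿cong (S.trans (S.distribʳ F _ _) (S.+-cong (S.*-identityˡ F) (shift-⊗ _ F)))) ⟩
        (F ⊕ shift (scale t F)) ⊕ neg (F ⊕ shift (scale t v⁻¹ ⊗ F))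
          ≈⟨ solve 3 (λ f a b → (f :+ a) :- (f :+ b) := :- (b :- a)) S.refl F _ _ ⟩
        neg (shift (scale t v⁻¹ ⊗ F) ⊕ neg (shift (scale t F))) ≈⟨ S.-‿cong (pointwise λ
            { zero → -‿inverseʳ 0# ; (suc n) → at inner n }) ⟩
        G Δ ∎
        where
        inner : scale t v⁻¹ ⊗ F ⊕ neg (scale t F) ≋ scale t (v⁻¹ ⊗ Δ)
        inner = S.sym (begin
          scale t (v⁻¹ ⊗ Δ) ≈⟨ St.⟦⟧-cong (solve 4 (λ vi v f g → vi :* (g :- v :* f) := vi :* g :- (v :* vi) :* f) S.refl v⁻¹ v F (scale x F)) ⟩
          scale t (v⁻¹ ⊗ scale x F ⊕ neg ((v ⊗ v⁻¹) ⊗ F))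
            ≈⟨ St.⟦⟧-cong (S.+-congˡ (S.-‿cong (S.trans (S.*-congʳ v⊗v⁻¹) (S.*-identityˡ F)))) ⟩
          scale t (v⁻¹ ⊗ scale x F ⊕ neg F) ≈⟨ St.+-homo _ _ ⟩
          scale t (v⁻¹ ⊗ scale x F) ⊕ scale t (neg F) ≈⟨ S.+-cong (St.*-homo _ _) (St.neg-homo F) ⟩
          scale t v⁻¹ ⊗ scale t (scale x F) ⊕ neg (scale t F)
            ≈⟨ S.+-congʳ (S.*-congˡ (S.trans (scale-scale t x F) (scale-1 F t*x≈1))) ⟩
          scale t v⁻¹ ⊗ F ⊕ neg (scale t F) ∎)

      G-0 : (λ _ → 0#) ≋ G (λ _ → 0#)
      G-0 = S.sym (S.trans (S.-‿cong (S.trans (shift-cong (S.trans (St.⟦⟧-cong (S.zeroʳ v⁻¹)) St.0-homo))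
        (pointwise λ { zero → refl ; (suc n) → refl }))) (Algebra.Properties.Ring.-0#≈0# S.ring))

    -- The difference Δ = F(xz) - v F satisfies Δ(z) = -z (Δ/v)(tz). This equation is causal and is
    -- solved by 0.
    ratio : scale x F ≋ v ⊗ F
    ratio = x-y≈0⇒x≈y (scale x F) (v ⊗ F) (fix-unique G-causal Δ-fixed G-0)

    -- The logarithmic derivative of F(xz) = v F, whose coefficients read xⁿ n hₙ = n hₙ + bₙ.
    -- Instead of inverting F, the proof establishes the identity multiplied by v F, then cancels F
    -- and multiplies by v⁻¹.
    θ-difference : scale x (θ h) ≋ θ h ⊕ dlogv
    θ-difference = begin
      scale x (θ h) ≈⟨ S.*-identityʳ _ ⟨
      scale x (θ h) ⊗ const 1# ≈⟨ S.*-congˡ v⊗v⁻¹ ⟨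
      scale x (θ h) ⊗ (v ⊗ v⁻¹) ≈⟨ S.*-assoc _ _ _ ⟨
      (scale x (θ h) ⊗ v) ⊗ v⁻¹ ≈⟨ S.*-congʳ (x-y≈0⇒x≈y _ _ (⊗-cancel _ F₀ product)) ⟩
      (v ⊗ θ h ⊕ θ v) ⊗ v⁻¹ ≈⟨ solve 4 (λ v h v′ vi → (v :* h :+ v′) :* vi := (v :* vi) :* h :+ v′ :* vi) S.refl v (θ h) (θ v) v⁻¹ ⟩
      (v ⊗ v⁻¹) ⊗ θ h ⊕ dlogv ≈⟨ S.+-congʳ (S.trans (S.*-congʳ v⊗v⁻¹) (S.*-identityˡ _)) ⟩
      θ h ⊕ dlogv ∎
      where
      product : (scale x (θ h) ⊗ v ⊕ neg (v ⊗ θ h ⊕ θ v)) ⊗ F ≋ (λ _ → 0#)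
      product = begin
        (scale x (θ h) ⊗ v ⊕ neg (v ⊗ θ h ⊕ θ v)) ⊗ F
          ≈⟨ solve 5 (λ a v h v′ f → (a :* v :- (v :* h :+ v′)) :* f := a :* (v :* f) :- (v′ :* f :+ v :* (h :* f))) S.refl
               (scale x (θ h)) v (θ h) (θ v) F ⟩
        scale x (θ h) ⊗ (v ⊗ F) ⊕ neg (θ v ⊗ F ⊕ v ⊗ (θ h ⊗ F))
          ≈⟨ S.+-cong (S.*-congˡ (S.sym ratio)) (S.-‿cong (S.+-congˡ (S.*-congˡ dlog))) ⟩
        scale x (θ h) ⊗ scale x F ⊕ neg (θ v ⊗ F ⊕ v ⊗ θ F)
          ≈⟨ S.+-cong (Sx.*-homo _ _) (S.-‿cong (θ-⊗ v F)) ⟨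
        scale x (θ h ⊗ F) ⊕ neg (θ (v ⊗ F)) ≈⟨ S.+-cong (Sx.⟦⟧-cong dlog) (S.-‿cong (θ-cong (S.sym ratio))) ⟩
        scale x (θ F) ⊕ neg (θ (scale x F)) ≈⟨ S.+-congˡ (S.-‿cong (θ-scale x F)) ⟩
        scale x (θ F) ⊕ neg (scale x (θ F)) ≈⟨ S.-‿inverseʳ _ ⟩
        (λ _ → 0#) ∎

-- Rational numbers, and the series of the statement in recursive form.

module Rational where
  open CommutativeRing ℚ.+-*-commutativeRing
    using (_+_; _*_; -_; _-_; 1#; *-assoc; *-identityˡ; *-identityʳ; *-congˡ)
  open Ringℤ ℚ.+-*-commutativeRing
  open ≡.≡-Reasoning

  private
    fromℤ : ℤ → ℚ
    fromℤ i = mkℚ i 0 (Coprimality.sym (1-coprimeTo ℤ.∣ i ∣))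

    /1≡fromℤ : ∀ i → i ℚ./ 1 ≡ fromℤ i
    /1≡fromℤ i = ℚ.↥p/↧p≡p (fromℤ i)

  ι≡/1 : ∀ i → ι i ≡ i ℚ./ 1
  ι≡/1 (+ n) = go n
    where
    go : ∀ n → ι (+ n) ≡ + n ℚ./ 1
    go zero = ≡.refl
    go (suc n) = begin
      ι (+ suc n) ≡⟨ Congruence.ι-suc ℚ.+-*-commutativeRing n ⟩
      1ℚ + ι (+ n) ≡⟨ ≡.cong (λ r → 1ℚ + r) (≡.trans (go n) (/1≡fromℤ (+ n))) ⟩
      1ℚ + fromℤ (+ n) ≡⟨ ≡.cong (λ i → (ℤ.1ℤ ℤ.+ i) ℚ./ 1) (ℤ.*-identityʳ (+ n)) ⟩
      + suc n ℚ./ 1 ∎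
  ι≡/1 -[1+ n ] = ≡.cong -_ (ι≡/1 (+ suc n))

  private
    ι≡fromℤ : ∀ i → ι i ≡ fromℤ i
    ι≡fromℤ i = ≡.trans (ι≡/1 i) (/1≡fromℤ i)

  ι-injective : ∀ {i j} → ι i ≡ ι j → i ≡ j
  ι-injective {i} {j} eq = ≡.cong ↥_ (≡.trans (≡.sym (ι≡fromℤ i)) (≡.trans eq (ι≡fromℤ j)))

  -- For r = n / d in lowest terms, n D = a d, so d divides D and p ∣ d would imply p ∣ D.
  integral : ∀ p r D a → r * ι D ≡ ι a → ¬ p ∣ ℤ.∣ D ∣ → InZp p r
  integral p r@(mkℚ n d-1 c) D a eq p∤D p∣d = p∤D (∣-trans p∣d
    (coprime-divisor (Coprimality.sym (Coprimality.recompute c)) (divides ℤ.∣ a ∣ (≡.trans (≡.sym (ℤ.abs-* n D))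
      (≡.trans (≡.cong ℤ.∣_∣ cross) (ℤ.abs-* a (+ suc d-1)))))))
    where
    unnormalised : toℚᵘ r ℚᵘ.* toℚᵘ (fromℤ D) ℚᵘ.≃ toℚᵘ (fromℤ a)
    unnormalised = ℚᵘ.≃-trans (ℚᵘ.≃-sym (ℚ.toℚᵘ-homo-* r (fromℤ D)))
      (ℚ.toℚᵘ-cong (≡.trans (≡.cong (λ s → r * s) (≡.sym (ι≡fromℤ D))) (≡.trans eq (ι≡fromℤ a))))
    cross : n ℤ.* D ≡ a ℤ.* + suc d-1
    cross with ℚᵘ.*≡* e ← unnormalised = ≡.trans (≡.sym (ℤ.*-identityʳ _))
      (≡.trans e (≡.cong (λ m → a ℤ.* + m) (ℕ.*-identityʳ (suc d-1))))

  inv-inverse : ∀ {y} → y ≢ 0ℚ → inv y * y ≡ 1ℚ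
  inv-inverse {y} y≢0 with y ℚ.≟ 0ℚ
  ... | yes y≡0 = contradiction y≡0 y≢0
  ... | no ne = ℚ.*-inverseˡ y {{ℚ.≢-nonZero ne}}

  *-cancel : ∀ {y a b} → y ≢ 0ℚ → y * a ≡ y * b → a ≡ b
  *-cancel {y} {a} {b} y≢0 eq = begin
    a ≡⟨ *-identityˡ a ⟨
    1ℚ * a ≡⟨ ≡.cong (λ c → c * a) (inv-inverse y≢0) ⟨
    inv y * y * a ≡⟨ *-assoc (inv y) y a ⟩
    inv y * (y * a) ≡⟨ ≡.cong (λ c → inv y * c) eq ⟩
    inv y * (y * b) ≡⟨ *-assoc (inv y) y b ⟨
    inv y * y * b ≡⟨ ≡.cong (λ c → c * b) (inv-inverse y≢0) ⟩
    1ℚ * b ≡⟨ *-identityˡ b ⟩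
    b ∎

  *-≢0 : ∀ {a b} → a ≢ 0ℚ → b ≢ 0ℚ → a * b ≢ 0ℚ
  *-≢0 {a} {b} a≢0 b≢0 eq = b≢0 (*-cancel a≢0 (≡.trans eq (≡.sym (ℚ.*-zeroʳ a))))

  recip : ℕ → ℚ
  recip k = + 1 ℚ./ suc k

  recip-inverse : ∀ k → recip k * ι (+ suc k) ≡ 1ℚ
  recip-inverse k = ≡.trans (≡.cong₂ _*_ (ℚ.↥p/↧p≡p (mkℚ (+ 1) k (1-coprimeTo (suc k)))) (ι≡fromℤ (+ suc k)))
    (ℚ.*-inverseˡ (fromℤ (+ suc k)))

  open PowerSeries ℚ.+-*-commutativeRing public
  open Logarithm ℚ.+-*-commutativeRing recip recip-inverse public
  private
    module S = CommutativeRing series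
  open import Algebra.Properties.CommutativeSemiring.Exp S.commutativeSemiring using () renaming (_^_ to _^ˢ_)
  open import Algebra.Properties.CommutativeSemiring.Exp (CommutativeRing.commutativeSemiring ℚ.+-*-commutativeRing) using (_^_)

  ^ℚ≡^ : ∀ x n → x ^ℚ n ≡ x ^ n
  ^ℚ≡^ x zero = ≡.refl
  ^ℚ≡^ x (suc n) = ≡.cong (λ y → x * y) (^ℚ≡^ x n)

  private
    -- `sumTo` splits off the last term, the recursive Cauchy product the first one.
    sumTo-suc : ∀ n g → sumTo (suc n) g ≡ g 0 + sumTo n (λ k → g (suc k))
    sumTo-suc zero g = ℚ.+-comm 0ℚ (g 0)
    sumTo-suc (suc n) g = ≡.trans (≡.cong (λ s → s + g (suc n)) (sumTo-suc n g))
      (ℚ.+-assoc (g 0) (sumTo n (λ k → g (suc k))) (g (suc n)))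

  cauchy≡⊗ : ∀ f g n → sumTo (suc n) (λ k → f k * g (n ℕ.∸ k)) ≡ (f ⊗ g) n
  cauchy≡⊗ f g zero = ℚ.+-identityˡ _
  cauchy≡⊗ f g (suc n) = ≡.trans (sumTo-suc (suc n) (λ k → f k * g (suc n ℕ.∸ k)))
    (≡.cong (λ s → f 0 * g (suc n) + s) (cauchy≡⊗ (tail f) g n))

  psPow≡^ : ∀ f m n → psPow f m n ≡ (f ^ˢ m) n
  psPow≡^ f zero zero = ≡.refl
  psPow≡^ f zero (suc n) = ≡.refl
  psPow≡^ f (suc m) n = ≡.trans (cauchy≡⊗ f (psPow f m) n) (at (S.*-congˡ {f} (pointwise (psPow≡^ f m))) n)

  psLog≡logarithm : ∀ f n → psLog f n ≡ logarithm (dropConst f) n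
  psLog≡logarithm f n = go n
    where
    go : ∀ N → sumTo N (λ k → ((ℚ.- 1ℚ) ^ℚ k) * ((+ 1 ℚ./ suc k) * psPow (dropConst f) (suc k) n))
             ≡ ∑< N (λ k → (- 1#) ^ k * (recip k * (dropConst f ^ˢ suc k) n))
    go zero = ≡.refl
    go (suc N) = ≡.cong₂ _+_ (go N) (≡.cong₂ _*_ (^ℚ≡^ (ℚ.- 1ℚ) N)
      (≡.cong (λ y → recip N * y) (psPow≡^ (dropConst f) (suc N) n)))

-- With t = 1/Q, fSeries Q is the Rogers–Ramanujan series Σ t^(n²) zⁿ / (t;t)ₙ.
module RogersRamanujanSeries (Q : ℕ) (Q>1 : 1 ℕ.< Q) where
  open Rational
  open CommutativeRing ℚ.+-*-commutativeRing
    using (_+_; _*_; -_; _-_)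
  open Ringℤ ℚ.+-*-commutativeRing
  open import Algebra.Properties.CommutativeSemiring.Exp (CommutativeRing.commutativeSemiring ℚ.+-*-commutativeRing)
    using (_^_; ^-homo-*)
  open ≡.≡-Reasoning

  x t : ℚ
  x = ι (+ Q)
  t = inv x

  private
    x≡ : x ≡ ℕ→ℚ Q
    x≡ = ι≡/1 (+ Q)

  ι-^ : ∀ n → ι (+ (Q ℕ.^ n)) ≡ x ^ n
  ι-^ zero = ≡.refl
  ι-^ (suc n) = ≡.trans (≡.cong ι (ℤ.pos-* Q (Q ℕ.^ n))) (≡.trans (ι-* (+ Q) (+ (Q ℕ.^ n))) (≡.cong (λ y → x * y) (ι-^ n)))

  x^≢1 : ∀ n .{{_ : ℕ.NonZero n}} → x ^ n ≢ 1ℚ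
  x^≢1 n@(suc _) eq with ℕ.m^n≡1⇒n≡0∨m≡1 Q n (ℤ.+-injective (ι-injective {+ (Q ℕ.^ n)} {+ 1} (≡.trans (ι-^ n) eq)))
  ... | inj₂ Q≡1 = ℕ.<-irrefl (≡.sym Q≡1) Q>1

  x≢0 : x ≢ 0ℚ
  x≢0 eq = ℕ.<-irrefl (≡.sym (ℤ.+-injective (ι-injective {+ Q} {+ 0} eq))) (ℕ.<-trans (s≤s z≤n) Q>1)

  t*x≡1 : t * x ≡ 1ℚ
  t*x≡1 = inv-inverse x≢0

  private
    x^≢0 : ∀ n → x ^ n ≢ 0ℚ
    x^≢0 zero = λ ()
    x^≢0 (suc n) = *-≢0 x≢0 (x^≢0 n)

    t^*x^ : ∀ n → t ^ n * x ^ n ≡ 1ℚ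
    t^*x^ n = Powers.^-inverse ℚ.+-*-commutativeRing {t} {x} n t*x≡1

    1-x^≢0 : ∀ n → 1ℚ - x ^ suc n ≢ 0ℚ
    1-x^≢0 n eq = x^≢1 (suc n) (≡.sym (x-y≈0⇒x≈y 1ℚ (x ^ suc n) eq))

    D : ℕ → ℚ
    D n = (x ^ℚ (n C 2)) * qPoch x n

    qPoch≢0 : ∀ n → qPoch x n ≢ 0ℚ
    qPoch≢0 zero = λ ()
    qPoch≢0 (suc n) = *-≢0 (qPoch≢0 n) (λ eq → 1-x^≢0 n (≡.trans (≡.cong (λ y → 1ℚ - y) (≡.sym (^ℚ≡^ x (suc n)))) eq))

    D≢0 : ∀ n → D n ≢ 0ℚ
    D≢0 n = *-≢0 (λ eq → x^≢0 (n C 2) (≡.trans (≡.sym (^ℚ≡^ x (n C 2))) eq)) (qPoch≢0 n)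

    -- C(n+1, 2) = C(n, 2) + n supplies the factor xⁿ.
    D-suc : ∀ n → D (suc n) ≡ D n * (x ^ n * (1ℚ - x ^ suc n))
    D-suc n = begin
      (x ^ℚ (suc n C 2)) * (qPoch x n * (1ℚ - (x ^ℚ suc n)))
        ≡⟨ ≡.cong₂ (λ a b → a * (qPoch x n * (1ℚ - b))) exponent (^ℚ≡^ x (suc n)) ⟩
      (x ^ℚ (n C 2)) * x ^ n * (qPoch x n * (1ℚ - x ^ suc n))
        ≡⟨ solve 4 (λ a b c d → a :* b :* (c :* d) := a :* c :* (b :* d)) ≡.refl (x ^ℚ (n C 2)) (x ^ n) (qPoch x n) (1ℚ - x ^ suc n) ⟩
      D n * (x ^ n * (1ℚ - x ^ suc n)) ∎
      where
      exponent : x ^ℚ (suc n C 2) ≡ (x ^ℚ (n C 2)) * x ^ n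
      exponent = begin
        x ^ℚ (suc n C 2) ≡⟨ ^ℚ≡^ x (suc n C 2) ⟩
        x ^ (suc n C 2) ≡⟨ ≡.cong (x ^_) (≡.trans (≡.sym (nCk+nC[k+1]≡[n+1]C[k+1] n 1))
          (≡.trans (≡.cong (λ m → m ℕ.+ (n C 2)) (nC1≡n n)) (ℕ.+-comm n (n C 2)))) ⟩
        x ^ ((n C 2) ℕ.+ n) ≡⟨ ^-homo-* x (n C 2) n ⟩
        x ^ (n C 2) * x ^ n ≡⟨ ≡.cong (λ y → y * x ^ n) (^ℚ≡^ x (n C 2)) ⟨
        (x ^ℚ (n C 2)) * x ^ n ∎

  F : Series
  F = fSeries Q

  private
    F*D : ∀ n → F n * D n ≡ (ℚ.- 1ℚ) ^ℚ n
    F*D n = begin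
      F n * D n ≡⟨ ≡.cong (λ y → ((ℚ.- 1ℚ) ^ℚ n) * inv ((y ^ℚ (n C 2)) * qPoch y n) * D n) x≡ ⟨
      ((ℚ.- 1ℚ) ^ℚ n) * inv (D n) * D n ≡⟨ ℚ.*-assoc ((ℚ.- 1ℚ) ^ℚ n) (inv (D n)) (D n) ⟩
      ((ℚ.- 1ℚ) ^ℚ n) * (inv (D n) * D n) ≡⟨ ≡.cong (λ y → ((ℚ.- 1ℚ) ^ℚ n) * y) (inv-inverse (D≢0 n)) ⟩
      ((ℚ.- 1ℚ) ^ℚ n) * 1ℚ ≡⟨ ℚ.*-identityʳ _ ⟩
      (ℚ.- 1ℚ) ^ℚ n ∎

    F-suc : ∀ n → F (suc n) * (x ^ n * (1ℚ - x ^ suc n)) ≡ - F n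
    F-suc n = *-cancel (D≢0 n) (begin
      D n * (F (suc n) * d) ≡⟨ solve 3 (λ a b c → a :* (b :* c) := b :* (a :* c)) ≡.refl (D n) (F (suc n)) d ⟩
      F (suc n) * (D n * d) ≡⟨ ≡.cong (λ y → F (suc n) * y) (D-suc n) ⟨
      F (suc n) * D (suc n) ≡⟨ F*D (suc n) ⟩
      (- 1ℚ) * ((ℚ.- 1ℚ) ^ℚ n) ≡⟨ ≡.cong (λ y → (- 1ℚ) * y) (F*D n) ⟨
      (- 1ℚ) * (F n * D n) ≡⟨ solve 2 (λ a b → (:- con (+ 1)) :* (a :* b) := b :* :- a) ≡.refl (F n) (D n) ⟩
      D n * - F n ∎)
      where
      d : ℚ
      d = x ^ n * (1ℚ - x ^ suc n)

  F₀ : F 0 ≡ 1ℚ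
  F₀ = ≡.trans (≡.sym (ℚ.*-identityʳ (F 0))) (F*D 0)

  -- Coefficient n+1 says (x^(n+1) - 1) F_(n+1) = tⁿ Fₙ, which is `F-suc` multiplied by tⁿ.
  recurrence : scale x F ≋ F ⊕ shift (scale t F)
  recurrence = pointwise λ
    { zero → solve 1 (λ a → con (+ 1) :* a := a :+ con (+ 0)) ≡.refl (F 0)
    ; (suc n) → ≡.sym (begin
        F (suc n) + t ^ n * F n
          ≡⟨ solve 3 (λ a t b → a :+ t :* b := a :- t :* :- b) ≡.refl (F (suc n)) (t ^ n) (F n) ⟩
        F (suc n) - t ^ n * - F n ≡⟨ ≡.cong (λ y → F (suc n) - t ^ n * y) (F-suc n) ⟨
        F (suc n) - t ^ n * (F (suc n) * (x ^ n * (1ℚ - x ^ suc n)))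
          ≡⟨ solve 4 (λ a t y z → a :- t :* (a :* (y :* (con (+ 1) :- z))) := a :- (t :* y) :* (a :* (con (+ 1) :- z)))
               ≡.refl (F (suc n)) (t ^ n) (x ^ n) (x ^ suc n) ⟩
        F (suc n) - t ^ n * x ^ n * (F (suc n) * (1ℚ - x ^ suc n))
          ≡⟨ ≡.cong (λ y → F (suc n) - y * (F (suc n) * (1ℚ - x ^ suc n))) (t^*x^ n) ⟩
        F (suc n) - 1ℚ * (F (suc n) * (1ℚ - x ^ suc n))
          ≡⟨ solve 2 (λ a z → a :- con (+ 1) :* (a :* (con (+ 1) :- z)) := z :* a) ≡.refl (F (suc n)) (x ^ suc n) ⟩
        x ^ suc n * F (suc n) ∎) }

  private
    module S = CommutativeRing series
    F≋ : F ≋ const 1ℚ ⊕ dropConst F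
    F≋ = pointwise λ
      { zero → ≡.trans F₀ (≡.sym (ℚ.+-identityʳ 1ℚ))
      ; (suc n) → ≡.sym (ℚ.+-identityˡ (F (suc n))) }

    h≋ : hSeries Q ≋ logarithm (dropConst F)
    h≋ = pointwise (psLog≡logarithm F)

    dlog : θ (hSeries Q) ⊗ F ≋ θ F
    dlog = S.trans (S.*-cong (θ-cong h≋) F≋) (S.trans (θ-log (dropConst F) ≡.refl) (θ-cong (S.sym F≋)))

  open Ratio ℚ.+-*-commutativeRing t using (dlogv)

  h-dlog : ∀ n → (x ^ n - 1ℚ) * (ι (+ n) * hSeries Q n) ≡ dlogv n
  h-dlog n = begin
    (x ^ n - 1ℚ) * nh ≡⟨ solve 2 (λ y a → (y :- con (+ 1)) :* a := y :* a :- a) ≡.refl (x ^ n) nh ⟩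
    x ^ n * nh - nh ≡⟨ ≡.cong (λ y → x ^ n * y - y) (ι-× n (hSeries Q n)) ⟨
    scale x (θ (hSeries Q)) n - θ (hSeries Q) n
      ≡⟨ ≡.cong (λ y → y - θ (hSeries Q) n) (at (QDifference.θ-difference ℚ.+-*-commutativeRing t*x≡1 F₀ recurrence dlog) n) ⟩
    θ (hSeries Q) n + dlogv n - θ (hSeries Q) n
      ≡⟨ solve 2 (λ a b → a :+ b :- a := b) ≡.refl (θ (hSeries Q) n) (dlogv n) ⟩
    dlogv n ∎
    where
    nh : ℚ
    nh = ι (+ n) * hSeries Q n

-- p-integrality of the coefficients.

prime-power-factor : ∀ p .{{_ : ℕ.NonTrivial p}} n .{{_ : ℕ.NonZero n}} → ∃₂ λ v m → n ≡ m ℕ.* p ℕ.^ v Product.× ¬ p ∣ m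
prime-power-factor p n = go n n ℕ.≤-refl
  where
  go : ∀ bound n .{{_ : ℕ.NonZero n}} → n ℕ.≤ bound → ∃₂ λ v m → n ≡ m ℕ.* p ℕ.^ v Product.× ¬ p ∣ m
  go zero (suc _) ()
  go (suc bound) n n≤ with p ∣? n
  ... | no p∤n = 0 , n , ≡.sym (ℕ.*-identityʳ n) , p∤n
  ... | yes (divides c@(suc _) ≡.refl) =
    let v , m , c≡ , p∤m = go bound c (ℕ.≤-pred (ℕ.≤-trans (ℕ.m<m*n c p (ℕ.nonTrivial⇒n>1 p)) n≤)) in
    suc v , m , ≡.trans (≡.cong (ℕ._* p) c≡) (≡.trans (ℕ.*-assoc m (p ℕ.^ v) p) (≡.cong (m ℕ.*_) (ℕ.*-comm (p ℕ.^ v) p))) , p∤m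

substPow-multiple : ∀ p .{{_ : ℕ.NonZero p}} g n → substPow p g (n ℕ.* p) ≡ g n
substPow-multiple p g n with p ∣? (n ℕ.* p)
... | yes (divides c eq) = ≡.cong g (≡.sym (ℕ.*-cancelʳ-≡ n c p eq))
... | no p∤ = contradiction (n∣m*n n) p∤

substPow-nonmultiple : ∀ p g n → ¬ p ∣ n → substPow p g n ≡ 0ℚ
substPow-nonmultiple p g n p∤n with p ∣? n
... | yes p∣n = contradiction p∣n p∤n
... | no _ = ≡.refl

ι-id : ∀ n → Ringℤ.ι ℤ.+-*-commutativeRing (+ n) ≡ + n
ι-id zero = ≡.refl
ι-id (suc n) = ≡.trans (Congruence.ι-suc ℤ.+-*-commutativeRing n) (≡.cong (λ i → ℤ.1ℤ ℤ.+ i) (ι-id n))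

module Integrality (k : ℕ) (pr : Prime (suc k)) (q′ : ℕ) (q>1 : 1 ℕ.< suc q′) (p∣q-1 : suc k ∣ q′) where
  private
    p q : ℕ
    p = suc k
    q = suc q′
  open Rational
  open RogersRamanujanSeries q q>1 hiding (F)
  open CommutativeRing ℚ.+-*-commutativeRing using (_+_; _*_; -_; _-_)
  open Ringℤ ℚ.+-*-commutativeRing
  open Geometric ℚ.+-*-commutativeRing using (geom; geom-*; geom-cong)
  open GeometricFactors ℚ.+-*-commutativeRing using (geom-+; geom-factor)
  open Algebra.Properties.CommutativeSemiring.Exp (CommutativeRing.commutativeSemiring ℚ.+-*-commutativeRing)
    using (_^_; ^-congˡ; ^-assocʳ)
  open Polynomial using (Poly; ℤ[t])
  open Polynomial.Evaluation ℚ.+-*-commutativeRing t using (eval; evalHom; eval-t)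
  private
    module Zexp = Algebra.Properties.CommutativeSemiring.Exp (CommutativeRing.commutativeSemiring ℤ.+-*-commutativeRing)
    module Zgeom = Geometric ℤ.+-*-commutativeRing
    module ev = RingHom evalHom
  open ≡.≡-Reasoning

  ιHom : RingHom ℤ.+-*-commutativeRing ℚ.+-*-commutativeRing
  ιHom = record { ⟦_⟧ = ι ; ⟦⟧-cong = ≡.cong ι ; +-homo = ι-+ ; *-homo = ι-* ; 1-homo = ≡.refl }

  private
    p∤1 : ¬ p ∣ 1
    p∤1 p∣1 = ℕ.<-irrefl (≡.sym (∣1⇒≡1 p∣1)) (ℕ.nonTrivial⇒n>1 p {{prime⇒nonTrivial pr}})

    p∤q : ¬ p ∣ q
    p∤q p∣q = p∤1 (∣m+n∣m⇒∣n (≡.subst (p ∣_) (ℕ.+-comm 1 q′) p∣q) p∣q-1)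

    p∤q^ : ∀ n → ¬ p ∣ q ℕ.^ n
    p∤q^ zero = p∤1
    p∤q^ (suc n) p∣ with euclidsLemma q (q ℕ.^ n) pr p∣
    ... | inj₁ p∣q = p∤q p∣q
    ... | inj₂ p∣qⁿ = p∤q^ n p∣qⁿ

    G : ℕ → ℕ → ℤ
    G N m = Zgeom.geom ((+ q) Zexp.^ N) m

    -- As q^N ≡ 1 modulo p, the sum of m powers of q^N is congruent to m.
    p∤G : ∀ N m → ¬ p ∣ m → ¬ p ∣ ℤ.∣ G N m ∣
    p∤G N m p∤m p∣G = p∤m (ℤ∣.∣⇒∣ᵤ (ℤ∣.∣m+n∣n⇒∣m {+ p} {+ m} {s-1 ℤ.* h}
      (≡.subst (+ p ℤ∣.∣_) (≡.trans (proj₂ expansion) (≡.cong (λ i → i ℤ.+ s-1 ℤ.* h) (ι-id m))) (ℤ∣.∣ᵤ⇒∣ p∣G))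
      (ℤ∣.∣m⇒∣m*n h (≡.subst (+ p ℤ∣.∣_) (Zgeom.geom-* (+ q) N) (ℤ∣.∣n⇒∣m*n (Zgeom.geom (+ q) N) (ℤ∣.∣ᵤ⇒∣ p∣q-1))))))
      where
      s-1 h : ℤ
      s-1 = (+ q) Zexp.^ N ℤ.- ℤ.1ℤ
      expansion : ∃ λ h → G N m ≡ Ringℤ.ι ℤ.+-*-commutativeRing (+ m) ℤ.+ s-1 ℤ.* h
      expansion = GeometricFactors.geom-expansion ℤ.+-*-commutativeRing ((+ q) Zexp.^ N) m
      h = proj₁ expansion

    -- Each t = 1/q costs one factor q. The exponent `length g` exceeds the degree, which is
    -- harmless because q is prime to p.
    clear-denominators : ∀ g → ∃ λ a → x ^ length g * eval g ≡ ι a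
    clear-denominators [] = ℤ.0ℤ , ≡.refl
    clear-denominators (c ∷ g) = + (q ℕ.^ suc (length g)) ℤ.* c ℤ.+ proj₁ rest , (begin
      x * x ^ length g * (ι c + t * eval g)
        ≡⟨ solve 5 (λ x y c t e → x :* y :* (c :+ t :* e) := x :* y :* c :+ (t :* x) :* (y :* e)) ≡.refl x (x ^ length g) (ι c) t (eval g) ⟩
      x ^ suc (length g) * ι c + t * x * (x ^ length g * eval g)
        ≡⟨ ≡.cong₂ (λ a b → x ^ suc (length g) * ι c + a * b) t*x≡1 (proj₂ rest) ⟩
      x ^ suc (length g) * ι c + 1ℚ * ι (proj₁ rest) ≡⟨ ≡.cong₂ (λ a b → a * ι c + b) (≡.sym (ι-^ (suc (length g)))) (ℚ.*-identityˡ _) ⟩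
      ι (+ (q ℕ.^ suc (length g))) * ι c + ι (proj₁ rest) ≡⟨ ≡.cong (λ a → a + ι (proj₁ rest)) (ι-* (+ (q ℕ.^ suc (length g))) c) ⟨
      ι (+ (q ℕ.^ suc (length g)) ℤ.* c) + ι (proj₁ rest) ≡⟨ ι-+ (+ (q ℕ.^ suc (length g)) ℤ.* c) (proj₁ rest) ⟨
      ι (+ (q ℕ.^ suc (length g)) ℤ.* c ℤ.+ proj₁ rest) ∎)
      where
      rest : ∃ λ a → x ^ length g * eval g ≡ ι a
      rest = clear-denominators g

    ι≢0 : ∀ n .{{_ : ℕ.NonZero n}} → ι (+ n) ≢ 0ℚ
    ι≢0 n eq = ℕ.≢-nonZero⁻¹ n (ℤ.+-injective (ι-injective {+ n} {+ 0} eq))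

    geom≢0 : ∀ N .{{_ : ℕ.NonZero N}} → geom x N ≢ 0ℚ
    geom≢0 N eq = x^≢1 N (x-y≈0⇒x≈y (x ^ N) 1ℚ (≡.trans (≡.sym (geom-* x N))
      (≡.trans (≡.cong (λ y → y * (x - 1ℚ)) eq) (ℚ.*-zeroˡ (x - 1ℚ)))))

    -- Reversal of the order of summation: both sides are x + x² + ... + xⁿ.
    geom-reverse : ∀ n → x ^ n * geom t n ≡ x * geom x n
    geom-reverse zero = ≡.trans (ℚ.*-zeroʳ 1ℚ) (≡.sym (ℚ.*-zeroʳ x))
    geom-reverse (suc n) = begin
      x * x ^ n * (1ℚ + t * geom t n)
        ≡⟨ solve 4 (λ x y t g → x :* y :* (con (+ 1) :+ t :* g) := x :* y :+ (t :* x) :* (y :* g)) ≡.refl x (x ^ n) t (geom t n) ⟩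
      x * x ^ n + t * x * (x ^ n * geom t n) ≡⟨ ≡.cong₂ (λ a b → x * x ^ n + a * b) t*x≡1 (geom-reverse n) ⟩
      x * x ^ n + 1ℚ * (x * geom x n)
        ≡⟨ solve 3 (λ x y g → x :* y :+ con (+ 1) :* (x :* g) := x :* (g :+ y :* (con (+ 1) :+ x :* con (+ 0)))) ≡.refl x (x ^ n) (geom x n) ⟩
      x * (geom x n + x ^ n * geom x 1) ≡⟨ ≡.cong (λ y → x * y) (≡.trans (≡.cong (geom x) (ℕ.+-comm 1 n)) (geom-+ x n 1)) ⟨
      x * geom x (suc n) ∎

  -- After x^(mN) - 1 is factored, N cancels against N, and `geom x N` against `geom t N` up to
  -- powers of x. What remains in the denominator is m, the sum `G N m`, and the powers q^N and q^L
  -- from reversing the sum and evaluating g; each is prime to p.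
  integral-quotient : ∀ N .{{_ : ℕ.NonZero N}} m s g → ¬ p ∣ m →
    (x ^ (m ℕ.* N) - 1ℚ) * (ι (+ (m ℕ.* N)) * s) ≡ ι (+ N) * (geom t N * eval g) →
    InZp p ((x - 1ℚ) * s)
  integral-quotient N m s g p∤m hyp = integral p r D (+ q ℤ.* a) final p∤D
    where
    L : ℕ
    L = length g
    a D : ℤ
    a = proj₁ (clear-denominators g)
    D = + m ℤ.* G N m ℤ.* + (q ℕ.^ N) ℤ.* + (q ℕ.^ L)
    r Y G₁ G₂ : ℚ
    r = (x - 1ℚ) * s
    Y = eval g
    G₁ = geom x N
    G₂ = geom (x ^ N) m
    p∤* : ∀ i j → ¬ p ∣ ℤ.∣ i ∣ → ¬ p ∣ ℤ.∣ j ∣ → ¬ p ∣ ℤ.∣ i ℤ.* j ∣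
    p∤* i j p∤i p∤j p∣ij with euclidsLemma ℤ.∣ i ∣ ℤ.∣ j ∣ pr (≡.subst (p ∣_) (ℤ.abs-* i j) p∣ij)
    ... | inj₁ p∣i = p∤i p∣i
    ... | inj₂ p∣j = p∤j p∣j
    p∤D : ¬ p ∣ ℤ.∣ D ∣
    p∤D = p∤* (+ m ℤ.* G N m ℤ.* + (q ℕ.^ N)) (+ (q ℕ.^ L))
      (p∤* (+ m ℤ.* G N m) (+ (q ℕ.^ N)) (p∤* (+ m) (G N m) p∤m (p∤G N m p∤m)) (p∤q^ N)) (p∤q^ L)
    ιG : ι (G N m) ≡ G₂
    ιG = ≡.trans (map-geom ιHom ((+ q) Zexp.^ N) m) (geom-cong m (RingHom.^-homo ιHom (+ q) N))
    ιD : ι D ≡ ι (+ m) * G₂ * x ^ N * x ^ L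
    ιD = ≡.trans (ι-* (+ m ℤ.* G N m ℤ.* + (q ℕ.^ N)) (+ (q ℕ.^ L))) (≡.cong₂ _*_
      (≡.trans (ι-* (+ m ℤ.* G N m) (+ (q ℕ.^ N))) (≡.cong₂ _*_
        (≡.trans (ι-* (+ m) (G N m)) (≡.cong (λ y → ι (+ m) * y) ιG)) (ι-^ N))) (ι-^ L))
    factored : x ^ (m ℕ.* N) - 1ℚ ≡ G₁ * G₂ * (x - 1ℚ)
    factored = ≡.trans (≡.sym (geom-* x (m ℕ.* N))) (≡.cong (λ y → y * (x - 1ℚ)) (geom-factor x N m))
    reduced : ι (+ m) * r * (G₁ * G₂) ≡ geom t N * Y
    reduced = *-cancel (ι≢0 N) (begin
      ι (+ N) * (ι (+ m) * ((x - 1ℚ) * s) * (G₁ * G₂))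
        ≡⟨ solve 5 (λ n m d s g → n :* (m :* (d :* s) :* g) := (g :* d) :* ((m :* n) :* s)) ≡.refl (ι (+ N)) (ι (+ m)) (x - 1ℚ) s (G₁ * G₂) ⟩
      G₁ * G₂ * (x - 1ℚ) * (ι (+ m) * ι (+ N) * s)
        ≡⟨ ≡.cong₂ (λ a b → a * (b * s)) factored (Congruence.ι-ℕ* ℚ.+-*-commutativeRing m N) ⟨
      (x ^ (m ℕ.* N) - 1ℚ) * (ι (+ (m ℕ.* N)) * s) ≡⟨ hyp ⟩
      ι (+ N) * (geom t N * Y) ∎)
    cancelled : ι (+ m) * r * G₂ * x ^ N ≡ x * Y
    cancelled = *-cancel (geom≢0 N) (begin
      G₁ * (ι (+ m) * r * G₂ * x ^ N)
        ≡⟨ solve 5 (λ g m r h y → g :* (m :* r :* h :* y) := y :* (m :* r :* (g :* h))) ≡.refl G₁ (ι (+ m)) r G₂ (x ^ N) ⟩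
      x ^ N * (ι (+ m) * r * (G₁ * G₂)) ≡⟨ ≡.cong (λ y → x ^ N * y) reduced ⟩
      x ^ N * (geom t N * Y) ≡⟨ ℚ.*-assoc (x ^ N) (geom t N) Y ⟨
      x ^ N * geom t N * Y ≡⟨ ≡.cong (λ y → y * Y) (geom-reverse N) ⟩
      x * G₁ * Y ≡⟨ solve 3 (λ x g y → x :* g :* y := g :* (x :* y)) ≡.refl x G₁ Y ⟩
      G₁ * (x * Y) ∎)
    final : r * ι D ≡ ι (+ q ℤ.* a)
    final = begin
      r * ι D ≡⟨ ≡.cong (λ y → r * y) ιD ⟩
      r * (ι (+ m) * G₂ * x ^ N * x ^ L)
        ≡⟨ solve 5 (λ r m g y z → r :* (m :* g :* y :* z) := z :* (m :* r :* g :* y)) ≡.refl r (ι (+ m)) G₂ (x ^ N) (x ^ L) ⟩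
      x ^ L * (ι (+ m) * r * G₂ * x ^ N) ≡⟨ ≡.cong (λ y → x ^ L * y) cancelled ⟩
      x ^ L * (x * Y) ≡⟨ solve 3 (λ z x y → z :* (x :* y) := x :* (z :* y)) ≡.refl (x ^ L) x Y ⟩
      x * (x ^ L * Y) ≡⟨ ≡.cong (λ y → x * y) (proj₂ (clear-denominators g)) ⟩
      x * ι a ≡⟨ ι-* (+ q) a ⟨
      ι (+ q ℤ.* a) ∎

  private
    q^p>1 : 1 ℕ.< q ℕ.^ p
    q^p>1 = ℕ.<-≤-trans q>1 (ℕ.m≤m*n q (q ℕ.^ k) {{ℕ.m^n≢0 q k}})

    module B = RogersRamanujanSeries (q ℕ.^ p) q^p>1

    dlogA dlogB : ℕ → ℚ
    dlogA = Ratio.dlogv ℚ.+-*-commutativeRing t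
    dlogB = Ratio.dlogv ℚ.+-*-commutativeRing B.t

    Bx≡ : B.x ≡ x ^ p
    Bx≡ = ι-^ p

    Bt≡ : t ^ p ≡ B.t
    Bt≡ = *-cancel B.x≢0 (begin
      B.x * t ^ p ≡⟨ ≡.cong (λ y → y * t ^ p) Bx≡ ⟩
      x ^ p * t ^ p ≡⟨ Powers.^-inverse ℚ.+-*-commutativeRing {x} {t} p (≡.trans (ℚ.*-comm x t) t*x≡1) ⟩
      1ℚ ≡⟨ B.t*x≡1 ⟨
      B.t * B.x ≡⟨ ℚ.*-comm B.t B.x ⟩
      B.x * B.t ∎)

    open DlogDivisibility k pr using (b; ψb; dlog-divisible)
    ψ : RingHom ℤ[t] ℤ[t]
    ψ = Polynomial.Frobenius.ψ pr

    eval-b : ∀ n → eval (b n) ≡ dlogA n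
    eval-b = at (map-dlogv evalHom eval-t)

    eval-ψb : ∀ n → eval (RingHom.⟦_⟧ ψ (b n)) ≡ dlogB n
    eval-ψb n = ≡.trans (ev.⟦⟧-cong (ψb n)) (at (map-dlogv evalHom
      (≡.trans (ev.^-homo Polynomial.t p) (≡.trans (^-congˡ p eval-t) Bt≡))) n)

    1/p : ℚ
    1/p = 1ℚ ÷₀ ℕ→ℚ p

    1/p*p : 1/p * ι (+ p) ≡ 1ℚ
    1/p*p = begin
      1ℚ * inv (ℕ→ℚ p) * ι (+ p) ≡⟨ ≡.cong₂ _*_ (ℚ.*-identityˡ (inv (ℕ→ℚ p))) (ι≡/1 (+ p)) ⟩
      inv (ℕ→ℚ p) * ℕ→ℚ p ≡⟨ inv-inverse (λ eq → ι≢0 p (≡.trans (ι≡/1 (+ p)) eq)) ⟩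
      1ℚ ∎

    bracket : ℕ → ℚ
    bracket n = hSeries q n - 1/p * substPow p (hSeries (q ℕ.^ p)) n

    series≡ : ∀ n → theSeries p q n ≡ (x - 1ℚ) * bracket n
    series≡ n = ≡.cong (λ y → y * bracket n) (begin
      ℕ→ℚ q′ ≡⟨ ι≡/1 (+ q′) ⟨
      ι (+ q′) ≡⟨ solve 1 (λ y → y := (con (+ 1) :+ y) :- con (+ 1)) ≡.refl (ι (+ q′)) ⟩
      1ℚ + ι (+ q′) - 1ℚ ≡⟨ ≡.cong (λ y → y - 1ℚ) (Congruence.ι-suc ℚ.+-*-commutativeRing q′) ⟨
      x - 1ℚ ∎)

    -- Both terms acquire the same denominator, since xⁿᵖ - 1 = (xᵖ)ⁿ - 1 and the prefactor 1/p
    -- turns np into n.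
    bracket-dlog : ∀ n → (x ^ (n ℕ.* p) - 1ℚ) * (ι (+ (n ℕ.* p)) * bracket (n ℕ.* p)) ≡ dlogA (n ℕ.* p) - dlogB n
    bracket-dlog n = begin
      X * (ι (+ (n ℕ.* p)) * (h - 1/p * substPow p (hSeries (q ℕ.^ p)) (n ℕ.* p)))
        ≡⟨ ≡.cong₂ (λ a y → X * (a * (h - 1/p * y))) (Congruence.ι-ℕ* ℚ.+-*-commutativeRing n p) (substPow-multiple p (hSeries (q ℕ.^ p)) n) ⟩
      X * (ι (+ n) * ι (+ p) * (h - 1/p * h′))
        ≡⟨ solve 6 (λ X n p h i h′ → X :* (n :* p :* (h :- i :* h′)) := X :* (n :* p :* h) :- X :* ((i :* p) :* (n :* h′)))
             ≡.refl X (ι (+ n)) (ι (+ p)) h 1/p h′ ⟩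
      X * (ι (+ n) * ι (+ p) * h) - X * (1/p * ι (+ p) * (ι (+ n) * h′))
        ≡⟨ ≡.cong₂ (λ a c → X * (a * h) - X * (c * (ι (+ n) * h′))) (≡.sym (Congruence.ι-ℕ* ℚ.+-*-commutativeRing n p)) 1/p*p ⟩
      X * (ι (+ (n ℕ.* p)) * h) - X * (1ℚ * (ι (+ n) * h′))
        ≡⟨ ≡.cong₂ (λ a c → a - X * c) (h-dlog (n ℕ.* p)) (ℚ.*-identityˡ _) ⟩
      dlogA (n ℕ.* p) - X * (ι (+ n) * h′) ≡⟨ ≡.cong (λ y → dlogA (n ℕ.* p) - (y - 1ℚ) * (ι (+ n) * h′)) power ⟩
      dlogA (n ℕ.* p) - (B.x ^ n - 1ℚ) * (ι (+ n) * h′) ≡⟨ ≡.cong (λ y → dlogA (n ℕ.* p) - y) (B.h-dlog n) ⟩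
      dlogA (n ℕ.* p) - dlogB n ∎
      where
      X h h′ : ℚ
      X = x ^ (n ℕ.* p) - 1ℚ
      h = hSeries q (n ℕ.* p)
      h′ = hSeries (q ℕ.^ p) n
      power : x ^ (n ℕ.* p) ≡ B.x ^ n
      power = ≡.trans (≡.cong (x ^_) (ℕ.*-comm n p)) (≡.trans (≡.sym (^-assocʳ x p n)) (^-congˡ n (≡.sym Bx≡)))

    multiple : ∀ n .{{_ : ℕ.NonZero n}} → InZp p ((x - 1ℚ) * bracket (n ℕ.* p))
    multiple n = integral-quotient N m (bracket (n ℕ.* p)) g p∤m
      (≡.subst (λ e → (x ^ e - 1ℚ) * (ι (+ e) * bracket (n ℕ.* p)) ≡ ι (+ N) * (geom t N * eval g)) n≡ (begin
        (x ^ (n ℕ.* p) - 1ℚ) * (ι (+ (n ℕ.* p)) * bracket (n ℕ.* p)) ≡⟨ bracket-dlog n ⟩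
        dlogA (n ℕ.* p) - dlogB n ≡⟨ ≡.cong₂ (λ a c → a - c) (eval-b (n ℕ.* p)) (eval-ψb n) ⟨
        eval (b (n ℕ.* p)) - eval (RingHom.⟦_⟧ ψ (b n)) ≡⟨ eval-- (b (n ℕ.* p)) (RingHom.⟦_⟧ ψ (b n)) ⟨
        eval (b (n ℕ.* p) P.- RingHom.⟦_⟧ ψ (b n)) ≡⟨ ev.⟦⟧-cong (proj₂ divided) ⟩
        eval (N P.× (Geometric.geom ℤ[t] Polynomial.t N P.* g)) ≡⟨ ev.×-homo N (Geometric.geom ℤ[t] Polynomial.t N P.* g) ⟩
        _ ≡⟨ ι-× N _ ⟩
        ι (+ N) * eval (Geometric.geom ℤ[t] Polynomial.t N P.* g) ≡⟨ ≡.cong (λ y → ι (+ N) * y) (ev.*-homo (Geometric.geom ℤ[t] Polynomial.t N) g) ⟩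
        ι (+ N) * (eval (Geometric.geom ℤ[t] Polynomial.t N) * eval g)
          ≡⟨ ≡.cong (λ y → ι (+ N) * (y * eval g)) (≡.trans (map-geom evalHom Polynomial.t N) (geom-cong N eval-t)) ⟩
        ι (+ N) * (geom t N * eval g) ∎))
      where
      instance
        _ = prime⇒nonTrivial pr
        _ = ℕ.m*n≢0 n p
      module P where
        open CommutativeRing ℤ[t] public
        open import Algebra.Properties.Semiring.Mult semiring public using (_×_)
      factorisation : ∃₂ λ v m → n ℕ.* p ≡ m ℕ.* p ℕ.^ v Product.× ¬ p ∣ m
      factorisation = prime-power-factor p (n ℕ.* p)
      v m N : ℕ
      v = proj₁ factorisation
      m = proj₁ (proj₂ factorisation)
      N = p ℕ.^ v
      instance _ = ℕ.m^n≢0 p v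
      n≡ : n ℕ.* p ≡ m ℕ.* N
      n≡ = proj₁ (proj₂ (proj₂ factorisation))
      p∤m : ¬ p ∣ m
      p∤m = proj₂ (proj₂ (proj₂ factorisation))
      divided : ∃ λ g → b (n ℕ.* p) P.- RingHom.⟦_⟧ ψ (b n) P.≈ N P.× (Geometric.geom ℤ[t] Polynomial.t N P.* g)
      divided = dlog-divisible v n (divides m n≡)
      g : Poly
      g = proj₁ divided
      eval-- : ∀ f g → eval (f P.- g) ≡ eval f - eval g
      eval-- f g = ≡.trans (ev.+-homo f (P.- g)) (≡.cong (λ y → eval f + y) (ev.neg-homo g))

    -- Here N = 1, so both divisors are trivial and it suffices that bₙ has integer coefficients.
    nonmultiple : ∀ n → ¬ p ∣ n → InZp p ((x - 1ℚ) * bracket n)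
    nonmultiple n p∤n = integral-quotient 1 n (bracket n) (b n) p∤n
      (≡.subst (λ e → (x ^ e - 1ℚ) * (ι (+ e) * bracket n) ≡ ι (+ 1) * (geom t 1 * eval (b n))) (≡.sym (ℕ.*-identityʳ n)) (begin
        (x ^ n - 1ℚ) * (ι (+ n) * (hSeries q n - 1/p * substPow p (hSeries (q ℕ.^ p)) n))
          ≡⟨ ≡.cong (λ y → (x ^ n - 1ℚ) * (ι (+ n) * (hSeries q n - 1/p * y))) (substPow-nonmultiple p (hSeries (q ℕ.^ p)) n p∤n) ⟩
        (x ^ n - 1ℚ) * (ι (+ n) * (hSeries q n - 1/p * 0ℚ))
          ≡⟨ solve 4 (λ X n h i → X :* (n :* (h :- i :* con (+ 0))) := X :* (n :* h)) ≡.refl (x ^ n - 1ℚ) (ι (+ n)) (hSeries q n) 1/p ⟩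
        (x ^ n - 1ℚ) * (ι (+ n) * hSeries q n) ≡⟨ h-dlog n ⟩
        dlogA n ≡⟨ eval-b n ⟨
        eval (b n) ≡⟨ solve 2 (λ t y → y := con (+ 1) :* ((con (+ 1) :+ t :* con (+ 0)) :* y)) ≡.refl t (eval (b n)) ⟩
        ι (+ 1) * (geom t 1 * eval (b n)) ∎))

    -- The formula for hₙ divides by n, so n = 0 is treated apart; both logarithms are empty sums
    -- there.
    constant : InZp p ((x - 1ℚ) * bracket 0)
    constant = integral p ((x - 1ℚ) * bracket 0) (+ 1) (+ 0) (begin
      (x - 1ℚ) * (0ℚ - 1/p * substPow p (hSeries (q ℕ.^ p)) 0) * 1ℚ
        ≡⟨ ≡.cong (λ y → (x - 1ℚ) * (0ℚ - 1/p * y) * 1ℚ) (substPow-multiple p (hSeries (q ℕ.^ p)) 0) ⟩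
      (x - 1ℚ) * (0ℚ - 1/p * 0ℚ) * 1ℚ
        ≡⟨ solve 2 (λ d i → d :* (con (+ 0) :- i :* con (+ 0)) :* con (+ 1) := con (+ 0)) ≡.refl (x - 1ℚ) 1/p ⟩
      0ℚ ∎) p∤1

  integrality : InZpSeries p (theSeries p q)
  integrality n = ≡.subst (InZp p) (≡.sym (series≡ n)) (cases n (p ∣? n))
    where
    cases : ∀ n → Dec (p ∣ n) → InZp p ((x - 1ℚ) * bracket n)
    cases n (no p∤n) = nonmultiple n p∤n
    cases n (yes (divides zero ≡.refl)) = constant
    cases n (yes (divides c@(suc _) ≡.refl)) = multiple c

theorem2p8 : (p q : ℕ) → Prime p → IsPrimePower q → p ∣ q ∸ 1 →
    InZpSeries p (theSeries p q)
theorem2p8 zero q pr = contradiction pr ¬prime[0]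
theorem2p8 (suc k) q pr (ℓ , e@(suc _) , prℓ , _ , q≡) p∣q-1 = go q q>1 p∣q-1
  where
  q>1 : 1 ℕ.< q
  q>1 = ≡.subst (1 ℕ.<_) (≡.sym q≡) (ℕ.<-≤-trans (ℕ.nonTrivial⇒n>1 ℓ {{prime⇒nonTrivial prℓ}})
    (ℕ.m≤m*n ℓ _ {{ℕ.m^n≢0 ℓ (ℕ.pred e) {{prime⇒nonZero prℓ}}}}))
  -- Generalising q allows it to be written as `suc q′`, so that `q ∸ 1` becomes q′.
  go : ∀ q → 1 ℕ.< q → suc k ∣ q ∸ 1 → InZpSeries (suc k) (theSeries (suc k) q)
  go (suc q′) q>1 p∣q-1 = Integrality.integrality k pr q′ q>1 p∣q-1
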